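{- For all integers $n\ge 0$, $\alpha\ge 0$, $\beta\ge 0$ and every odd prime $p$: $$v_0(2^{2\alpha+2}p^{2\beta+1}(8pn+8i+p))\equiv 0 \pmod{2^{3\alpha+9}}\quad\text{for every } i\in\{1,2,3,\ldots,p-1\},$$ and $$v_0(2^{2\alpha+2}p^{2\beta}(8pn+8j+1))\equiv 0 \pmod{2^{3\alpha+9}}$$ for every integer $j$ with $0\le j\le p-1$ such that the Legendre symbol satisfies $\left(\frac{8j+1}{p}\right)=-1$.
   Context: The integer sequence $v_0(n)$, $n\ge 0$, is defined by the generating function (formal power series in $q$) $$\sum_{n=0}^\infty v_0(n)q^n=\sum_{n=0}^\infty \frac{q^{n^2}(-q;q^2)_n}{(q;q^2)_n},$$ where $(a;q)_0=1$ and $(a;q)_n=\prod_{i=1}^n(1-aq^{i-1})$ for $n\ge1$, so that $(-q;q^2)_n=\prod_{i=1}^n(1+q^{2i-1})$ and $(q;q^2)_n=\prod_{i=1}^n(1-q^{2i-1})$. -}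

module Defs where

open import Data.Fin.Base using (Fin; toℕ; fromℕ<)
open import Data.Fin.Properties using (any?; toℕ-fromℕ<)
open import Data.Integer.Base
  using (ℤ; +_; 0ℤ; 1ℤ; -1ℤ; _+_; _*_; _-_; -_)
open import Data.Integer.DivMod using (_%ℕ_; _/ℕ_; n%ℕd<d; a≡a%ℕn+[a/ℕn]*n)
open import Data.Integer.Divisibility.Signed
  using (_∣_; _∣?_; divides; ∣m∣n⇒∣m-n)
open import Data.Integer.Properties
  using (*-zeroˡ; *-identityˡ; +-inverseˡ)
open import Data.Integer.Tactic.RingSolver using (solve-∀)
open import Data.Nat.Base as ℕ using (ℕ; zero; suc; z≤n; s≤s; NonZero)
open import Data.Nat.Primality using (Prime; prime⇒nonZero)
open import Data.Nat.Properties using (_≟_; ≤-<-trans; <-irrefl)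
open import Data.Product.Base using (∃-syntax; _,_)
open import Relation.Binary.PropositionalEquality
open import Relation.Nullary.Decidable using (Dec; yes; no; map′)
open import Relation.Nullary.Negation using (contradiction)

-- Formal power series in q over ℤ, as coefficient sequences.

Series : Set
Series = ℕ → ℤ

∑≤ : ℕ → (ℕ → ℤ) → ℤ
∑≤ zero    f = f 0
∑≤ (suc n) f = f 0 + ∑≤ n (λ k → f (suc k))

infixl 6 _⊖_
infixl 7 _⊛_ _⊘_
infixr 8 _^ˢ_

q^_ : ℕ → Series
(q^ a) n with a ≟ n
... | yes _ = 1ℤ
... | no  _ = 0ℤ

1ˢ : Series
1ˢ = q^ 0

_⊖_ : Series → Series → Series
(f ⊖ g) n = f n - g n

negˢ : Series → Series
negˢ f n = - f n

_⊛_ : Series → Series → Series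
(f ⊛ g) n = ∑≤ n (λ k → f k * g (n ℕ.∸ k))

_^ˢ_ : Series → ℕ → Series
f ^ˢ zero  = 1ˢ
f ^ˢ suc n = f ⊛ f ^ˢ n

-- The inverse g of a series f with f 0 ≡ 1 satisfies g 0 = 1 and
-- g (n+1) = - ∑_{k≤n} f (k+1) g (n-k).  To make this recursion structural,
-- `inv-rev f n k` is g (n-k) for k ≤ n (and a junk value for k > n).
inv-rev : Series → ℕ → ℕ → ℤ
inv-rev f zero    _       = 1ℤ
inv-rev f (suc n) zero    = - ∑≤ n (λ k → f (suc k) * inv-rev f n k)
inv-rev f (suc n) (suc k) = inv-rev f n k

-- Meaningful only when f 0 ≡ 1; see ⊛-inverseʳ.
inv : Series → Series
inv f n = inv-rev f n 0

_⊘_ : Series → Series → Series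
f ⊘ g = f ⊛ inv g

-- (a;x)_n = ∏_{i=1}^n (1 - a x^{i-1})
poch : Series → Series → ℕ → Series
poch a x zero    = 1ˢ
poch a x (suc n) = poch a x n ⊛ (1ˢ ⊖ a ⊛ x ^ˢ n)

-- The sum ∑_{n≥0} F n of a family in which F n only involves powers q^m with
-- m ≥ n, so that only F 0, …, F m contribute to the coefficient of q^m.
∑ˢ : (ℕ → Series) → Series
∑ˢ F m = ∑≤ m (λ n → F n m)

v₀-term : ℕ → Series
v₀-term n =
  q^ (n ℕ.* n) ⊛ poch (negˢ (q^ 1)) (q^ 2) n ⊘ poch (q^ 1) (q^ 2) n

v₀ : ℕ → ℤ
v₀ = ∑ˢ v₀-term

IsSquareMod : ℤ → ℕ → Set
IsSquareMod a p = ∃[ x ] + p ∣ x * x - a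

isSquareMod? : ∀ a p .{{_ : NonZero p}} → Dec (IsSquareMod a p)
isSquareMod? a p =
  map′ (λ (r , d) → + toℕ r , d) reduce
       (any? λ (r : Fin p) → + p ∣? (+ toℕ r * + toℕ r - a))
  where
  square-shift : ∀ r t m a →
    (r + t * m) * (r + t * m) - a - (t * (r + r + t * m)) * m ≡ r * r - a
  square-shift = solve-∀

  reduce : IsSquareMod a p → ∃[ r ] + p ∣ + toℕ {p} r * + toℕ r - a
  reduce (x , d) =
    fromℕ< (n%ℕd<d x p) , subst IsRoot (sym (toℕ-fromℕ< (n%ℕd<d x p))) residue
    where
    IsRoot : ℕ → Set
    IsRoot r = + p ∣ + r * + r - a
    t = x /ℕ p
    residue : IsRoot (x %ℕ p)
    residue = subst (+ p ∣_)
      (trans (cong (λ y → y * y - a - (t * (+ (x %ℕ p) + + (x %ℕ p) + t * + p)) * + p)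
                   (a≡a%ℕn+[a/ℕn]*n x p))
             (square-shift (+ (x %ℕ p)) t (+ p) a))
      (∣m∣n⇒∣m-n d (divides (t * (+ (x %ℕ p) + + (x %ℕ p) + t * + p)) refl))

legendre : ℤ → {p : ℕ} → Prime p → ℤ
legendre a {p} p-prime with + p ∣? a | isSquareMod? a p {{prime⇒nonZero p-prime}}
... | yes _ | _     = 0ℤ
... | no  _ | yes _ = 1ℤ
... | no  _ | no  _ = -1ℤ

-- Justification of `inv` and of the finite sum in `∑ˢ`.

∑≤-cong : ∀ n {f g : ℕ → ℤ} → (∀ k → k ℕ.≤ n → f k ≡ g k) → ∑≤ n f ≡ ∑≤ n g
∑≤-cong zero    e = e 0 z≤n
∑≤-cong (suc n) e = cong₂ _+_ (e 0 z≤n) (∑≤-cong n λ k k≤n → e (suc k) (s≤s k≤n))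

∑≤-zero : ∀ n {f : ℕ → ℤ} → (∀ k → k ℕ.≤ n → f k ≡ 0ℤ) → ∑≤ n f ≡ 0ℤ
∑≤-zero zero    e = e 0 z≤n
∑≤-zero (suc n) e =
  cong₂ _+_ (e 0 z≤n) (∑≤-zero n λ k k≤n → e (suc k) (s≤s k≤n))

inv-rev-∸ : ∀ f n k → k ℕ.≤ n → inv-rev f n k ≡ inv f (n ℕ.∸ k)
inv-rev-∸ f n       zero    _         = refl
inv-rev-∸ f (suc n) (suc k) (s≤s k≤n) = inv-rev-∸ f n k k≤n

⊛-inverseʳ : ∀ f → f 0 ≡ 1ℤ → ∀ n → (f ⊛ inv f) n ≡ 1ˢ n
⊛-inverseʳ f f0≡1 zero    = cong (_* 1ℤ) f0≡1
⊛-inverseʳ f f0≡1 (suc n) = begin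
  f 0 * - s + ∑≤ n (λ k → f (suc k) * inv f (n ℕ.∸ k))
    ≡⟨ cong₂ _+_ (trans (cong (_* - s) f0≡1) (*-identityˡ (- s)))
                 (∑≤-cong n λ k k≤n → cong (f (suc k) *_) (sym (inv-rev-∸ f n k k≤n))) ⟩
  - s + s
    ≡⟨ +-inverseˡ s ⟩
  0ℤ ∎
  where
  open ≡-Reasoning
  s = ∑≤ n (λ k → f (suc k) * inv-rev f n k)

poch-constant : ∀ a x n → a 0 ≡ 0ℤ → poch a x n 0 ≡ 1ℤ
poch-constant a x zero    _    = refl
poch-constant a x (suc n) a0≡0
  rewrite poch-constant a x n a0≡0 | a0≡0 = refl

⊛-order : ∀ a f g → (∀ m → m ℕ.< a → f m ≡ 0ℤ) → ∀ m → m ℕ.< a → (f ⊛ g) m ≡ 0ℤ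
⊛-order a f g f≡0 m m<a = ∑≤-zero m λ k k≤m →
  trans (cong (_* g (m ℕ.∸ k)) (f≡0 k (≤-<-trans k≤m m<a))) (*-zeroˡ (g (m ℕ.∸ k)))

q^-order : ∀ a m → m ℕ.< a → (q^ a) m ≡ 0ℤ
q^-order a m m<a with a ≟ m
... | yes refl = contradiction m<a (<-irrefl refl)
... | no  _    = refl

v₀-term-order : ∀ n m → m ℕ.< n ℕ.* n → v₀-term n m ≡ 0ℤ
v₀-term-order n =
  ⊛-order (n ℕ.* n) _ (inv (poch (q^ 1) (q^ 2) n))
    (⊛-order (n ℕ.* n) _ (poch (negˢ (q^ 1)) (q^ 2) n) (q^-order (n ℕ.* n)))

{-# OPTIONS --safe #-}
module Submission where

-- Write φ(q) = ∑_{z ∈ ℤ} q^{z²}, ψ(q) = ∑_{k ≥ 0} q^{k(k+1)/2}, ε(q) = (-q;q²)_∞.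
--
-- The terms of v₀(q) and of v₀(-q) are the terms n ≥ 0 and n ≤ 0 of the
-- bilateral sum ∑_n q^{n²} (-q;q²)_n / (q;q²)_n.  Euler's expansions turn
-- ε(q) ε(-q) times this sum into
--   ∑_{r,s} (-1)^r / ((q²;q²)_r (q²;q²)_s) ∑_n q^{(n+r)² + (n-s)²},
-- where the sum over n depends only on N = r + s, and where the sum over
-- r + s = N of the coefficients is 1/(q⁴;q⁴)_{N/2} for even N and 0 for odd N.
-- The value is φ(q²) ε(q²).  With an additional sign (-1)^{n+r} the same
-- computation gives ε(q)² φ(-q) = ε(-q²) φ(-q²).  Hence
--   2 ∑ v₀(2n) qⁿ - 1 = φ(q)²/φ(-q²),   2 ∑ v₀(4n) qⁿ - 1 = φ(q)²/φ(-q).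
--
-- Put x = φ(q⁴)/φ(-q⁴), y = 2qψ(q⁸)/φ(-q⁴) and T = (φ(q)/φ(-q))⁴ - 1.  Then
-- x⁴ - y⁴ = 1, φ = φ(-q⁴)(x + y), T(q⁴) = y⁴ and T = 8xy(x² + y²)⁵(x + y)⁴, so
-- extracting the exponents divisible by 4 maps φ T ℤ[T] into 8 φ ℤ[T].  After α ≥ 1
-- steps φ(q)²/φ(-q) becomes φ (n + 2^{3α-1} T f) with f ∈ ℤ[T]; since 16 divides
-- T and 128 divides its even part, the coefficient at 8N + 1 is a multiple of
-- ψ(N) modulo 2^{3α+10}.  Finally ψ(N) = 0 unless 8N + 1 is a square, and the
-- indices in question are nonsquares congruent to 1 modulo 8.

-- The signed use of the triple sum supplies the theta identities: cancelling ε(q) against ε(-q²) =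
-- ε(q) ε(-q) gives ε(q) φ(-q) = ε(-q) φ(-q²), and the product of this with its image under q ↦ -q
-- is φ(q) φ(-q) = φ(-q²)², the source of x⁴ - y⁴ = 1. The gain of 8 rests on a grading. A series in
-- q⁴ times y^r lives on exponents congruent to r modulo 4, and T/8 is a form of degree 16 in x and
-- y, so φ T g(T) / 8 is φ(-q⁴) times a sum of forms of degree 1 modulo 4. Extracting the exponents
-- divisible by 4 keeps powers of y divisible by 4, hence powers of x congruent to 1; then x⁴ and y⁴
-- become 1 + T and T, and φ(-q⁴) x becomes φ. A constant multiple of φ gains no 8, but it is fixed
-- by the extraction and ends as a multiple of ψ, so it can be split off before every step.

open import Defs
open import Algebra.Bundles using (CommutativeRing; RawRing)
open import Algebra.Structures using (IsCommutativeRing)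
open import Algebra.Solver.Ring.AlmostCommutativeRing using (fromCommutativeRing; _-Raw-AlmostCommutative⟶_)
import Algebra.Solver.Ring
open import Data.Nat.Base as ℕ using (ℕ; zero; suc; z≤n; s≤s)
import Data.Nat.Divisibility as ℕ-Div
import Data.Nat.Properties as ℕₚ
import Data.Nat.Tactic.RingSolver as ℕ-Solver
open import Data.Integer.Base as ℤ using (ℤ; +_; -[1+_]; 0ℤ; 1ℤ; -1ℤ)
import Data.Integer.Properties as ℤₚ
import Data.Integer.Tactic.RingSolver as ℤ-Solver
open import Data.Maybe.Base using (Maybe; just; nothing)
open import Data.Product.Base using (_×_; _,_; ∃-syntax)
open import Data.Sum.Base using (inj₁; inj₂)
open import Function.Base using (_∘_)
open import Level using (0ℓ)
open import Relation.Binary.PropositionalEquality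
open import Relation.Nullary.Decidable using (yes; no)
open import Relation.Nullary.Negation using (contradiction; ¬_)

-- The ring of power series

infix 4 _≈_
-- A record and not the bare function type: the type of a proof then determines both series, so that
-- implicit arguments can be inferred in long chains.
record _≈_ (f g : Series) : Set where
  constructor pointwise
  field at : ∀ n → f n ≡ g n
open _≈_

infixl 7 _·_
infixl 6 _⊕_
infix 8 ⊝_

module _ where
  open import Data.Integer.Base using (_+_; _*_; -_)

  sum-+ : ∀ n f g → ∑≤ n (λ k → f k + g k) ≡ ∑≤ n f + ∑≤ n g
  sum-+ zero f g = refl
  sum-+ (suc n) f g rewrite sum-+ n (f ∘ suc) (g ∘ suc) =
    interchange (f 0) (g 0) _ _
    where
    interchange : ∀ a b c d → a + b + (c + d) ≡ a + c + (b + d)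
    interchange = ℤ-Solver.solve-∀

  sum-*ˡ : ∀ n c f → ∑≤ n (λ k → c * f k) ≡ c * ∑≤ n f
  sum-*ˡ zero c f = refl
  sum-*ˡ (suc n) c f rewrite sum-*ˡ n c (f ∘ suc) = sym (ℤₚ.*-distribˡ-+ c _ _)

  ⊛-cong : ∀ n {f f' g g'} → (∀ k → k ℕ.≤ n → f k ≡ f' k) → (∀ k → k ℕ.≤ n → g k ≡ g' k) →
           (f ⊛ g) n ≡ (f' ⊛ g') n
  ⊛-cong n p q = ∑≤-cong n λ k k≤n → cong₂ _*_ (p k k≤n) (q (n ℕ.∸ k) (ℕₚ.m∸n≤m n k))

  ⊛-distribʳ : ∀ n f g h → ((λ k → f k + g k) ⊛ h) n ≡ (f ⊛ h) n + (g ⊛ h) n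
  ⊛-distribʳ n f g h =
    trans (∑≤-cong n λ k _ → ℤₚ.*-distribʳ-+ (h (n ℕ.∸ k)) (f k) (g k)) (sum-+ n _ _)

  ⊛-scaleˡ : ∀ n c f h → ((λ k → c * f k) ⊛ h) n ≡ c * (f ⊛ h) n
  ⊛-scaleˡ n c f h =
    trans (∑≤-cong n λ k _ → ℤₚ.*-assoc c (f k) (h (n ℕ.∸ k))) (sum-*ˡ n c _)

  ⊛-sucʳ : ∀ n f g → (f ⊛ g) (suc n) ≡ f (suc n) * g 0 + (f ⊛ (g ∘ suc)) n
  ⊛-sucʳ zero f g = ℤₚ.+-comm (f 0 * g 1) (f 1 * g 0)
  ⊛-sucʳ (suc n) f g rewrite ⊛-sucʳ n (f ∘ suc) g
      = rotate (f 0 * g (suc (suc n))) (f (suc (suc n)) * g 0) (((f ∘ suc) ⊛ (g ∘ suc)) n)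
    where
    rotate : ∀ a b c → a + (b + c) ≡ b + (a + c)
    rotate = ℤ-Solver.solve-∀

  ⊛-comm : ∀ n f g → (f ⊛ g) n ≡ (g ⊛ f) n
  ⊛-comm zero f g = ℤₚ.*-comm (f 0) (g 0)
  ⊛-comm (suc n) f g = trans (cong₂ _+_ (ℤₚ.*-comm (f 0) (g (suc n))) (⊛-comm n (f ∘ suc) g))
                             (sym (⊛-sucʳ n g f))

  ⊛-assoc : ∀ n f g h → ((f ⊛ g) ⊛ h) n ≡ (f ⊛ (g ⊛ h)) n
  ⊛-assoc zero f g h = ℤₚ.*-assoc (f 0) (g 0) (h 0)
  ⊛-assoc (suc n) f g h = begin
    f 0 * g 0 * h (suc n) + ((λ k → f 0 * g (suc k) + ((f ∘ suc) ⊛ g) k) ⊛ h) n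
      ≡⟨ cong (_+_ (f 0 * g 0 * h (suc n))) (trans (⊛-distribʳ n (λ k → f 0 * g (suc k)) ((f ∘ suc) ⊛ g) h)
           (cong₂ _+_ (⊛-scaleˡ n (f 0) (g ∘ suc) h) (⊛-assoc n (f ∘ suc) g h))) ⟩
    f 0 * g 0 * h (suc n) + (f 0 * ((g ∘ suc) ⊛ h) n + ((f ∘ suc) ⊛ (g ⊛ h)) n)
      ≡⟨ regroup (f 0) (g 0) (h (suc n)) (((g ∘ suc) ⊛ h) n) (((f ∘ suc) ⊛ (g ⊛ h)) n) ⟩
    f 0 * (g ⊛ h) (suc n) + ((f ∘ suc) ⊛ (g ⊛ h)) n ∎
    where
    open ≡-Reasoning
    regroup : ∀ a b c x y → a * b * c + (a * x + y) ≡ a * (b * c + x) + y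
    regroup = ℤ-Solver.solve-∀

-- Type checking treats these copies of the operations as rigid symbols: equations are matched by
-- shape, and products are not unfolded into sums of coefficients.
opaque
  _·_ _⊕_ : Series → Series → Series
  _·_ = _⊛_
  (f ⊕ g) n = f n ℤ.+ g n

  ⊝_ : Series → Series
  ⊝_ = negˢ

  C : ℤ → Series
  C c zero    = c
  C c (suc n) = 0ℤ

  X : ℕ → Series
  X a = q^ a

0# 1# : Series
0# = C 0ℤ
1# = C 1ℤ

module _ where
  open import Data.Integer.Base using (_+_; _*_; -_)

  opaque
    unfolding _·_ _⊕_ C X

    ·-def : ∀ f g → f ⊛ g ≈ f · g
    ·-def f g = pointwise λ _ → refl

    X-def : ∀ a → q^ a ≈ X a
    X-def a = pointwise λ _ → refl

    ⊕-at : ∀ f g n → (f ⊕ g) n ≡ f n + g n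
    ⊕-at f g n = refl

    ⊝-at : ∀ f n → (⊝ f) n ≡ - f n
    ⊝-at f n = refl

    C-at-suc : ∀ c n → C c (suc n) ≡ 0ℤ
    C-at-suc c n = refl

    C-at-0 : ∀ c → C c 0 ≡ c
    C-at-0 c = refl

    ·-at-0 : ∀ f g → (f · g) 0 ≡ f 0 * g 0
    ·-at-0 f g = refl

    ·-local : ∀ n {f f' g g'} → (∀ k → k ℕ.≤ n → f k ≡ f' k) → (∀ k → k ℕ.≤ n → g k ≡ g' k) →
              (f · g) n ≡ (f' · g') n
    ·-local = ⊛-cong

    zero-· : ∀ n f → ((λ _ → 0ℤ) · f) n ≡ 0ℤ
    zero-· n f = ∑≤-zero n λ k _ → refl

    C·-at : ∀ c f n → (C c · f) n ≡ c * f n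
    C·-at c f zero    = refl
    C·-at c f (suc n) = trans (cong (_+_ (c * f (suc n))) (zero-· n f)) (ℤₚ.+-identityʳ _)

    X-suc : ∀ a n → X (suc a) (suc n) ≡ X a n
    X-suc a n with a ℕₚ.≟ n | suc a ℕₚ.≟ suc n
    ... | yes _ | yes _ = refl
    ... | no  _ | no  _ = refl
    ... | yes p | no ¬p = contradiction (cong suc p) ¬p
    ... | no ¬p | yes p = contradiction (ℕₚ.suc-injective p) ¬p

    X-suc-0 : ∀ a → X (suc a) 0 ≡ 0ℤ
    X-suc-0 a = refl

    X-0 : 1# ≈ X 0
    X-0 = pointwise λ { zero → refl ; (suc n) → refl }

    isCommutativeRing : IsCommutativeRing _≈_ _⊕_ _·_ ⊝_ 0# 1#
    isCommutativeRing = record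
        { isRing = record
          { +-isAbelianGroup = record
            { isGroup = record
              { isMonoid = record
                { isSemigroup = record
                  { isMagma = record
                    { isEquivalence = record
                      { refl = pointwise λ _ → refl
                      ; sym = λ p → pointwise λ n → sym (at p n)
                      ; trans = λ p q → pointwise λ n → trans (at p n) (at q n) }
                    ; ∙-cong = λ p q → pointwise λ n → cong₂ _+_ (at p n) (at q n) }
                  ; assoc = λ f g h → pointwise λ n → ℤₚ.+-assoc (f n) (g n) (h n) }
                ; identity = (λ f → pointwise λ { zero → ℤₚ.+-identityˡ _ ; (suc n) → ℤₚ.+-identityˡ _ })
                           , (λ f → pointwise λ { zero → ℤₚ.+-identityʳ _ ; (suc n) → ℤₚ.+-identityʳ _ }) }
              ; inverse = (λ f → pointwise λ { zero → ℤₚ.+-inverseˡ (f 0) ; (suc n) → ℤₚ.+-inverseˡ (f (suc n)) })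
                        , (λ f → pointwise λ { zero → ℤₚ.+-inverseʳ (f 0) ; (suc n) → ℤₚ.+-inverseʳ (f (suc n)) })
              ; ⁻¹-cong = λ p → pointwise λ n → cong -_ (at p n) }
            ; comm = λ f g → pointwise λ n → ℤₚ.+-comm (f n) (g n) }
          ; *-cong = λ p q → pointwise λ n → ⊛-cong n (λ k _ → at p k) (λ k _ → at q k)
          ; *-assoc = λ f g h → pointwise λ n → ⊛-assoc n f g h
          ; *-identity = identityˡ , λ f → pointwise λ n → trans (⊛-comm n f 1#) (at (identityˡ f) n)
          ; distrib = (λ f g h → pointwise λ n →
                         trans (⊛-comm n f (g ⊕ h)) (trans (⊛-distribʳ n g h f)
                             (cong₂ _+_ (⊛-comm n g f) (⊛-comm n h f))))
                    , (λ f g h → pointwise λ n → ⊛-distribʳ n g h f) }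
        ; *-comm = λ f g → pointwise λ n → ⊛-comm n f g }
      where
      identityˡ : ∀ f → 1# · f ≈ f
      identityˡ f = pointwise λ n → trans (C·-at 1ℤ f n) (ℤₚ.*-identityˡ (f n))

    C-+ : ∀ a b → C (a + b) ≈ C a ⊕ C b
    C-+ a b = pointwise λ { zero → refl ; (suc n) → refl }

    C-* : ∀ a b → C (a * b) ≈ C a · C b
    C-* a b = pointwise λ { zero → refl
      ; (suc n) → sym (trans (C·-at a (C b) (suc n)) (ℤₚ.*-zeroʳ a)) }

    C-neg : ∀ a → C (- a) ≈ ⊝ C a
    C-neg a = pointwise λ { zero → refl ; (suc n) → refl }

series-ring : CommutativeRing 0ℓ 0ℓ
series-ring = record { isCommutativeRing = isCommutativeRing }

module 𝓢 = CommutativeRing series-ring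

≈-refl : ∀ {f} → f ≈ f
≈-refl = pointwise λ _ → refl

≈-sym : ∀ {f g} → f ≈ g → g ≈ f
≈-sym p = pointwise λ n → sym (at p n)

infixr 4 _⟫_
_⟫_ : ∀ {f g h} → f ≈ g → g ≈ h → f ≈ h
p ⟫ q = pointwise λ n → trans (at p n) (at q n)

open 𝓢 using () renaming (+-cong to ⊕-cong; *-cong to ·-cong; -‿cong to ⊝-cong)

private
  ℤ-rawRing : RawRing 0ℓ 0ℓ
  ℤ-rawRing = record { _≈_ = _≡_ ; _+_ = ℤ._+_ ; _*_ = ℤ._*_ ; -_ = ℤ.-_ ; 0# = 0ℤ ; 1# = 1ℤ }

  constants : ℤ-rawRing -Raw-AlmostCommutative⟶ fromCommutativeRing series-ring
  constants = record
    { ⟦_⟧ = C ; +-homo = C-+ ; *-homo = C-* ; -‿homo = C-neg ; 0-homo = ≈-refl ; 1-homo = ≈-refl }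

  constants-≟ : (a b : ℤ) → Maybe (C a ≈ C b)
  constants-≟ a b with a ℤₚ.≟ b
  ... | yes refl = just ≈-refl
  ... | no  _    = nothing

open Algebra.Solver.Ring ℤ-rawRing (fromCommutativeRing series-ring) constants constants-≟
  using (solve; _:=_; con; _:+_; _:*_; :-_)

-- Even and odd parts, q ↦ q² and q ↦ -q

dbl : ℕ → ℕ
dbl zero    = zero
dbl (suc n) = suc (suc (dbl n))

data Parity : ℕ → Set where
  even : ∀ n → Parity (dbl n)
  odd  : ∀ n → Parity (suc (dbl n))

parity : ∀ n → Parity n
parity zero = even 0
parity (suc n) with parity n
... | even k = odd k
... | odd k  = even (suc k)

sg : ℕ → ℤ
sg zero    = 1ℤ
sg (suc n) = ℤ.- sg n

-- dil is q ↦ q² and alt is q ↦ -q.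
opaque
  ev od dil alt : Series → Series
  ev f n = f (dbl n)
  od f n = f (suc (dbl n))

  dil f zero          = f 0
  dil f (suc zero)    = 0ℤ
  dil f (suc (suc n)) = dil (f ∘ suc) n

  alt f zero    = f 0
  alt f (suc n) = ℤ.- alt (f ∘ suc) n

module _ where
  open import Data.Integer.Base using (_+_; _*_; -_)

  opaque
    unfolding ev _·_ _⊕_ C X

    ev-at : ∀ f n → ev f n ≡ f (dbl n)
    ev-at f n = refl

    od-at : ∀ f n → od f n ≡ f (suc (dbl n))
    od-at f n = refl

    ev-cong : ∀ {f g} → f ≈ g → ev f ≈ ev g
    ev-cong p = pointwise λ n → at p (dbl n)

    od-cong : ∀ {f g} → f ≈ g → od f ≈ od g
    od-cong p = pointwise λ n → at p (suc (dbl n))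

    -- Reduces the laws of `dil` and `alt` to ring identities between even and odd parts.
    sections : ∀ {f g} → ev f ≈ ev g → od f ≈ od g → f ≈ g
    sections {f} {g} p q = pointwise λ n → go n (parity n)
      where
      go : ∀ n → Parity n → f n ≡ g n
      go .(dbl k)       (even k) = at p k
      go .(suc (dbl k)) (odd k)  = at q k

    dil-local : ∀ n {f g} → (∀ k → k ℕ.≤ n → f k ≡ g k) → dil f n ≡ dil g n
    dil-local zero          p = p 0 z≤n
    dil-local (suc zero)    p = refl
    dil-local (suc (suc n)) p = dil-local n λ k k≤n → p (suc k) (s≤s (ℕₚ.m≤n⇒m≤1+n k≤n))

    alt-local : ∀ n {f g} → f n ≡ g n → alt f n ≡ alt g n
    alt-local zero    p = p
    alt-local (suc n) p = cong -_ (alt-local n p)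

    dil-cong : ∀ {f g} → f ≈ g → dil f ≈ dil g
    dil-cong p = pointwise λ n → dil-local n λ k _ → at p k

    alt-cong : ∀ {f g} → f ≈ g → alt f ≈ alt g
    alt-cong p = pointwise λ n → alt-local n (at p n)

    ev-dil : ∀ f → ev (dil f) ≈ f
    ev-dil f = pointwise (go f)
      where
      go : ∀ f n → dil f (dbl n) ≡ f n
      go f zero    = refl
      go f (suc n) = go (f ∘ suc) n

    od-dil : ∀ f → od (dil f) ≈ 0#
    od-dil f = pointwise λ { zero → refl ; (suc n) → go (f ∘ suc) n }
      where
      go : ∀ f n → dil f (suc (dbl n)) ≡ 0ℤ
      go f zero    = refl
      go f (suc n) = go (f ∘ suc) n

    ev-alt : ∀ f → ev (alt f) ≈ ev f
    ev-alt f = pointwise (go f)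
      where
      go : ∀ f n → alt f (dbl n) ≡ f (dbl n)
      go f zero    = refl
      go f (suc n) = trans (ℤₚ.neg-involutive _) (go (f ∘ suc ∘ suc) n)

    od-alt : ∀ f → od (alt f) ≈ ⊝ od f
    od-alt f = pointwise λ n → cong -_ (at (ev-alt (f ∘ suc)) n)

    ev-⊕ : ∀ f g → ev (f ⊕ g) ≈ ev f ⊕ ev g
    ev-⊕ f g = ≈-refl

    od-⊕ : ∀ f g → od (f ⊕ g) ≈ od f ⊕ od g
    od-⊕ f g = ≈-refl

    ev-C : ∀ c → ev (C c) ≈ C c
    ev-C c = pointwise λ { zero → refl ; (suc n) → refl }

    od-C : ∀ c → od (C c) ≈ 0#
    od-C c = pointwise λ { zero → refl ; (suc n) → refl }

    X-+ : ∀ a b → X a · X b ≈ X (a ℕ.+ b)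
    X-+ zero    b = pointwise λ n → trans (⊛-cong n
        {g = X b} (λ k _ → sym (at X-0 k)) (λ _ _ → refl)) (at (𝓢.*-identityˡ (X b)) n)
    X-+ (suc a) b = pointwise λ
      { zero → trans (cong (_* X b 0) (X-suc-0 a)) (sym (X-suc-0 (a ℕ.+ b)))
      ; (suc n) → begin
          0ℤ * X b (suc n) + ((X (suc a) ∘ suc) ⊛ X b) n  ≡⟨ ℤₚ.+-identityˡ _ ⟩
          ((X (suc a) ∘ suc) ⊛ X b) n  ≡⟨ ⊛-cong n {g = X b} (λ k _ → X-suc a k) (λ _ _ → refl) ⟩
          (X a ⊛ X b) n  ≡⟨ at (X-+ a b) n ⟩
          X (a ℕ.+ b) n  ≡⟨ X-suc (a ℕ.+ b) n ⟨
          X (suc a ℕ.+ b) (suc n) ∎ }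
      where open ≡-Reasoning

    X1·-suc : ∀ f n → (X 1 · f) (suc n) ≡ f n
    X1·-suc f n = begin
      0ℤ * f (suc n) + ((X 1 ∘ suc) ⊛ f) n  ≡⟨ ℤₚ.+-identityˡ _ ⟩
      ((X 1 ∘ suc) ⊛ f) n  ≡⟨ ⊛-cong n {g = f} (λ k _ → trans (X-suc 0 k) (sym (at X-0 k))) (λ _ _ → refl) ⟩
      (1# ⊛ f) n  ≡⟨ at (𝓢.*-identityˡ f) n ⟩
      f n ∎
      where open ≡-Reasoning

    -- In f = f₀(q²) + q f₁(q²) two odd parts multiply to q² f₁(q²) g₁(q²), whence the `X 1`. The
    -- induction removes two coefficients of `f` at a time.
    ev-· : ∀ f g → ev (f · g) ≈ ev f · ev g ⊕ X 1 · (od f · od g)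
    ev-· f g = pointwise (go f)
      where
      split : ∀ f n → (od f ⊛ od g) n ≡ f 1 * od g n + (X 1 · (od (f ∘ suc ∘ suc) ⊛ od g)) n
      split f zero    = sym (ℤₚ.+-identityʳ _)
      split f (suc n) = cong (_+_ (f 1 * od g (suc n))) (sym (X1·-suc (od (f ∘ suc ∘ suc) ⊛ od g) n))
      regroup : ∀ a b c d → a + (b + (c + d)) ≡ a + c + (b + d)
      regroup = ℤ-Solver.solve-∀
      go : ∀ f n → (f ⊛ g) (dbl n) ≡ (ev f ⊛ ev g) n + (X 1 · (od f ⊛ od g)) n
      go f zero    = sym (ℤₚ.+-identityʳ _)
      go f (suc n) = begin
        f 0 * ev g (suc n) + (f 1 * od g n + ((f ∘ suc ∘ suc) ⊛ g) (dbl n))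
          ≡⟨ cong (λ z → f 0 * ev g (suc n) + (f 1 * od g n + z)) (go (f ∘ suc ∘ suc) n) ⟩
        f 0 * ev g (suc n) + (f 1 * od g n + ((ev (f ∘ suc ∘ suc) ⊛ ev g) n + (X 1 · (od (f ∘ suc ∘ suc) ⊛ od g)) n))
          ≡⟨ regroup (f 0 * ev g (suc n)) (f 1 * od g n) ((ev (f ∘ suc ∘ suc) ⊛ ev g) n) _ ⟩
        (ev f ⊛ ev g) (suc n) + (f 1 * od g n + (X 1 · (od (f ∘ suc ∘ suc) ⊛ od g)) n)
          ≡⟨ cong (_+_ ((ev f ⊛ ev g) (suc n))) (sym (trans (X1·-suc (od f ⊛ od g) n) (split f n))) ⟩
        (ev f ⊛ ev g) (suc n) + (X 1 · (od f ⊛ od g)) (suc n) ∎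
        where open ≡-Reasoning

    od-· : ∀ f g → od (f · g) ≈ ev f · od g ⊕ od f · ev g
    od-· f g = pointwise (go f)
      where
      regroup : ∀ a b c d → a + (b + (c + d)) ≡ a + c + (b + d)
      regroup = ℤ-Solver.solve-∀
      go : ∀ f n → (f ⊛ g) (suc (dbl n)) ≡ (ev f ⊛ od g) n + (od f ⊛ ev g) n
      go f zero    = refl
      go f (suc n) = begin
        f 0 * od g (suc n) + (f 1 * ev g (suc n) + ((f ∘ suc ∘ suc) ⊛ g) (suc (dbl n)))
          ≡⟨ cong (λ z → f 0 * od g (suc n) + (f 1 * ev g (suc n) + z)) (go (f ∘ suc ∘ suc) n) ⟩
        f 0 * od g (suc n) + (f 1 * ev g (suc n) + ((ev (f ∘ suc ∘ suc) ⊛ od g) n + (od (f ∘ suc ∘ suc) ⊛ ev g) n))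
          ≡⟨ regroup (f 0 * od g (suc n)) (f 1 * ev g (suc n)) ((ev (f ∘ suc ∘ suc) ⊛ od g) n) ((od (f ∘ suc ∘ suc) ⊛ ev g) n) ⟩
        (ev f ⊛ od g) (suc n) + (od f ⊛ ev g) (suc n) ∎
        where open ≡-Reasoning

ev-C· : ∀ c f → ev (C c · f) ≈ C c · ev f
ev-C· c f = ev-· (C c) f
  ⟫ ⊕-cong (·-cong (ev-C c) ≈-refl) (·-cong ≈-refl (·-cong (od-C c) ≈-refl))
  ⟫ solve 4 (λ c e o x → c :* e :+ x :* (con 0ℤ :* o) := c :* e) ≈-refl (C c) (ev f) (od f) (X 1)

od-C· : ∀ c f → od (C c · f) ≈ C c · od f
od-C· c f = od-· (C c) f
  ⟫ ⊕-cong (·-cong (ev-C c) ≈-refl) (·-cong (od-C c) ≈-refl)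
  ⟫ solve 3 (λ c e o → c :* o :+ con 0ℤ :* e := c :* o) ≈-refl (C c) (ev f) (od f)

ev-dil· : ∀ f g → ev (dil f · g) ≈ f · ev g
ev-dil· f g = ev-· (dil f) g
  ⟫ ⊕-cong (·-cong (ev-dil f) ≈-refl) (·-cong ≈-refl (·-cong (od-dil f) ≈-refl))
  ⟫ solve 4 (λ c e o x → c :* e :+ x :* (con 0ℤ :* o) := c :* e) ≈-refl f (ev g) (od g) (X 1)

od-dil· : ∀ f g → od (dil f · g) ≈ f · od g
od-dil· f g = od-· (dil f) g
  ⟫ ⊕-cong (·-cong (ev-dil f) ≈-refl) (·-cong (od-dil f) ≈-refl)
  ⟫ solve 3 (λ c e o → c :* o :+ con 0ℤ :* e := c :* o) ≈-refl f (ev g) (od g)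

dil-· : ∀ f g → dil (f · g) ≈ dil f · dil g
dil-· f g = sections
  (ev-dil (f · g) ⟫ ≈-sym (ev-dil· f (dil g) ⟫ ·-cong ≈-refl (ev-dil g)))
  (od-dil (f · g) ⟫ ≈-sym (od-dil· f (dil g) ⟫ ·-cong ≈-refl (od-dil g) ⟫ 𝓢.zeroʳ f))

dil-⊕ : ∀ f g → dil (f ⊕ g) ≈ dil f ⊕ dil g
dil-⊕ f g = sections
  (ev-dil (f ⊕ g) ⟫ ≈-sym (ev-⊕ (dil f) (dil g) ⟫ ⊕-cong (ev-dil f) (ev-dil g)))
  (od-dil (f ⊕ g) ⟫ ≈-sym (od-⊕ (dil f) (dil g) ⟫ ⊕-cong (od-dil f) (od-dil g) ⟫ 𝓢.+-identityˡ 0#))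

dil-C : ∀ c → dil (C c) ≈ C c
dil-C c = sections (ev-dil (C c) ⟫ ≈-sym (ev-C c)) (od-dil (C c) ⟫ ≈-sym (od-C c))

alt-⊕ : ∀ f g → alt (f ⊕ g) ≈ alt f ⊕ alt g
alt-⊕ f g = sections
  (ev-alt (f ⊕ g) ⟫ ev-⊕ f g ⟫ ≈-sym (ev-⊕ (alt f) (alt g) ⟫ ⊕-cong (ev-alt f) (ev-alt g)))
  (od-alt (f ⊕ g) ⟫ ⊝-cong (od-⊕ f g)
    ⟫ solve 2 (λ a b → :- (a :+ b) := :- a :+ :- b) ≈-refl (od f) (od g)
    ⟫ ≈-sym (od-⊕ (alt f) (alt g) ⟫ ⊕-cong (od-alt f) (od-alt g)))

alt-· : ∀ f g → alt (f · g) ≈ alt f · alt g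
alt-· f g = sections
  (ev-alt (f · g) ⟫ ev-· f g
    ⟫ solve 5 (λ a b c d x → a :* b :+ x :* (c :* d) := a :* b :+ x :* (:- c :* :- d)) ≈-refl
        (ev f) (ev g) (od f) (od g) (X 1)
    ⟫ ≈-sym (ev-· (alt f) (alt g)
        ⟫ ⊕-cong (·-cong (ev-alt f) (ev-alt g)) (·-cong ≈-refl (·-cong (od-alt f) (od-alt g)))))
  (od-alt (f · g) ⟫ ⊝-cong (od-· f g)
    ⟫ solve 4 (λ a b c d → :- (a :* d :+ c :* b) := a :* :- d :+ :- c :* b) ≈-refl (ev f) (ev g) (od f) (od g)
    ⟫ ≈-sym (od-· (alt f) (alt g)
        ⟫ ⊕-cong (·-cong (ev-alt f) (od-alt g)) (·-cong (od-alt f) (ev-alt g))))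

alt-dil : ∀ f → alt (dil f) ≈ dil f
alt-dil f = sections (ev-alt (dil f))
  (od-alt (dil f) ⟫ ⊝-cong (od-dil f) ⟫ solve 0 (:- con 0ℤ := con 0ℤ) ≈-refl ⟫ ≈-sym (od-dil f))

alt-alt : ∀ f → alt (alt f) ≈ f
alt-alt f = sections (ev-alt (alt f) ⟫ ev-alt f)
  (od-alt (alt f) ⟫ ⊝-cong (od-alt f) ⟫ solve 1 (λ x → :- (:- x) := x) ≈-refl (od f))

alt-C : ∀ c → alt (C c) ≈ C c
alt-C c = alt-cong (≈-sym (dil-C c)) ⟫ alt-dil (C c) ⟫ dil-C c

X-≡ : ∀ {a b} → a ≡ b → X a ≈ X b
X-≡ refl = ≈-refl

dil-X1 : dil (X 1) ≈ X 2
dil-X1 = pointwise go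
  where
  opaque
    unfolding dil X
    go : ∀ n → dil (X 1) n ≡ X 2 n
    go zero = refl
    go (suc zero) = refl
    go (suc (suc n)) = trans (dil-local n (λ k _ → trans (X-suc 0 k) (sym (at X-0 k))))
      (trans (at (dil-C 1ℤ) n) (trans (at X-0 n) (trans (sym (X-suc 0 n)) (sym (X-suc 1 (suc n))))))

dil-X : ∀ a → dil (X a) ≈ X (a ℕ.+ a)
dil-X zero    = dil-cong (≈-sym X-0) ⟫ dil-C 1ℤ ⟫ X-0
dil-X (suc a) = dil-cong (≈-sym (X-+ 1 a)) ⟫ dil-· (X 1) (X a) ⟫ ·-cong dil-X1 (dil-X a) ⟫ X-+ 2 (a ℕ.+ a)
  ⟫ X-≡ (cong suc (sym (ℕₚ.+-suc a a)))

alt-X1 : alt (X 1) ≈ ⊝ X 1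
alt-X1 = pointwise go
  where
  opaque
    unfolding alt X _⊕_
    go : ∀ n → alt (X 1) n ≡ (⊝ X 1) n
    go zero = refl
    go (suc n) = cong ℤ.-_ (trans (alt-local n (trans (X-suc 0 n) (sym (at X-0 n))))
      (trans (at (alt-C 1ℤ) n) (trans (at X-0 n) (sym (X-suc 0 n)))))

alt-X : ∀ a → alt (X a) ≈ C (sg a) · X a
alt-X zero    = alt-cong (≈-sym X-0) ⟫ alt-C 1ℤ ⟫ ≈-sym (𝓢.*-identityˡ 1#) ⟫ ·-cong ≈-refl X-0
alt-X (suc a) = alt-cong (≈-sym (X-+ 1 a)) ⟫ alt-· (X 1) (X a) ⟫ ·-cong alt-X1 (alt-X a)
  ⟫ solve 3 (λ c x y → :- x :* (c :* y) := :- c :* (x :* y)) ≈-refl (C (sg a)) (X 1) (X a)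
  ⟫ ·-cong (≈-sym (C-neg (sg a))) (X-+ 1 a)

-- Truncation and finite sums

infix 4 _≈[_]_
-- Congruence modulo q^(m+1). Identities between infinite sums and products are proved for every `m`
-- with finite ones, whose length depends on `m`.
record _≈[_]_ (f : Series) (m : ℕ) (g : Series) : Set where
  constructor upTo
  field coeff : ∀ k → k ℕ.≤ m → f k ≡ g k
open _≈[_]_

weaken : ∀ {f g} m → f ≈ g → f ≈[ m ] g
weaken m p = upTo λ k _ → at p k

≈-from-≈[] : ∀ {f g} → (∀ m → f ≈[ m ] g) → f ≈ g
≈-from-≈[] p = pointwise λ n → coeff (p n) n ℕₚ.≤-refl

≈[]-refl : ∀ {f m} → f ≈[ m ] f
≈[]-refl = upTo λ _ _ → refl

≈[]-sym : ∀ {f g m} → f ≈[ m ] g → g ≈[ m ] f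
≈[]-sym p = upTo λ k k≤m → sym (coeff p k k≤m)

infixr 4 _⟫[]_
_⟫[]_ : ∀ {f g h m} → f ≈[ m ] g → g ≈[ m ] h → f ≈[ m ] h
p ⟫[] q = upTo λ k k≤m → trans (coeff p k k≤m) (coeff q k k≤m)

⊕-cong[] : ∀ {f f' g g' m} → f ≈[ m ] f' → g ≈[ m ] g' → f ⊕ g ≈[ m ] f' ⊕ g'
⊕-cong[] {f} {f'} {g} {g'} p q = upTo λ k k≤m →
  trans (⊕-at f g k) (trans (cong₂ ℤ._+_ (coeff p k k≤m) (coeff q k k≤m)) (sym (⊕-at f' g' k)))

·-cong[] : ∀ {f f' g g' m} → f ≈[ m ] f' → g ≈[ m ] g' → f · g ≈[ m ] f' · g'
·-cong[] p q = upTo λ k k≤m → ·-local k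
  (λ i i≤k → coeff p i (ℕₚ.≤-trans i≤k k≤m)) (λ i i≤k → coeff q i (ℕₚ.≤-trans i≤k k≤m))

alt-cong[] : ∀ {f g m} → f ≈[ m ] g → alt f ≈[ m ] alt g
alt-cong[] p = upTo λ k k≤m → alt-local k (coeff p k k≤m)

dil-cong[] : ∀ {f g m} → f ≈[ m ] g → dil f ≈[ m ] dil g
dil-cong[] p = upTo λ k k≤m → dil-local k λ i i≤k → coeff p i (ℕₚ.≤-trans i≤k k≤m)

0#-at : ∀ n → 0# n ≡ 0ℤ
0#-at zero    = C-at-0 0ℤ
0#-at (suc n) = C-at-suc 0ℤ n

X-order : ∀ {m a} → m ℕ.< a → X a ≈[ m ] 0#
X-order {m} {a} m<a = upTo λ k k≤m →
  trans (sym (at (X-def a) k)) (trans (q^-order a k (ℕₚ.≤-<-trans k≤m m<a)) (sym (0#-at k)))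

X-·-order : ∀ {m a} f → m ℕ.< a → X a · f ≈[ m ] 0#
X-·-order f m<a = ·-cong[] (X-order m<a) ≈[]-refl ⟫[] weaken _ (𝓢.zeroˡ f)

Σs : ℕ → (ℕ → Series) → Series
Σs zero    F = F 0
Σs (suc L) F = F 0 ⊕ Σs L (F ∘ suc)

Σs-at : ∀ L F n → Σs L F n ≡ ∑≤ L λ k → F k n
Σs-at zero    F n = refl
Σs-at (suc L) F n = trans (⊕-at (F 0) (Σs L (F ∘ suc)) n) (cong (ℤ._+_ (F 0 n)) (Σs-at L (F ∘ suc) n))

Σs-cong[] : ∀ L {F G m} → (∀ k → k ℕ.≤ L → F k ≈[ m ] G k) → Σs L F ≈[ m ] Σs L G
Σs-cong[] zero    p = p 0 z≤n
Σs-cong[] (suc L) p = ⊕-cong[] (p 0 z≤n) (Σs-cong[] L λ k k≤L → p (suc k) (s≤s k≤L))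

Σs-cong≤ : ∀ L {F G} → (∀ k → k ℕ.≤ L → F k ≈ G k) → Σs L F ≈ Σs L G
Σs-cong≤ L p = ≈-from-≈[] λ m → Σs-cong[] L λ k k≤L → weaken m (p k k≤L)

Σs-cong : ∀ L {F G} → (∀ k → F k ≈ G k) → Σs L F ≈ Σs L G
Σs-cong L p = Σs-cong≤ L λ k _ → p k

Σs-·ˡ : ∀ L f F → f · Σs L F ≈ Σs L λ k → f · F k
Σs-·ˡ zero    f F = ≈-refl
Σs-·ˡ (suc L) f F = 𝓢.distribˡ f (F 0) _ ⟫ ⊕-cong ≈-refl (Σs-·ˡ L f (F ∘ suc))

Σs-·ʳ : ∀ L f F → Σs L F · f ≈ Σs L λ k → F k · f
Σs-·ʳ L f F = 𝓢.*-comm _ f ⟫ Σs-·ˡ L f F ⟫ Σs-cong L λ k → 𝓢.*-comm f (F k)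

⊕-interchange : ∀ a b c d → (a ⊕ b) ⊕ (c ⊕ d) ≈ (a ⊕ c) ⊕ (b ⊕ d)
⊕-interchange = solve 4 (λ a b c d → (a :+ b) :+ (c :+ d) := (a :+ c) :+ (b :+ d)) ≈-refl

Σs-⊕ : ∀ L F G → Σs L (λ k → F k ⊕ G k) ≈ Σs L F ⊕ Σs L G
Σs-⊕ zero    F G = ≈-refl
Σs-⊕ (suc L) F G = ⊕-cong ≈-refl (Σs-⊕ L (F ∘ suc) (G ∘ suc)) ⟫ ⊕-interchange (F 0) (G 0) _ _

Σs-last : ∀ L F → Σs (suc L) F ≈ Σs L F ⊕ F (suc L)
Σs-last zero    F = ≈-refl
Σs-last (suc L) F = ⊕-cong ≈-refl (Σs-last L (F ∘ suc)) ⟫ ≈-sym (𝓢.+-assoc (F 0) _ _)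

Σs-alt : ∀ L F → alt (Σs L F) ≈ Σs L (alt ∘ F)
Σs-alt zero    F = ≈-refl
Σs-alt (suc L) F = alt-⊕ (F 0) _ ⟫ ⊕-cong ≈-refl (Σs-alt L (F ∘ suc))

Σs-dil : ∀ L F → dil (Σs L F) ≈ Σs L (dil ∘ F)
Σs-dil zero    F = ≈-refl
Σs-dil (suc L) F = dil-⊕ (F 0) _ ⟫ ⊕-cong ≈-refl (Σs-dil L (F ∘ suc))

Σs-zero[] : ∀ L {F m} → (∀ k → k ℕ.≤ L → F k ≈[ m ] 0#) → Σs L F ≈[ m ] 0#
Σs-zero[] zero    p = p 0 z≤n
Σs-zero[] (suc L) p = ⊕-cong[] (p 0 z≤n) (Σs-zero[] L λ k k≤L → p (suc k) (s≤s k≤L))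
  ⟫[] weaken _ (𝓢.+-identityˡ 0#)

Σs-trim : ∀ {m} K L F → K ℕ.≤ L → (∀ k → K ℕ.< k → F k ≈[ m ] 0#) → Σs L F ≈[ m ] Σs K F
Σs-trim zero zero F _ p = ≈[]-refl
Σs-trim zero (suc L) F _ p =
  ⊕-cong[] ≈[]-refl (Σs-zero[] L λ k _ → p (suc k) (s≤s z≤n)) ⟫[] weaken _ (𝓢.+-identityʳ (F 0))
Σs-trim (suc K) (suc L) F (s≤s K≤L) p =
  ⊕-cong[] ≈[]-refl (Σs-trim K L (F ∘ suc) K≤L λ k K<k → p (suc k) (s≤s K<k))

Σs-parity : ∀ L F → Σs (suc (dbl L)) F ≈ Σs L (F ∘ dbl) ⊕ Σs L (F ∘ suc ∘ dbl)
Σs-parity zero    F = ≈-refl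
Σs-parity (suc L) F = ⊕-cong ≈-refl (⊕-cong ≈-refl (Σs-parity L (F ∘ suc ∘ suc)))
  ⟫ solve 4 (λ a b c d → a :+ (b :+ (c :+ d)) := (a :+ c) :+ (b :+ d)) ≈-refl (F 0) (F 1) _ _

Σs-triangle : ∀ L (G : ℕ → ℕ → Series) →
  Σs L (λ N → Σs N λ r → G r (N ℕ.∸ r)) ≈ Σs L (λ r → Σs (L ℕ.∸ r) (G r))
Σs-triangle zero    G = ≈-refl
Σs-triangle (suc L) G =
  ⊕-cong ≈-refl (Σs-⊕ L (λ N → G 0 (suc N)) (λ N → Σs N λ r → G (suc r) (N ℕ.∸ r)))
  ⟫ ≈-sym (𝓢.+-assoc (G 0 0) _ _)
  ⟫ ⊕-cong ≈-refl (Σs-triangle L (G ∘ suc))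

-- The square r, s ≤ L exceeds the triangle r + s ≤ L only by negligible terms, and the triangle is
-- summed along its diagonals r + s = N.
Σs-square : ∀ {m} L (G : ℕ → ℕ → Series) → (∀ r s → L ℕ.< r ℕ.+ s → G r s ≈[ m ] 0#) →
  Σs L (λ r → Σs L (G r)) ≈[ m ] Σs L (λ N → Σs N λ r → G r (N ℕ.∸ r))
Σs-square L G p =
  Σs-cong[] L (λ r r≤L → Σs-trim (L ℕ.∸ r) L (G r) (ℕₚ.m∸n≤m L r) λ s q → p r s (bound r s r≤L q))
  ⟫[] weaken _ (≈-sym (Σs-triangle L G))
  where
  bound : ∀ r s → r ℕ.≤ L → L ℕ.∸ r ℕ.< s → L ℕ.< r ℕ.+ s
  bound r s r≤L q = subst (ℕ._< r ℕ.+ s) (ℕₚ.m+[n∸m]≡n r≤L) (ℕₚ.+-monoʳ-< r q)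

∑ˢ-approx : ∀ F {m} L → (∀ k n → n ℕ.< k → F k n ≡ 0ℤ) → m ℕ.≤ L → ∑ˢ F ≈[ m ] Σs L F
∑ˢ-approx F {m} L order m≤L = upTo λ k k≤m →
  trans (sym (Σs-at k F k))
    (sym (coeff (Σs-trim {k} k L F (ℕₚ.≤-trans k≤m m≤L) λ i k<i → upTo λ n n≤k →
      trans (order i n (ℕₚ.≤-<-trans n≤k k<i)) (sym (0#-at n))) k ℕₚ.≤-refl))

Σℤ : ℕ → (ℤ → Series) → Series
Σℤ zero    F = F (+ 0)
Σℤ (suc m) F = Σℤ m F ⊕ (F (+ suc m) ⊕ F -[1+ m ])

Σℤ-cong[] : ∀ L {F G m} → (∀ z → ℤ.∣ z ∣ ℕ.≤ L → F z ≈[ m ] G z) → Σℤ L F ≈[ m ] Σℤ L G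
Σℤ-cong[] zero    p = p (+ 0) z≤n
Σℤ-cong[] (suc L) p = ⊕-cong[] (Σℤ-cong[] L λ z z≤L → p z (ℕₚ.m≤n⇒m≤1+n z≤L))
  (⊕-cong[] (p _ ℕₚ.≤-refl) (p _ ℕₚ.≤-refl))

Σℤ-cong : ∀ L {F G} → (∀ z → F z ≈ G z) → Σℤ L F ≈ Σℤ L G
Σℤ-cong L p = ≈-from-≈[] λ m → Σℤ-cong[] L λ z _ → weaken m (p z)

Σℤ-·ˡ : ∀ L f F → f · Σℤ L F ≈ Σℤ L λ z → f · F z
Σℤ-·ˡ zero    f F = ≈-refl
Σℤ-·ˡ (suc L) f F = 𝓢.distribˡ f _ _ ⟫ ⊕-cong (Σℤ-·ˡ L f F) (𝓢.distribˡ f _ _)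

Σℤ-⊕ : ∀ L F G → Σℤ L (λ z → F z ⊕ G z) ≈ Σℤ L F ⊕ Σℤ L G
Σℤ-⊕ zero    F G = ≈-refl
Σℤ-⊕ (suc L) F G = ⊕-cong (Σℤ-⊕ L F G) (⊕-interchange (F (+ suc L)) (G (+ suc L)) _ _) ⟫ ⊕-interchange _ _ _ _

Σℤ-alt : ∀ L F → alt (Σℤ L F) ≈ Σℤ L (alt ∘ F)
Σℤ-alt zero    F = ≈-refl
Σℤ-alt (suc L) F = alt-⊕ _ _ ⟫ ⊕-cong (Σℤ-alt L F) (alt-⊕ _ _)

Σℤ-dil : ∀ L F → dil (Σℤ L F) ≈ Σℤ L (dil ∘ F)
Σℤ-dil zero    F = ≈-refl
Σℤ-dil (suc L) F = dil-⊕ _ _ ⟫ ⊕-cong (Σℤ-dil L F) (dil-⊕ _ _)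

Σℤ-Σs-swap : ∀ M L (F : ℤ → ℕ → Series) → Σℤ M (λ z → Σs L (F z)) ≈ Σs L λ r → Σℤ M λ z → F z r
Σℤ-Σs-swap M zero    F = ≈-refl
Σℤ-Σs-swap M (suc L) F = Σℤ-⊕ M (λ z → F z 0) _ ⟫ ⊕-cong ≈-refl (Σℤ-Σs-swap M L λ z → F z ∘ suc)

-- Both sides sum F over the window from -m to m + 1.
Σℤ-step : ∀ m F → Σℤ m (F ∘ ℤ.suc) ⊕ F (ℤ.- (+ m)) ≈ Σℤ m F ⊕ F (+ suc m)
Σℤ-step zero    F = 𝓢.+-comm _ _
Σℤ-step (suc m) F =
  ⊕-cong (⊕-cong ≈-refl (⊕-cong ≈-refl (pred-suc m))) ≈-refl
  ⟫ solve 4 (λ s a b c → s :+ (a :+ b) :+ c := s :+ b :+ (a :+ c)) ≈-refl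
      (Σℤ m (F ∘ ℤ.suc)) (F (+ suc (suc m))) (F (ℤ.- (+ m))) (F -[1+ m ])
  ⟫ ⊕-cong (Σℤ-step m F) ≈-refl
  ⟫ solve 4 (λ s a b c → s :+ a :+ (b :+ c) := s :+ (a :+ c) :+ b) ≈-refl
      (Σℤ m F) (F (+ suc m)) (F (+ suc (suc m))) (F -[1+ m ])
  where
  pred-suc : ∀ m → F (ℤ.suc -[1+ m ]) ≈ F (ℤ.- (+ m))
  pred-suc zero    = ≈-refl
  pred-suc (suc m) = ≈-refl

-- Moving the window by r loses the values at -m, ..., -m + r - 1 and takes in r values beyond m;
-- the hypotheses make both kinds negligible.
Σℤ-shift : ∀ m r F → (∀ k → F (+ suc (m ℕ.+ k)) ≈[ m ] 0#) →
  (∀ j → j ℕ.< r → F (ℤ.- (+ m) ℤ.+ + j) ≈[ m ] 0#) →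
  Σℤ m (λ z → F (z ℤ.+ + r)) ≈[ m ] Σℤ m F
Σℤ-shift m zero F _ _ = weaken m (Σℤ-cong m λ z → subst (λ w → F w ≈ F z) (sym (ℤₚ.+-identityʳ z)) ≈-refl)
Σℤ-shift m (suc r) F above below =
  weaken m (Σℤ-cong m λ z → subst (λ w → F (z ℤ.+ + suc r) ≈ F w) (move z (+ r)) ≈-refl)
  ⟫[] ≈[]-sym (weaken m (𝓢.+-identityʳ _))
  ⟫[] ⊕-cong[] ≈[]-refl (≈[]-sym (below r ℕₚ.≤-refl))
  ⟫[] weaken m (Σℤ-step m λ z → F (z ℤ.+ + r))
  ⟫[] ⊕-cong[] (Σℤ-shift m r F above λ j j<r → below j (ℕₚ.m≤n⇒m≤1+n j<r)) (above r)
  ⟫[] weaken m (𝓢.+-identityʳ _)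
  where
  move : ∀ z r → z ℤ.+ (+ 1 ℤ.+ r) ≡ + 1 ℤ.+ z ℤ.+ r
  move = ℤ-Solver.solve-∀

-- Euler's expansions

inv-inverse : ∀ f → f 0 ≡ 1ℤ → f · inv f ≈ 1#
inv-inverse f f0≡1 = pointwise λ n →
  trans (sym (at (·-def f (inv f)) n)) (trans (⊛-inverseʳ f f0≡1 n) (trans (at (X-def 0) n) (sym (at X-0 n))))

·-cancelˡ[] : ∀ {m g h} f → f 0 ≡ 1ℤ → f · g ≈[ m ] f · h → g ≈[ m ] h
·-cancelˡ[] {m} {g} {h} f f0≡1 p =
  ≈[]-sym (undo g) ⟫[] ·-cong[] (≈[]-refl {inv f}) p ⟫[] undo h
  where
  undo : ∀ g → inv f · (f · g) ≈[ m ] g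
  undo g = weaken m (solve 3 (λ i f g → i :* (f :* g) := f :* i :* g) ≈-refl (inv f) f g
    ⟫ ·-cong (inv-inverse f f0≡1) ≈-refl ⟫ 𝓢.*-identityˡ g)

·-cancelˡ : ∀ {g h} f → f 0 ≡ 1ℤ → f · g ≈ f · h → g ≈ h
·-cancelˡ f f0≡1 p = ≈-from-≈[] λ m → ·-cancelˡ[] f f0≡1 (weaken m p)

1⊝X 1⊕X : ℕ → Series
1⊝X a = 1# ⊕ ⊝ X a
1⊕X a = 1# ⊕ X a

1⊝X-0 : ∀ a → 1⊝X (suc a) 0 ≡ 1ℤ
1⊝X-0 a = trans (⊕-at 1# _ 0) (cong₂ ℤ._+_ (C-at-0 1ℤ) (trans (⊝-at _ 0) (cong ℤ.-_ (X-suc-0 a))))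

1⊕X-0 : ∀ a → 1⊕X (suc a) 0 ≡ 1ℤ
1⊕X-0 a = trans (⊕-at 1# _ 0) (cong₂ ℤ._+_ (C-at-0 1ℤ) (X-suc-0 a))

dil-1⊝X : ∀ a → dil (1⊝X a) ≈ 1⊝X (a ℕ.+ a)
dil-1⊝X a = dil-⊕ _ _ ⟫ ⊕-cong (dil-C 1ℤ) (dil-⊝ (X a) ⟫ ⊝-cong (dil-X a))
  where
  neg-as-· : ∀ f → ⊝ f ≈ C -1ℤ · f
  neg-as-· = solve 1 (λ f → :- f := con -1ℤ :* f) ≈-refl
  dil-⊝ : ∀ f → dil (⊝ f) ≈ ⊝ dil f
  dil-⊝ f = dil-cong (neg-as-· f) ⟫ dil-· _ f ⟫ ·-cong (dil-C -1ℤ) ≈-refl ⟫ ≈-sym (neg-as-· (dil f))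

recip-poch : ℕ → Series
recip-poch zero    = 1#
recip-poch (suc r) = recip-poch r · inv (1⊝X (suc r))

recip-poch-suc : ∀ r → 1⊝X (suc r) · recip-poch (suc r) ≈ recip-poch r
recip-poch-suc r = solve 3 (λ d p i → d :* (p :* i) := p :* (d :* i)) ≈-refl (1⊝X (suc r)) (recip-poch r) _
  ⟫ ·-cong ≈-refl (inv-inverse (1⊝X (suc r)) (1⊝X-0 r)) ⟫ 𝓢.*-identityʳ _

-- u r = 1 / (q²;q²)_r
u : ℕ → Series
u r = dil (recip-poch r)

u-0 : u 0 ≈ 1#
u-0 = dil-C 1ℤ

u-suc : ∀ r → 1⊝X (suc r ℕ.+ suc r) · u (suc r) ≈ u r
u-suc r = ·-cong (≈-sym (dil-1⊝X (suc r))) ≈-refl ⟫ ≈-sym (dil-· _ _) ⟫ dil-cong (recip-poch-suc r)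

alt-u : ∀ r → alt (u r) ≈ u r
alt-u r = alt-dil (recip-poch r)

sq : ℤ → ℕ
sq z = ℤ.∣ z ∣ ℕ.* ℤ.∣ z ∣

+sq : ∀ z → + sq z ≡ z ℤ.* z
+sq (+ n)    = sym (ℤₚ.+◃n≡+n (n ℕ.* n))
+sq -[1+ n ] = refl

Q : ℤ → Series
Q z = X (sq z)

∣z∣≤sq : ∀ z → ℤ.∣ z ∣ ℕ.≤ sq z
∣z∣≤sq z = go ℤ.∣ z ∣
  where
  go : ∀ n → n ℕ.≤ n ℕ.* n
  go zero    = z≤n
  go (suc n) = ℕₚ.m≤m+n (suc n) (n ℕ.* suc n)

Q-order : ∀ {m} z → m ℕ.< ℤ.∣ z ∣ → Q z ≈[ m ] 0#
Q-order z m<z = X-order (ℕₚ.<-≤-trans m<z (∣z∣≤sq z))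

Q·-order : ∀ {m} z f → m ℕ.< ℤ.∣ z ∣ → Q z · f ≈[ m ] 0#
Q·-order z f m<z = X-·-order f (ℕₚ.<-≤-trans m<z (∣z∣≤sq z))

-- Equality of exponents is checked in ℤ, where squares of differences expand.
X-≡ℤ : ∀ {a b} → + a ≡ + b → X a ≈ X b
X-≡ℤ p = X-≡ (ℤₚ.+-injective p)

-- pp n = (-q;q²)_n; by Euler, ε below is (-q;q²)_∞.
pp : ℕ → Series
pp zero    = 1#
pp (suc n) = pp n · 1⊕X (suc (n ℕ.+ n))

pp-0 : ∀ n → pp n 0 ≡ 1ℤ
pp-0 zero    = C-at-0 1ℤ
pp-0 (suc n) = trans (·-at-0 _ _) (cong₂ ℤ._*_ (pp-0 n) (1⊕X-0 (n ℕ.+ n)))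

P-term : ℕ → ℕ → Series
P-term n r = Q (+ n ℤ.+ + r) · u r

-- Euler's ∑ q^(r²) t^r / (q²;q²)_r = (-tq;q²)_∞ at t = q^(2n) shows that this is q^(n²)
-- (-q^(2n+1);q²)_∞. Completing the product by its first n factors is `pp·P`.
P : ℕ → Series
P n = ∑ˢ (P-term n)

P-approx : ∀ n {m} L → m ℕ.≤ L → P n ≈[ m ] Σs L (P-term n)
P-approx n L = ∑ˢ-approx (P-term n) L λ r k k<r →
  trans (coeff (Q·-order {k} (+ n ℤ.+ + r) (u r) (ℕₚ.<-≤-trans k<r (ℕₚ.m≤n+m r n))) k ℕₚ.≤-refl) (0#-at k)

private
  P-term-0 : ∀ n → X (suc (n ℕ.+ n)) · P-term n 0 ≈ P-term (suc n) 0
  P-term-0 n = ≈-sym (𝓢.*-assoc _ _ _)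
    ⟫ ·-cong (X-+ _ _ ⟫ X-≡ℤ exponent) ≈-refl
    where
    open import Data.Integer.Base using (_+_; _*_)
    expand : ∀ n → + 1 + (n + n) + (n + 0ℤ) * (n + 0ℤ) ≡ (+ 1 + n + 0ℤ) * (+ 1 + n + 0ℤ)
    expand = ℤ-Solver.solve-∀
    exponent : + (suc (n ℕ.+ n) ℕ.+ sq (+ n + + 0)) ≡ + sq (+ suc n + + 0)
    exponent = trans (cong (_+_ (+ suc (n ℕ.+ n))) (+sq (+ n + + 0))) (trans (expand (+ n))
        (sym (+sq (+ suc n + + 0))))

  P-term-suc : ∀ n r → X (suc (n ℕ.+ n)) · P-term n (suc r)
                       ≈ P-term (suc n) (suc r) ⊕ X (suc (n ℕ.+ n)) · P-term (suc n) r
  P-term-suc n r = ≈-sym (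
    ⊕-cong (·-cong (≈-sym (·-cong (X-+ _ _) ≈-refl ⟫ X-+ _ _ ⟫ X-≡ℤ exponent)) ≈-refl)
           (·-cong ≈-refl (·-cong (X-≡ (cong (λ k → k ℕ.* k) (sym (ℕₚ.+-suc n r)))) (≈-sym (u-suc r))))
    ⟫ solve 4 (λ a x b w → a :* x :* b :* w :+ a :* (x :* ((con 1ℤ :+ :- b) :* w)) := a :* (x :* w)) ≈-refl
        (X (suc (n ℕ.+ n))) (Q (+ n ℤ.+ + suc r)) (X (suc r ℕ.+ suc r)) (u (suc r)))
    where
    open import Data.Integer.Base using (_+_; _*_)
    expand : ∀ n r → + 1 + (n + n) + (n + (+ 1 + r)) * (n + (+ 1 + r)) + (+ 1 + r + (+ 1 + r))
                     ≡ (+ 1 + n + (+ 1 + r)) * (+ 1 + n + (+ 1 + r))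
    expand = ℤ-Solver.solve-∀
    exponent : + (suc (n ℕ.+ n) ℕ.+ sq (+ n + + suc r) ℕ.+ (suc r ℕ.+ suc r)) ≡ + sq (+ suc n + + suc r)
    exponent = trans (cong (λ k → + suc (n ℕ.+ n) + k + + (suc r ℕ.+ suc r)) (+sq (+ n + + suc r)))
      (trans (expand (+ n) (+ r)) (sym (+sq (+ suc n + + suc r))))

-- Substituting u r = (1 - q^(2r+2)) u (r+1) in the terms of P (n+1) makes the right side telescope
-- to the left; the sums differ in length by one because of the index shift.
P-step : ∀ n → X (suc (n ℕ.+ n)) · P n ≈ 1⊕X (suc (n ℕ.+ n)) · P (suc n)
P-step n = ≈-from-≈[] λ m →
  ·-cong[] ≈[]-refl (P-approx n (suc m) (ℕₚ.n≤1+n m))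
  ⟫[] weaken m (exact m)
  ⟫[] ⊕-cong[] (≈[]-sym (P-approx (suc n) (suc m) (ℕₚ.n≤1+n m)))
               (·-cong[] ≈[]-refl (≈[]-sym (P-approx (suc n) m ℕₚ.≤-refl)))
  ⟫[] weaken m (solve 2 (λ p x → p :+ x :* p := (con 1ℤ :+ x) :* p) ≈-refl (P (suc n)) x)
  where
  x = X (suc (n ℕ.+ n))
  exact : ∀ m → x · Σs (suc m) (P-term n) ≈ Σs (suc m) (P-term (suc n)) ⊕ x · Σs m (P-term (suc n))
  exact m = 𝓢.distribˡ x _ _
    ⟫ ⊕-cong (P-term-0 n) (Σs-·ˡ m x _ ⟫ Σs-cong m (P-term-suc n) ⟫ Σs-⊕ m _ _
        ⟫ ⊕-cong ≈-refl (≈-sym (Σs-·ˡ m x (P-term (suc n)))))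
    ⟫ ≈-sym (𝓢.+-assoc _ _ _)

ε : Series
ε = P 0

pp·P : ∀ n → pp n · P n ≈ Q (+ n) · ε
pp·P zero    = ·-cong X-0 ≈-refl
pp·P (suc n) =
  𝓢.*-assoc _ _ _
  ⟫ ·-cong ≈-refl (≈-sym (P-step n))
  ⟫ solve 3 (λ p x f → p :* (x :* f) := x :* (p :* f)) ≈-refl (pp n) (X (suc (n ℕ.+ n))) (P n)
  ⟫ ·-cong ≈-refl (pp·P n)
  ⟫ ≈-sym (𝓢.*-assoc _ _ _)
  ⟫ ·-cong (X-+ _ _ ⟫ X-≡ exponent) ≈-refl
  where
  exponent : suc (n ℕ.+ n) ℕ.+ n ℕ.* n ≡ suc n ℕ.* suc n
  exponent = cong suc (trans (ℕₚ.+-assoc n n (n ℕ.* n)) (cong (n ℕ.+_) (sym (ℕₚ.*-suc n n))))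

M-term : ℕ → ℕ → Series
M-term n s = Q (+ n ℤ.- + s) · u s

private
  M-term-0 : ∀ n → M-term (suc n) 0 ≈ X (suc (n ℕ.+ n)) · M-term n 0
  M-term-0 n = ≈-sym (≈-sym (𝓢.*-assoc _ _ _) ⟫ ·-cong (X-+ _ _ ⟫ X-≡ℤ exponent) ≈-refl)
    where
    open import Data.Integer.Base using (_+_; _*_; _-_)
    expand : ∀ n → + 1 + (n + n) + (n - 0ℤ) * (n - 0ℤ) ≡ (+ 1 + n - 0ℤ) * (+ 1 + n - 0ℤ)
    expand = ℤ-Solver.solve-∀
    exponent : + (suc (n ℕ.+ n) ℕ.+ sq (+ n - + 0)) ≡ + sq (+ suc n - + 0)
    exponent = trans (cong (_+_ (+ suc (n ℕ.+ n))) (+sq (+ n - + 0))) (trans (expand (+ n))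
        (sym (+sq (+ suc n - + 0))))

  M-term-suc : ∀ n s → M-term (suc n) (suc s) ≈ M-term n s ⊕ X (suc (n ℕ.+ n)) · M-term n (suc s)
  M-term-suc n s = ≈-sym (
    ⊕-cong (·-cong ≈-refl (≈-sym (u-suc s))) ≈-refl
    ⟫ solve 5 (λ x b w a y → x :* ((con 1ℤ :+ :- b) :* w) :+ a :* (y :* w)
        := x :* w :+ :- (x :* b) :* w :+ (a :* y) :* w) ≈-refl
        (Q (+ n ℤ.- + s)) (X (suc s ℕ.+ suc s)) (u (suc s)) (X (suc (n ℕ.+ n))) (Q (+ n ℤ.- + suc s))
    ⟫ ⊕-cong (⊕-cong ≈-refl (·-cong (⊝-cong (X-+ _ _ ⟫ X-≡ℤ exponent ⟫ ≈-sym (X-+ _ _))) ≈-refl)) ≈-refl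
    ⟫ solve 3 (λ x w y → x :* w :+ :- y :* w :+ y :* w := x :* w) ≈-refl (Q (+ n ℤ.- + s)) (u (suc s)) _
    ⟫ ·-cong (X-≡ (cong sq (sym (cancel (+ n) (+ s))))) ≈-refl)
    where
    open import Data.Integer.Base using (_+_; _*_; _-_)
    cancel : ∀ n s → + 1 + n - (+ 1 + s) ≡ n - s
    cancel = ℤ-Solver.solve-∀
    expand : ∀ n s → (n - s) * (n - s) + (+ 1 + s + (+ 1 + s)) ≡ + 1 + (n + n) + (n - (+ 1 + s)) * (n - (+ 1 + s))
    expand = ℤ-Solver.solve-∀
    exponent : + (sq (+ n - + s) ℕ.+ (suc s ℕ.+ suc s)) ≡ + (suc (n ℕ.+ n) ℕ.+ sq (+ n - + suc s))
    exponent = trans (cong (_+ + (suc s ℕ.+ suc s)) (+sq (+ n - + s)))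
      (trans (expand (+ n) (+ s)) (sym (cong (_+_ (+ suc (n ℕ.+ n))) (+sq (+ n - + suc s)))))

-- Euler's expansion at t = q^(-2n): in q^(n²) (-q^(1-2n);q²)_∞ the n factors with negative
-- exponents absorb q^(n²) and become (-q;q²)_n. Terms with s > n + m start beyond q^m, hence the
-- bound on `L`.
M-approx : ∀ n {m} L → n ℕ.+ m ℕ.≤ L → Σs L (M-term n) ≈[ m ] pp n · ε
M-approx zero {m} L m≤L =
  weaken m (Σs-cong L λ s → ·-cong (X-≡ℤ (trans (+sq (+ 0 ℤ.- + s)) (trans (square-neg (+ s))
      (sym (+sq (+ s)))))) ≈-refl)
  ⟫[] ≈[]-sym (P-approx 0 L m≤L) ⟫[] weaken m (≈-sym (𝓢.*-identityˡ ε))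
  where
  open import Data.Integer.Base using (_*_; _-_)
  square-neg : ∀ s → (+ 0 - s) * (+ 0 - s) ≡ s * s
  square-neg = ℤ-Solver.solve-∀
M-approx (suc n) {m} (suc L) (s≤s n+m≤L) =
  weaken m (⊕-cong (M-term-0 n) (Σs-cong L (M-term-suc n) ⟫ Σs-⊕ L _ _ ⟫ ⊕-cong ≈-refl (≈-sym (Σs-·ˡ L x _)))
    ⟫ solve 4 (λ x a b c → x :* a :+ (b :+ x :* c) := b :+ x :* (a :+ c)) ≈-refl x (M-term n 0) (Σs L (M-term n)) _)
  ⟫[] ⊕-cong[] (M-approx n L n+m≤L) (·-cong[] ≈[]-refl (M-approx n (suc L) (ℕₚ.m≤n⇒m≤1+n n+m≤L)))
  ⟫[] weaken m (solve 3 (λ p e x → p :* e :+ x :* (p :* e) := p :* (con 1ℤ :+ x) :* e) ≈-refl (pp n) ε x)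
  where
  x = X (suc (n ℕ.+ n))

X·-at : ∀ a f n → (X a · f) (a ℕ.+ n) ≡ f n
X·-at zero f n = at (·-cong (≈-sym X-0) ≈-refl ⟫ 𝓢.*-identityˡ f) n
X·-at (suc a) f n = trans (at (·-cong (≈-sym (X-+ 1 a)) ≈-refl ⟫ 𝓢.*-assoc (X 1) (X a) f) (suc (a ℕ.+ n)))
  (trans (X1·-suc (X a · f) (a ℕ.+ n)) (X·-at a f n))

-- `P m` begins with q^(m²) and continues at q^((m+1)²), beyond m² + m. So `pp·P` at n = m, divided
-- by q^(m²), identifies the coefficients up to q^m.
ε≈pp : ∀ m → ε ≈[ m ] pp m
ε≈pp m = upTo λ k k≤m → trans (sym (X·-at (sq (+ m)) ε k))
  (trans (at (≈-sym (pp·P m)) (sq (+ m) ℕ.+ k))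
    (trans (coeff (leading k k≤m) (sq (+ m) ℕ.+ k) ℕₚ.≤-refl)
      (trans (at (𝓢.*-comm (pp m) (Q (+ m))) _) (X·-at (sq (+ m)) (pp m) k))))
  where
  leading : ∀ k → k ℕ.≤ m → pp m · P m ≈[ sq (+ m) ℕ.+ k ] pp m · Q (+ m)
  leading k k≤m = ·-cong[] ≈[]-refl (
    P-approx m (sq (+ m) ℕ.+ k) ℕₚ.≤-refl
    ⟫[] Σs-trim 0 (sq (+ m) ℕ.+ k) (P-term m) z≤n (λ { (suc r) _ → X-·-order (u (suc r)) (bound r) })
    ⟫[] weaken _ (·-cong (X-≡ (cong (λ j → j ℕ.* j) (ℕₚ.+-identityʳ m))) u-0 ⟫ 𝓢.*-identityʳ _))
    where
    open ℕₚ.≤-Reasoning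
    bound : ∀ r → m ℕ.* m ℕ.+ k ℕ.< (m ℕ.+ suc r) ℕ.* (m ℕ.+ suc r)
    bound r = begin-strict
      m ℕ.* m ℕ.+ k  ≤⟨ ℕₚ.+-monoʳ-≤ (m ℕ.* m) k≤m ⟩
      m ℕ.* m ℕ.+ m  ≡⟨ ℕₚ.+-comm (m ℕ.* m) m ⟩
      m ℕ.+ m ℕ.* m  ≡⟨ ℕₚ.*-suc m m ⟨
      m ℕ.* suc m  <⟨ ℕₚ.*-monoˡ-< (suc m) (ℕₚ.n<1+n m) ⟩
      suc m ℕ.* suc m  ≤⟨ ℕₚ.*-mono-≤ step step ⟩
      (m ℕ.+ suc r) ℕ.* (m ℕ.+ suc r) ∎
      where
      step : suc m ℕ.≤ m ℕ.+ suc r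
      step = subst (suc m ℕ.≤_) (sym (ℕₚ.+-suc m r)) (s≤s (ℕₚ.m≤m+n m r))

alt-X-odd : ∀ n → alt (X (suc (n ℕ.+ n))) ≈ ⊝ X (suc (n ℕ.+ n))
alt-X-odd n = alt-cong (≈-sym (X-+ 1 (n ℕ.+ n))) ⟫ alt-· _ _
  ⟫ ·-cong alt-X1 (alt-cong (≈-sym (dil-X n)) ⟫ alt-dil (X n) ⟫ dil-X n)
  ⟫ solve 2 (λ a b → :- a :* b := :- (a :* b)) ≈-refl (X 1) (X (n ℕ.+ n))
  ⟫ ⊝-cong (X-+ 1 (n ℕ.+ n))

alt-1⊕X-odd : ∀ n → alt (1⊕X (suc (n ℕ.+ n))) ≈ 1⊝X (suc (n ℕ.+ n))
alt-1⊕X-odd n = alt-⊕ _ _ ⟫ ⊕-cong (alt-C 1ℤ) (alt-X-odd n)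

pp·alt-pp : ∀ n → pp n · alt (pp n) ≈ dil (alt (pp n))
pp·alt-pp zero = 𝓢.*-identityˡ _ ⟫ alt-C 1ℤ ⟫ ≈-sym (dil-cong (alt-C 1ℤ) ⟫ dil-C 1ℤ)
pp·alt-pp (suc n) =
  ·-cong ≈-refl (alt-· (pp n) _ ⟫ ·-cong ≈-refl (alt-1⊕X-odd n))
  ⟫ solve 3 (λ p a x → p :* (con 1ℤ :+ x) :* (a :* (con 1ℤ :+ :- x)) := p :* a :* (con 1ℤ :+ :- (x :* x))) ≈-refl
      (pp n) (alt (pp n)) (X (suc (n ℕ.+ n)))
  ⟫ ·-cong (pp·alt-pp n) (⊕-cong ≈-refl (⊝-cong (X-+ _ _)) ⟫ ≈-sym (dil-1⊝X (suc (n ℕ.+ n)))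
      ⟫ dil-cong (≈-sym (alt-1⊕X-odd n)))
  ⟫ ≈-sym (dil-cong (alt-· (pp n) _) ⟫ dil-· _ _)

ε·alt-ε : ε · alt ε ≈ dil (alt ε)
ε·alt-ε = ≈-from-≈[] λ m →
  ·-cong[] (ε≈pp m) (alt-cong[] (ε≈pp m)) ⟫[] weaken m (pp·alt-pp m)
  ⟫[] dil-cong[] (alt-cong[] (≈[]-sym (ε≈pp m)))

-- The triple sum

sg-+ : ∀ a b → sg (a ℕ.+ b) ≡ sg a ℤ.* sg b
sg-+ zero    b = sym (ℤₚ.*-identityˡ (sg b))
sg-+ (suc a) b = trans (cong ℤ.-_ (sg-+ a b)) (ℤₚ.neg-distribˡ-* (sg a) (sg b))

sg² : ∀ a → sg a ℤ.* sg a ≡ 1ℤ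
sg² zero    = refl
sg² (suc a) = trans (neg*neg (sg a)) (sg² a)
  where
  neg*neg : ∀ x → ℤ.- x ℤ.* ℤ.- x ≡ x ℤ.* x
  neg*neg = ℤ-Solver.solve-∀

sg-sq : ∀ n → sg (n ℕ.* n) ≡ sg n
sg-sq zero    = refl
sg-sq (suc n) = cong ℤ.-_ (begin
  sg (n ℕ.+ n ℕ.* suc n)                ≡⟨ cong (λ k → sg (n ℕ.+ k)) (ℕₚ.*-suc n n) ⟩
  sg (n ℕ.+ (n ℕ.+ n ℕ.* n))            ≡⟨ trans (sg-+ n _) (cong (ℤ._*_ (sg n)) (sg-+ n (n ℕ.* n))) ⟩
  sg n ℤ.* (sg n ℤ.* sg (n ℕ.* n))      ≡⟨ ℤₚ.*-assoc (sg n) (sg n) (sg (n ℕ.* n)) ⟨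
  sg n ℤ.* sg n ℤ.* sg (n ℕ.* n)        ≡⟨ cong₂ ℤ._*_ (sg² n) (sg-sq n) ⟩
  1ℤ ℤ.* sg n                           ≡⟨ ℤₚ.*-identityˡ (sg n) ⟩
  sg n ∎)
  where open ≡-Reasoning

sgℤ : ℤ → ℤ
sgℤ z = sg ℤ.∣ z ∣

sgℤ-suc : ∀ z → sgℤ (ℤ.suc z) ≡ ℤ.- sgℤ z
sgℤ-suc (+ n)          = refl
sgℤ-suc -[1+ zero ]    = refl
sgℤ-suc -[1+ (suc n) ] = sym (ℤₚ.neg-involutive (sg (suc n)))

sgℤ-+ : ∀ z r → sgℤ (z ℤ.+ + r) ≡ sgℤ z ℤ.* sg r
sgℤ-+ z zero    = trans (cong sgℤ (ℤₚ.+-identityʳ z)) (sym (ℤₚ.*-identityʳ (sgℤ z)))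
sgℤ-+ z (suc r) = begin
  sgℤ (z ℤ.+ + suc r)      ≡⟨ cong sgℤ (move z (+ r)) ⟩
  sgℤ (ℤ.suc (z ℤ.+ + r))  ≡⟨ sgℤ-suc (z ℤ.+ + r) ⟩
  ℤ.- sgℤ (z ℤ.+ + r)      ≡⟨ cong ℤ.-_ (sgℤ-+ z r) ⟩
  ℤ.- (sgℤ z ℤ.* sg r)     ≡⟨ ℤₚ.neg-distribʳ-* (sgℤ z) (sg r) ⟩
  sgℤ z ℤ.* sg (suc r) ∎
  where
  open ≡-Reasoning
  move : ∀ z r → z ℤ.+ (+ 1 ℤ.+ r) ≡ + 1 ℤ.+ (z ℤ.+ r)
  move = ℤ-Solver.solve-∀

C-≡ : ∀ {a b} → a ≡ b → C a ≈ C b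
C-≡ refl = ≈-refl

dbl≡+ : ∀ n → dbl n ≡ n ℕ.+ n
dbl≡+ zero    = refl
dbl≡+ (suc n) = cong suc (trans (cong suc (dbl≡+ n)) (sym (ℕₚ.+-suc n n)))

-- ∑ u r zʳ = 1/(z;q²)_∞, so γ consists of the coefficients of
-- 1/((z;q²)_∞ (-z;q²)_∞) = 1/(z²;q⁴)_∞.
γ : ℕ → Series
γ N = Σs N λ r → C (sg r) · (u r · u (N ℕ.∸ r))

private
  Dq : ℕ → Series
  Dq r = X (r ℕ.+ r)

  -- This is u (r - 1), read as 0 at r = 0. Accordingly `γ⁻ N` is -γ (N - 1), and 0 at N = 0.
  ū : ℕ → Series
  ū r = 1⊝X (r ℕ.+ r) · u r

  ū-0 : ū 0 ≈ 0#
  ū-0 = ·-cong (⊕-cong ≈-refl (⊝-cong (≈-sym X-0)) ⟫ 𝓢.-‿inverseʳ 1#) ≈-refl ⟫ 𝓢.zeroˡ (u 0)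

  γ⁻ : ℕ → Series
  γ⁻ N = Σs N λ r → C (sg r) · (ū r · u (N ℕ.∸ r))

  γ⁻-0 : γ⁻ 0 ≈ 0#
  γ⁻-0 = ·-cong ≈-refl (·-cong ū-0 ≈-refl) ⟫ solve 2 (λ c u → c :* (con 0ℤ :* u) := con 0ℤ) ≈-refl (C (sg 0)) (u 0)

  γ⁻-suc : ∀ N → γ⁻ (suc N) ≈ ⊝ γ N
  γ⁻-suc N =
    ⊕-cong (·-cong ≈-refl (·-cong ū-0 ≈-refl))
           (Σs-cong N (λ r → ·-cong (C-neg (sg r)) (·-cong (u-suc r) ≈-refl)
              ⟫ solve 2 (λ c w → :- c :* w := con -1ℤ :* (c :* w)) ≈-refl (C (sg r)) (u r · u (N ℕ.∸ r)))
            ⟫ ≈-sym (Σs-·ˡ N (C -1ℤ) _))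
    ⟫ solve 3 (λ c w g → c :* (con 0ℤ :* w) :+ con -1ℤ :* g := :- g) ≈-refl (C (sg 0)) (u (suc N)) (γ N)

  -- For d = q^(2r) and e = q^(2(N+1-r)) the factor is 1 - de = (1 - d) + d(1 - e), and each part
  -- lowers one of the two indices. The first part gives -γ N, the second γ N - γ⁻ N.
  γ-step : ∀ N → 1⊝X (suc N ℕ.+ suc N) · γ (suc N) ≈ ⊝ γ⁻ N
  γ-step N =
    Σs-·ˡ (suc N) (1⊝X (suc N ℕ.+ suc N)) (λ r → C (sg r) · (u r · u (suc N ℕ.∸ r)))
    ⟫ Σs-cong≤ (suc N) {G = λ r → first r ⊕ second r} split
    ⟫ Σs-⊕ (suc N) first second
    ⟫ ⊕-cong (γ⁻-suc N) (Σs-last N second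
        ⟫ ⊕-cong (Σs-cong≤ N shorten)
                 (·-cong ≈-refl (·-cong ≈-refl (ū-≡ (ℕₚ.n∸n≡0 (suc N)) ⟫ ū-0))
                  ⟫ solve 2 (λ c w → c :* (w :* con 0ℤ) := con 0ℤ) ≈-refl (C (sg (suc N))) (Dq (suc N) · u (suc N)))
        ⟫ 𝓢.+-identityʳ _)
    ⟫ ≈-sym (
        ⊝-cong (Σs-cong N (λ r → solve 4 (λ c d a b → c :* ((con 1ℤ :+ :- d) :* a :* b)
            := c :* (a :* b) :+ con -1ℤ :* (c :* (d :* a :* b))) ≈-refl
                    (C (sg r)) (Dq r) (u r) (u (N ℕ.∸ r)))
                ⟫ Σs-⊕ N _ _ ⟫ ⊕-cong ≈-refl (≈-sym (Σs-·ˡ N (C -1ℤ) _)))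
        ⟫ solve 2 (λ a b → :- (a :+ con -1ℤ :* b) := :- a :+ b) ≈-refl (γ N) _)
    where
    first second : ℕ → Series
    first  r = C (sg r) · (ū r · u (suc N ℕ.∸ r))
    second r = C (sg r) · (Dq r · u r · ū (suc N ℕ.∸ r))
    ū-≡ : ∀ {a b} → a ≡ b → ū a ≈ ū b
    ū-≡ refl = ≈-refl
    split : ∀ r → r ℕ.≤ suc N → 1⊝X (suc N ℕ.+ suc N) · (C (sg r) · (u r · u (suc N ℕ.∸ r)))
      ≈ first r ⊕ second r
    split r r≤ =
      ·-cong (⊕-cong ≈-refl (⊝-cong (≈-sym (X-+ _ _ ⟫ X-≡ exponent)))) ≈-refl
      ⟫ solve 5 (λ d e c a b → (con 1ℤ :+ :- (d :* e)) :* (c :* (a :* b))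
            := c :* ((con 1ℤ :+ :- d) :* a :* b) :+ c :* (d :* a :* ((con 1ℤ :+ :- e) :* b))) ≈-refl
          (Dq r) (Dq (suc N ℕ.∸ r)) (C (sg r)) (u r) (u (suc N ℕ.∸ r))
      where
      exponent : r ℕ.+ r ℕ.+ (suc N ℕ.∸ r ℕ.+ (suc N ℕ.∸ r)) ≡ suc N ℕ.+ suc N
      exponent = trans (interchange r r _ _) (cong₂ ℕ._+_ (ℕₚ.m+[n∸m]≡n r≤) (ℕₚ.m+[n∸m]≡n r≤))
        where
        interchange : ∀ a b c d → a ℕ.+ b ℕ.+ (c ℕ.+ d) ≡ a ℕ.+ c ℕ.+ (b ℕ.+ d)
        interchange = ℕ-Solver.solve-∀
    shorten : ∀ r → r ℕ.≤ N → second r ≈ C (sg r) · (Dq r · u r · u (N ℕ.∸ r))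
    shorten r r≤N = ·-cong ≈-refl (·-cong ≈-refl (ū-≡ (ℕₚ.+-∸-assoc 1 r≤N) ⟫ u-suc (N ℕ.∸ r)))

-- Coefficient form of (1 - t²) F(t) = F(q²t) for F(t) = 1/(t²;q⁴)_∞.
γ-suc-suc : ∀ N → 1⊝X (suc (suc N) ℕ.+ suc (suc N)) · γ (suc (suc N)) ≈ γ N
γ-suc-suc N = γ-step (suc N) ⟫ ⊝-cong (γ⁻-suc N) ⟫ solve 1 (λ x → :- (:- x) := x) ≈-refl (γ N)

γ-even : ∀ M → γ (dbl M) ≈ dil (u M)
γ-even zero = ·-cong ≈-refl (·-cong u-0 u-0) ⟫ solve 0 (con 1ℤ :* (con 1ℤ :* con 1ℤ) := con 1ℤ) ≈-refl
  ⟫ ≈-sym (dil-cong u-0 ⟫ dil-C 1ℤ)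
γ-even (suc M) = ·-cancelˡ (1⊝X (a ℕ.+ a)) (1⊝X-0 _)
  (γ-suc-suc (dbl M) ⟫ γ-even M
   ⟫ ≈-sym (·-cong (⊕-cong ≈-refl (⊝-cong (X-≡ (cong₂ ℕ._+_ (dbl≡+ (suc M)) (dbl≡+ (suc M)))))
       ⟫ ≈-sym (dil-1⊝X (suc M ℕ.+ suc M))) ≈-refl
            ⟫ ≈-sym (dil-· _ _) ⟫ dil-cong (u-suc M)))
  where a = dbl (suc M)

γ-odd : ∀ M → γ (suc (dbl M)) ≈ 0#
γ-odd zero = ·-cancelˡ (1⊝X 2) (1⊝X-0 1)
  (γ-step 0 ⟫ ⊝-cong γ⁻-0 ⟫ solve 1 (λ x → :- con 0ℤ := x :* con 0ℤ) ≈-refl (1⊝X 2))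
γ-odd (suc M) = ·-cancelˡ (1⊝X (a ℕ.+ a)) (1⊝X-0 _)
  (γ-suc-suc (suc (dbl M)) ⟫ γ-odd M ⟫ ≈-sym (𝓢.zeroʳ _))
  where a = suc (dbl (suc M))

Y⁺ Y⁻ : ℕ → ℤ → Series
Y⁺ L z = Σs L λ r → Q (z ℤ.+ + r) · u r
Y⁻ L z = Σs L λ s → Q (z ℤ.- + s) · u s

-- The character `χ` will be 1 for the sum that contains v₀ and (-1)^z for the theta identity. With
-- x = z + r and N = r + s the exponents (z+r)² and (z-s)² become x² and (x-N)². The choice L = 2m +
-- 1 pairs the N ≤ L as 2M, 2M + 1 with M ≤ m, and for N > L the numbers x and x - N cannot both
-- have size at most m.
module TripleSum (χ : ℤ → ℤ) (χ-+ : ∀ z r → χ (z ℤ.+ + r) ≡ χ z ℤ.* χ (+ r)) 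
  (m L : ℕ) (L≡ : L ≡ suc (dbl m)) where

  R : ℕ → ℤ → Series
  R N x = C (χ x) · (Q x · Q (x ℤ.- + N))

  Θ : ℕ → Series
  Θ N = Σℤ m (R N)

  R-order : ∀ N x → m ℕ.< ℤ.∣ x ∣ → R N x ≈[ m ] 0#
  R-order N x m<x = ·-cong[] ≈[]-refl (Q·-order x _ m<x) ⟫[] weaken m (𝓢.zeroʳ _)

  R-order′ : ∀ N x → m ℕ.< ℤ.∣ x ℤ.- + N ∣ → R N x ≈[ m ] 0#
  R-order′ N x m<x = ·-cong[] ≈[]-refl (·-cong[] ≈[]-refl (Q-order (x ℤ.- + N) m<x))
    ⟫[] weaken m (solve 2 (λ c q → c :* (q :* con 0ℤ) := con 0ℤ) ≈-refl (C (χ x)) (Q x))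

  Θ-order : ∀ N → L ℕ.< N → Θ N ≈[ m ] 0#
  Θ-order N L<N = Σℤ-cong[] m (λ x x≤m → R-order′ N x (bound x x≤m)) ⟫[] weaken m (Σℤ-zero m)
    where
    open ℕₚ.≤-Reasoning
    Σℤ-zero : ∀ k → Σℤ k (λ _ → 0#) ≈ 0#
    Σℤ-zero zero    = ≈-refl
    Σℤ-zero (suc k) = ⊕-cong (Σℤ-zero k) ≈-refl ⟫ solve 0 (con 0ℤ :+ (con 0ℤ :+ con 0ℤ) := con 0ℤ) ≈-refl
    difference : ∀ x N → x ℤ.- (x ℤ.- N) ≡ N
    difference = ℤ-Solver.solve-∀
    bound : ∀ x → ℤ.∣ x ∣ ℕ.≤ m → m ℕ.< ℤ.∣ x ℤ.- + N ∣
    bound x x≤m = ℕₚ.+-cancelˡ-< m _ _ (begin-strict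
      m ℕ.+ m                          ≡⟨ dbl≡+ m ⟨
      dbl m                            <⟨ ℕₚ.n<1+n (dbl m) ⟩
      suc (dbl m)                      ≡⟨ L≡ ⟨
      L                                <⟨ L<N ⟩
      N                                ≡⟨ cong ℤ.∣_∣ (difference x (+ N)) ⟨
      ℤ.∣ x ℤ.- (x ℤ.- + N) ∣          ≤⟨ ℤₚ.∣i-j∣≤∣i∣+∣j∣ x (x ℤ.- + N) ⟩
      ℤ.∣ x ∣ ℕ.+ ℤ.∣ x ℤ.- + N ∣      ≤⟨ ℕₚ.+-monoˡ-≤ _ x≤m ⟩
      m ℕ.+ ℤ.∣ x ℤ.- + N ∣ ∎)

  Θ-shift : ∀ r s → Σℤ m (λ z → R (r ℕ.+ s) (z ℤ.+ + r)) ≈[ m ] Θ (r ℕ.+ s)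
  Θ-shift r s = Σℤ-shift m r (R (r ℕ.+ s)) (λ k → R-order (r ℕ.+ s) _ (s≤s (ℕₚ.m≤m+n m k))) below
    where
    collapse : ∀ m j d s → ℤ.- m ℤ.+ j ℤ.- (+ 1 ℤ.+ j ℤ.+ d ℤ.+ s) ≡ ℤ.- (+ 1 ℤ.+ (m ℤ.+ (d ℤ.+ s)))
    collapse = ℤ-Solver.solve-∀
    -- At the lower edge x = -m + j may itself be small, but x - N is below -m, so the second theta
    -- factor has high order.
    below : ∀ j → j ℕ.< r → R (r ℕ.+ s) (ℤ.- (+ m) ℤ.+ + j) ≈[ m ] 0#
    below j j<r with ℕₚ.m≤n⇒∃[o]m+o≡n j<r
    ... | d , refl = R-order′ (r ℕ.+ s) _ (subst (m ℕ.<_) (sym (cong ℤ.∣_∣ (collapse (+ m) (+ j) (+ d) (+ s))))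
                       (s≤s (ℕₚ.m≤m+n m (d ℕ.+ s))))

  -- Centring the sum by x = z + M turns the exponent into (z+M)² + (z-M)² = 2M² + 2z², which
  -- separates M from z.
  Θ-even : ∀ M → Θ (dbl M) ≈[ m ] C (χ (+ M)) · dil (Q (+ M)) · Σℤ m λ z → C (χ z) · dil (Q z)
  Θ-even M = weaken m (Θ-≡ (dbl≡+ M)) ⟫[] ≈[]-sym (Θ-shift M M)
    ⟫[] weaken m (Σℤ-cong m factor ⟫ ≈-sym (Σℤ-·ˡ m _ _))
    where
    Θ-≡ : ∀ {a b} → a ≡ b → Θ a ≈ Θ b
    Θ-≡ refl = ≈-refl
    parallelogram : ∀ z M → (z ℤ.+ M) ℤ.* (z ℤ.+ M) ℤ.+ (z ℤ.+ M ℤ.- (M ℤ.+ M)) ℤ.* (z ℤ.+ M ℤ.- (M ℤ.+ M))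
      ≡ M ℤ.* M ℤ.+ M ℤ.* M ℤ.+ (z ℤ.* z ℤ.+ z ℤ.* z)
    parallelogram = ℤ-Solver.solve-∀
    exponent : ∀ z → + (sq (z ℤ.+ + M) ℕ.+ sq (z ℤ.+ + M ℤ.- + (M ℕ.+ M)))
                     ≡ + (sq (+ M) ℕ.+ sq (+ M) ℕ.+ (sq z ℕ.+ sq z))
    exponent z = trans (cong₂ ℤ._+_ (+sq (z ℤ.+ + M)) (+sq (z ℤ.+ + M ℤ.- + (M ℕ.+ M))))
      (trans (parallelogram z (+ M))
        (sym (cong₂ ℤ._+_ (cong₂ ℤ._+_ (+sq (+ M)) (+sq (+ M))) (cong₂ ℤ._+_ (+sq z) (+sq z)))))
    factor : ∀ z → R (M ℕ.+ M) (z ℤ.+ + M) ≈ C (χ (+ M)) · dil (Q (+ M)) · (C (χ z) · dil (Q z))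
    factor z = ·-cong (C-≡ (χ-+ z M) ⟫ C-* _ _)
        (X-+ _ _ ⟫ X-≡ℤ (exponent z) ⟫ ≈-sym (X-+ _ _) ⟫ ·-cong (≈-sym (dil-X (sq (+ M)))) (≈-sym (dil-X (sq z))))
      ⟫ solve 4 (λ a b c d → a :* b :* (c :* d) := b :* c :* (a :* d)) ≈-refl
          (C (χ z)) (C (χ (+ M))) (dil (Q (+ M))) (dil (Q z))

  weighted : ℤ → Series
  weighted z = Σs L λ r → C (χ (z ℤ.+ + r) ℤ.* sg r) · (Q (z ℤ.+ + r) · u r)

  triple-sum : Σℤ m (λ z → weighted z · Y⁻ L z)
    ≈[ m ] Σs m (λ M → C (χ (+ M)) · dil (Q (+ M) · u M)) · Σℤ m (λ z → C (χ z) · dil (Q z))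
  triple-sum =
    weaken m (Σℤ-cong m (λ z → Σs-·ʳ L _ _ ⟫ Σs-cong L (λ r → Σs-·ˡ L _ _))
      ⟫ Σℤ-Σs-swap m L _
      ⟫ Σs-cong L (λ r → Σℤ-Σs-swap m L _ ⟫ Σs-cong L (λ s →
          Σℤ-cong m (regroup r s) ⟫ ≈-sym (Σℤ-·ˡ m _ _))))
    ⟫[] Σs-cong[] L (λ r _ → Σs-cong[] L λ s _ → ·-cong[] ≈[]-refl (Θ-shift r s))
    ⟫[] Σs-square L (λ r s → C (sg r) · (u r · u s) · Θ (r ℕ.+ s))
          (λ r s L<r+s → ·-cong[] ≈[]-refl (Θ-order (r ℕ.+ s) L<r+s) ⟫[] weaken m (𝓢.zeroʳ _))
    ⟫[] weaken m (Σs-cong L (λ N → Σs-cong≤ N (λ r r≤N → ·-cong ≈-refl (Θ-≡ (ℕₚ.m+[n∸m]≡n r≤N)))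
                                   ⟫ ≈-sym (Σs-·ʳ N (Θ N) _))
                  ⟫ Σs-≡ L≡ (λ N → γ N · Θ N) ⟫ Σs-parity m (λ N → γ N · Θ N)
                  ⟫ ⊕-cong (Σs-cong m (λ M → ·-cong (γ-even M) ≈-refl))
                           (Σs-cong m (λ M → ·-cong (γ-odd M) ≈-refl ⟫ 𝓢.zeroˡ _) ⟫ Σs-zero m)
                  ⟫ 𝓢.+-identityʳ _)
    ⟫[] Σs-cong[] m (λ M _ → ·-cong[] ≈[]-refl (Θ-even M))
    ⟫[] weaken m (Σs-cong m (λ M →
          solve 4 (λ u c q s → u :* (c :* q :* s) := c :* (q :* u) :* s)
              ≈-refl (dil (u M)) (C (χ (+ M))) (dil (Q (+ M))) _
          ⟫ ·-cong (·-cong ≈-refl (≈-sym (dil-· (Q (+ M)) (u M)))) ≈-refl)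
        ⟫ ≈-sym (Σs-·ʳ m _ _))
    where
    Θ-≡ : ∀ {a b} → a ≡ b → Θ a ≈ Θ b
    Θ-≡ refl = ≈-refl
    Σs-≡ : ∀ {a b} → a ≡ b → ∀ F → Σs a F ≈ Σs b F
    Σs-≡ refl F = ≈-refl
    Σs-zero : ∀ k → Σs k (λ _ → 0#) ≈ 0#
    Σs-zero zero    = ≈-refl
    Σs-zero (suc k) = 𝓢.+-identityˡ _ ⟫ Σs-zero k
    reindex : ∀ z r s → z ℤ.- s ≡ z ℤ.+ r ℤ.- (r ℤ.+ s)
    reindex = ℤ-Solver.solve-∀
    regroup : ∀ r s z → C (χ (z ℤ.+ + r) ℤ.* sg r) · (Q (z ℤ.+ + r) · u r) · (Q (z ℤ.- + s) · u s)
                        ≈ C (sg r) · (u r · u s) · R (r ℕ.+ s) (z ℤ.+ + r)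
    regroup r s z = ·-cong (·-cong (C-* _ _) ≈-refl) (·-cong (X-≡ (cong sq (reindex z (+ r) (+ s)))) ≈-refl)
      ⟫ solve 6 (λ c g q v p w → c :* g :* (q :* v) :* (p :* w) := g :* (v :* w) :* (c :* (q :* p))) ≈-refl
          (C (χ (z ℤ.+ + r))) (C (sg r)) (Q (z ℤ.+ + r)) (u r) (Q (z ℤ.+ + r ℤ.- + (r ℕ.+ s))) (u s)

-- The generating function of v₀(2n)

Q-neg : ∀ {z w} → z ℤ.* z ≡ w ℤ.* w → Q z ≈ Q w
Q-neg {z} {w} p = X-≡ℤ (trans (+sq z) (trans p (sym (+sq w))))

-- φ = ∑_{z ∈ ℤ} q^{z²}; only |z| ≤ n contributes to the coefficient of qⁿ.
φ : Series
φ n = Σℤ n Q n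

φ-approx : ∀ m → φ ≈[ m ] Σℤ m Q
φ-approx m = upTo λ k k≤m → go m k≤m
  where
  go : ∀ {k} m → k ℕ.≤ m → Σℤ k Q k ≡ Σℤ m Q k
  go {zero} zero _ = refl
  go {k} (suc m) k≤m with ℕₚ.m≤n⇒m<n∨m≡n k≤m
  ... | inj₂ refl = refl
  ... | inj₁ (s≤s k<m) = trans (go m k<m) (coeff (≈[]-sym (
          ⊕-cong[] (≈[]-refl {m = k}) (⊕-cong[] (Q-order (+ suc m) (s≤s k<m)) (Q-order -[1+ m ] (s≤s k<m)))
          ⟫[] weaken k (solve 1 (λ x → x :+ (con 0ℤ :+ con 0ℤ) := x) ≈-refl (Σℤ m Q)))) k ℕₚ.≤-refl)

Y⁺-pos : ∀ n {m} L → m ℕ.≤ L → Y⁺ L (+ n) ≈[ m ] P n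
Y⁺-pos n L m≤L = ≈[]-sym (P-approx n L m≤L)

Y⁻-pos : ∀ n {m} L → n ℕ.+ m ℕ.≤ L → Y⁻ L (+ n) ≈[ m ] pp n · ε
Y⁻-pos = M-approx

Y⁺-neg : ∀ L n → Y⁺ L -[1+ n ] ≈ Y⁻ L (+ suc n)
Y⁺-neg L n = Σs-cong L λ r → ·-cong (Q-neg {z = -[1+ n ] ℤ.+ + r}
    {w = + suc n ℤ.- + r} (flip (+ suc n) (+ r))) ≈-refl
  where
  flip : ∀ n r → (ℤ.- n ℤ.+ r) ℤ.* (ℤ.- n ℤ.+ r) ≡ (n ℤ.- r) ℤ.* (n ℤ.- r)
  flip = ℤ-Solver.solve-∀

Y⁻-neg : ∀ L n → Y⁻ L -[1+ n ] ≈ Y⁺ L (+ suc n)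
Y⁻-neg L n = Σs-cong L λ r → ·-cong (Q-neg {z = -[1+ n ] ℤ.- + r}
    {w = + suc n ℤ.+ + r} (flip (+ suc n) (+ r))) ≈-refl
  where
  flip : ∀ n r → (ℤ.- n ℤ.- r) ℤ.* (ℤ.- n ℤ.- r) ≡ (n ℤ.+ r) ℤ.* (n ℤ.+ r)
  flip = ℤ-Solver.solve-∀

alt-Q : ∀ z → alt (Q z) ≈ C (sgℤ z) · Q z
alt-Q z = alt-X (sq z) ⟫ ·-cong (C-≡ (sg-sq ℤ.∣ z ∣)) ≈-refl

C-sg² : ∀ n → C (sg n) · C (sg n) ≈ 1#
C-sg² n = ≈-sym (C-* (sg n) (sg n)) ⟫ C-≡ (sg² n)

alt-pp·P : ∀ n → alt (pp n) · alt (P n) ≈ C (sg n) · Q (+ n) · alt ε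
alt-pp·P n = ≈-sym (alt-· (pp n) (P n)) ⟫ alt-cong (pp·P n) ⟫ alt-· (Q (+ n)) ε ⟫ ·-cong (alt-Q (+ n)) ≈-refl

alt-at-0 : ∀ f → alt f 0 ≡ f 0
alt-at-0 f = trans (sym (ev-at (alt f) 0)) (trans (at (ev-alt f) 0) (ev-at f 0))

⊖-def : ∀ f g → f ⊖ g ≈ f ⊕ ⊝ g
⊖-def f g = pointwise λ n → sym (trans (⊕-at f (⊝ g) n) (cong (ℤ._+_ (f n)) (⊝-at g n)))

negˢ-def : ∀ f → negˢ f ≈ ⊝ f
negˢ-def f = pointwise λ n → sym (⊝-at f n)

q²-power : ∀ n → (q^ 2) ^ˢ n ≈ X (n ℕ.+ n)
q²-power zero    = X-def 0
q²-power (suc n) = ·-def (q^ 2) ((q^ 2) ^ˢ n) ⟫ ·-cong (X-def 2) (q²-power n) ⟫ X-+ 2 (n ℕ.+ n)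
  ⟫ X-≡ (cong suc (sym (ℕₚ.+-suc n n)))

poch-step : ∀ a n → poch a (q^ 2) (suc n) ≈ poch a (q^ 2) n · (1# ⊕ ⊝ (a · X (n ℕ.+ n)))
poch-step a n = ·-def (poch a (q^ 2) n) _ ⟫ ·-cong ≈-refl (⊖-def _ _
  ⟫ ⊕-cong (X-def 0 ⟫ ≈-sym X-0) (⊝-cong (·-def a _ ⟫ ·-cong ≈-refl (q²-power n))))

poch-neg : ∀ n → poch (negˢ (q^ 1)) (q^ 2) n ≈ pp n
poch-neg zero    = X-def 0 ⟫ ≈-sym X-0
poch-neg (suc n) = poch-step (negˢ (q^ 1)) n ⟫ ·-cong (poch-neg n) (⊕-cong ≈-refl (
  ⊝-cong (·-cong (negˢ-def (q^ 1) ⟫ ⊝-cong (X-def 1)) ≈-refl)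
  ⟫ solve 2 (λ x y → :- (:- x :* y) := x :* y) ≈-refl (X 1) (X (n ℕ.+ n)) ⟫ X-+ 1 (n ℕ.+ n)))

poch-pos : ∀ n → poch (q^ 1) (q^ 2) n ≈ alt (pp n)
poch-pos zero    = X-def 0 ⟫ ≈-sym X-0 ⟫ ≈-sym (alt-C 1ℤ)
poch-pos (suc n) = poch-step (q^ 1) n ⟫ ·-cong (poch-pos n)
    (⊕-cong ≈-refl (⊝-cong (·-cong (X-def 1) ≈-refl ⟫ X-+ 1 (n ℕ.+ n))) ⟫ ≈-sym (alt-1⊕X-odd n))
  ⟫ ≈-sym (alt-· (pp n) _)

v₀-term-clear : ∀ n → alt (pp n) · v₀-term n ≈ Q (+ n) · pp n
v₀-term-clear n =
  ·-cong (≈-sym (poch-pos n)) (·-def _ (inv p) ⟫ ·-cong (·-def (q^ (n ℕ.* n)) _) ≈-refl)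
  ⟫ solve 3 (λ p a i → p :* (a :* i) := a :* (p :* i)) ≈-refl p (q^ (n ℕ.* n) · poch (negˢ (q^ 1)) (q^ 2) n) (inv p)
  ⟫ ·-cong (·-cong (X-def (n ℕ.* n)) (poch-neg n)) (inv-inverse p (poch-constant (q^ 1) (q^ 2) n refl))
  ⟫ 𝓢.*-identityʳ _
  where p = poch (q^ 1) (q^ 2) n

v₀-approx : ∀ m → v₀ ≈[ m ] Σs m v₀-term
v₀-approx m = ∑ˢ-approx v₀-term m (λ n k k<n → v₀-term-order n k (ℕₚ.<-≤-trans k<n (∣z∣≤sq (+ n)))) ℕₚ.≤-refl

ε-approx : ∀ m → ε ≈[ m ] Σs m λ r → Q (+ r) · u r
ε-approx m = P-approx 0 m ℕₚ.≤-refl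

private
  -- Under q ↦ -q, `pp·P` acquires the sign (-1)^n of q^(n²), which the factor in front cancels.
  -- What remains besides ε(q) ε(-q) is q^(n²) (-q;q²)_n / (q;q²)_n.
  product-term : ∀ {m} n L → n ℕ.+ m ℕ.≤ L →
    C (sg n) · alt (Y⁺ L (+ n)) · Y⁻ L (+ n) ≈[ m ] ε · alt ε · v₀-term n
  product-term {m} n L n+m≤L = ·-cancelˡ[] (alt (pp n)) (trans (alt-at-0 (pp n)) (pp-0 n)) (
    ·-cong[] ≈[]-refl (·-cong[] (·-cong[] ≈[]-refl (alt-cong[] (Y⁺-pos n L (ℕₚ.m+n≤o⇒n≤o n n+m≤L))))
        (Y⁻-pos n L n+m≤L))
    ⟫[] weaken m (
      solve 5 (λ a s b p e → a :* (s :* b :* (p :* e)) := s :* (a :* b) :* (p :* e)) ≈-refl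
        (alt (pp n)) (C (sg n)) (alt (P n)) (pp n) ε
      ⟫ ·-cong (·-cong ≈-refl (alt-pp·P n)) ≈-refl
      ⟫ solve 5 (λ s q b p e → s :* (s :* q :* b) :* (p :* e) := s :* s :* (e :* b) :* (q :* p)) ≈-refl
          (C (sg n)) (Q (+ n)) (alt ε) (pp n) ε
      ⟫ ·-cong (·-cong (C-sg² n) ≈-refl) (≈-sym (v₀-term-clear n))
      ⟫ solve 3 (λ k a v → con 1ℤ :* k :* (a :* v) := a :* (k :* v)) ≈-refl (ε · alt ε) (alt (pp n)) (v₀-term n)))

  alt-C· : ∀ c f → alt (C c · f) ≈ C c · alt f
  alt-C· c f = alt-· (C c) f ⟫ ·-cong (alt-C c) ≈-refl

  -- Replacing z by -z exchanges `Y⁺` and `Y⁻`, which on the product amounts to q ↦ -q. This is why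
  -- v₀(-q) is the negative half of the bilateral sum.
  product-term-neg : ∀ n L → C (sg (suc n)) · alt (Y⁺ L -[1+ n ]) · Y⁻ L -[1+ n ]
    ≈ alt (C (sg (suc n)) · alt (Y⁺ L (+ suc n)) · Y⁻ L (+ suc n))
  product-term-neg n L =
    ·-cong (·-cong ≈-refl (alt-cong (Y⁺-neg L n))) (Y⁻-neg L n)
    ⟫ solve 3 (λ c a b → c :* a :* b := c :* b :* a) ≈-refl (C (sg (suc n))) (alt (Y⁻ L (+ suc n))) (Y⁺ L (+ suc n))
    ⟫ ≈-sym (alt-· _ _ ⟫ ·-cong (alt-C· (sg (suc n)) _ ⟫ ·-cong ≈-refl (alt-alt _)) ≈-refl)

K : Series
K = ε · alt ε

alt-K : alt K ≈ K
alt-K = alt-· ε (alt ε) ⟫ ·-cong ≈-refl (alt-alt ε) ⟫ 𝓢.*-comm (alt ε) ε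

private
  level : ℕ → ℕ
  level m = suc (dbl m)

  k+m≤level : ∀ {k m} → k ℕ.≤ m → k ℕ.+ m ℕ.≤ level m
  k+m≤level {k} {m} k≤m = ℕₚ.≤-trans (ℕₚ.+-monoˡ-≤ m k≤m) (ℕₚ.≤-trans (ℕₚ.≤-reflexive
      (sym (dbl≡+ m))) (ℕₚ.n≤1+n (dbl m)))

K·v₀ : K · (v₀ ⊕ alt v₀ ⊕ ⊝ 1#) ≈ dil ε · dil φ
K·v₀ = ≈-from-≈[] λ m →
  ·-cong[] ≈[]-refl (⊕-cong[] (⊕-cong[] (v₀-approx m) (alt-cong[] (v₀-approx m))) ≈[]-refl)
  ⟫[] ≈[]-sym (partial m m ℕₚ.≤-refl)
  ⟫[] weaken m (Σℤ-cong m λ z → ·-cong (resign z (level m)) ≈-refl)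
  ⟫[] TripleSum.triple-sum (λ _ → 1ℤ) (λ _ _ → refl) m (level m) refl
  ⟫[] weaken m (·-cong (Σs-cong m (λ M → 𝓢.*-identityˡ _) ⟫ ≈-sym (Σs-dil m λ M → Q (+ M) · u M))
                       (Σℤ-cong m (λ z → 𝓢.*-identityˡ _) ⟫ ≈-sym (Σℤ-dil m Q)))
  ⟫[] ·-cong[] (dil-cong[] (≈[]-sym (ε-approx m))) (dil-cong[] (≈[]-sym (φ-approx m)))
  where
  signed : ℕ → ℤ → Series
  signed L z = C (sgℤ z) · alt (Y⁺ L z)

  -- The substitution q ↦ -q puts (-1)^(z+r) on q^((z+r)²); with the outer (-1)^z this leaves the
  -- alternating sign of `γ`.
  resign : ∀ z L → signed L z ≈ Σs L λ r → C (1ℤ ℤ.* sg r) · (Q (z ℤ.+ + r) · u r)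
  resign z L = ·-cong ≈-refl (Σs-alt L _) ⟫ Σs-·ˡ L _ _ ⟫ Σs-cong L λ r →
    ·-cong ≈-refl (alt-· _ _ ⟫ ·-cong (alt-Q (z ℤ.+ + r)) (alt-u r))
    ⟫ solve 4 (λ a b q v → a :* (b :* q :* v) := a :* b :* (q :* v)) ≈-refl
        (C (sgℤ z)) (C (sgℤ (z ℤ.+ + r))) (Q (z ℤ.+ + r)) (u r)
    ⟫ ·-cong (≈-sym (C-* _ _) ⟫ C-≡ (cancel z r)) ≈-refl
    where
    cancel : ∀ z r → sgℤ z ℤ.* sgℤ (z ℤ.+ + r) ≡ 1ℤ ℤ.* sg r
    cancel z r = trans (cong (ℤ._*_ (sgℤ z)) (sgℤ-+ z r)) (trans (sym (ℤₚ.*-assoc (sgℤ z) (sgℤ z) (sg r)))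
      (cong (ℤ._* sg r) (sg² ℤ.∣ z ∣)))

  -- Enlarging the window adds z = k + 1 to v₀ and z = -(k + 1) to `alt v₀`. The term z = 0 occurs
  -- in both, hence the `⊝ 1#`.
  partial : ∀ m k → k ℕ.≤ m →
    Σℤ k (λ z → signed (level m) z · Y⁻ (level m) z) ≈[ m ] K · (Σs k v₀-term ⊕ alt (Σs k v₀-term) ⊕ ⊝ 1#)
  partial m zero _ = product-term 0 (level m) (k+m≤level z≤n)
    ⟫[] weaken m (·-cong ≈-refl (v₀-term-0 ⟫ ≈-sym (
        ⊕-cong (⊕-cong v₀-term-0 (alt-cong v₀-term-0 ⟫ alt-C 1ℤ)) ≈-refl
        ⟫ solve 0 (con 1ℤ :+ con 1ℤ :+ :- con 1ℤ := con 1ℤ) ≈-refl)))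
    where
    v₀-term-0 : v₀-term 0 ≈ 1#
    v₀-term-0 = ≈-sym (𝓢.*-identityˡ _) ⟫ ·-cong (≈-sym (alt-C 1ℤ)) ≈-refl ⟫ v₀-term-clear 0
      ⟫ ·-cong (≈-sym X-0) ≈-refl ⟫ 𝓢.*-identityˡ 1#
  partial m (suc k) k<m =
    ⊕-cong[] (partial m k (ℕₚ.<⇒≤ k<m))
      (⊕-cong[] (product-term (suc k) (level m) (k+m≤level k<m))
                (weaken m (product-term-neg k (level m))
                    ⟫[] alt-cong[] (product-term (suc k) (level m) (k+m≤level k<m))
                 ⟫[] weaken m (alt-· K _ ⟫ ·-cong alt-K ≈-refl)))
    ⟫[] weaken m (
      solve 6 (λ k s a o v w → k :* (s :+ a :+ o) :+ (k :* v :+ k :* w) := k :* ((s :+ v) :+ (a :+ w) :+ o)) ≈-refl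
        K (Σs k v₀-term) (alt (Σs k v₀-term)) (⊝ 1#) (v₀-term (suc k)) (alt (v₀-term (suc k)))
      ⟫ ·-cong ≈-refl (⊕-cong (⊕-cong (≈-sym (Σs-last k v₀-term))
          (≈-sym (alt-cong (Σs-last k v₀-term) ⟫ alt-⊕ _ _))) ≈-refl))

-- For χ = (-1)^z the signs (-1)^(z+r) and (-1)^r leave (-1)^z, which is free of r. The summand is
-- then (-1)^z `Y⁺` `Y⁻` = (-1)^z q^(z²) ε², and ε² comes out of the sum over z.
ε²·alt-φ : ε · ε · alt φ ≈ dil (alt ε) · dil (alt φ)
ε²·alt-φ = ≈-from-≈[] λ m →
  ·-cong[] ≈[]-refl (alt-cong[] (φ-approx m))
  ⟫[] weaken m (·-cong ≈-refl (Σℤ-alt m Q) ⟫ Σℤ-·ˡ m _ _)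
  ⟫[] ≈[]-sym (Σℤ-cong[] m (term m))
  ⟫[] weaken m (Σℤ-cong m λ z → ·-cong (resign z (level m)) ≈-refl)
  ⟫[] TripleSum.triple-sum sgℤ sgℤ-+ m (level m) refl
  ⟫[] weaken m (·-cong (Σs-cong m (λ M →
                           ·-cong (≈-sym (dil-C _)) ≈-refl ⟫ ≈-sym (dil-· _ _) ⟫ dil-cong (
                             ≈-sym (𝓢.*-assoc _ _ _) ⟫ ≈-sym (alt-· _ _ ⟫ ·-cong (alt-Q (+ M)) (alt-u M))))
                         ⟫ ≈-sym (dil-cong (Σs-alt m _) ⟫ Σs-dil m _))
                       (Σℤ-cong m (λ z → ·-cong (≈-sym (dil-C _)) ≈-refl ⟫ ≈-sym (dil-· _ _)
                           ⟫ dil-cong (≈-sym (alt-Q z)))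
                         ⟫ ≈-sym (dil-cong (Σℤ-alt m Q) ⟫ Σℤ-dil m _)))
  ⟫[] ·-cong[] (dil-cong[] (alt-cong[] (≈[]-sym (ε-approx m)))) (dil-cong[] (alt-cong[] (≈[]-sym (φ-approx m))))
  where
  signed : ℕ → ℤ → Series
  signed L z = C (sgℤ z) · Y⁺ L z

  resign : ∀ z L → signed L z ≈ Σs L λ r → C (sgℤ (z ℤ.+ + r) ℤ.* sg r) · (Q (z ℤ.+ + r) · u r)
  resign z L = Σs-·ˡ L _ _ ⟫ Σs-cong L λ r → ·-cong (C-≡ (sym (cancel r))) ≈-refl
    where
    cancel : ∀ r → sgℤ (z ℤ.+ + r) ℤ.* sg r ≡ sgℤ z
    cancel r = trans (cong (ℤ._* sg r) (sgℤ-+ z r)) (trans (ℤₚ.*-assoc (sgℤ z) (sg r) (sg r))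
      (trans (cong (ℤ._*_ (sgℤ z)) (sg² r)) (ℤₚ.*-identityʳ (sgℤ z))))

  term⁺ : ∀ m n → n ℕ.≤ m → signed (level m) (+ n) · Y⁻ (level m) (+ n) ≈[ m ] ε · ε · alt (Q (+ n))
  term⁺ m n n≤m = ·-cong[] (·-cong[] ≈[]-refl (Y⁺-pos n (level m) (ℕₚ.m+n≤o⇒n≤o n (k+m≤level n≤m))))
      (Y⁻-pos n (level m) (k+m≤level n≤m))
    ⟫[] weaken m (
      solve 4 (λ c p w e → c :* p :* (w :* e) := c :* e :* (w :* p)) ≈-refl (C (sg n)) (P n) (pp n) ε
      ⟫ ·-cong ≈-refl (pp·P n)
      ⟫ solve 3 (λ c q e → c :* e :* (q :* e) := e :* e :* (c :* q)) ≈-refl (C (sg n)) (Q (+ n)) ε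
      ⟫ ·-cong ≈-refl (≈-sym (alt-Q (+ n))))

  term : ∀ m z → ℤ.∣ z ∣ ℕ.≤ m → signed (level m) z · Y⁻ (level m) z ≈[ m ] ε · ε · alt (Q z)
  term m (+ n)    n≤m = term⁺ m n n≤m
  term m -[1+ n ] n≤m = weaken m (
      ·-cong (·-cong ≈-refl (Y⁺-neg (level m) n)) (Y⁻-neg (level m) n)
      ⟫ solve 3 (λ c a b → c :* a :* b := c :* b :* a) ≈-refl (C (sg (suc n)))
          (Y⁻ (level m) (+ suc n)) (Y⁺ (level m) (+ suc n)))
    ⟫[] term⁺ m (suc n) n≤m

ε-0 : ε 0 ≡ 1ℤ
ε-0 = trans (coeff (ε≈pp 0) 0 z≤n) (C-at-0 1ℤ)

alt-ε-0 : alt ε 0 ≡ 1ℤ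
alt-ε-0 = trans (alt-at-0 ε) ε-0

ε·alt-φ : ε · alt φ ≈ alt ε · dil (alt φ)
ε·alt-φ = ·-cancelˡ ε ε-0 (≈-sym (𝓢.*-assoc _ _ _) ⟫ ε²·alt-φ ⟫ ·-cong (≈-sym ε·alt-ε) ≈-refl ⟫ 𝓢.*-assoc _ _ _)

alt-ε·φ : alt ε · φ ≈ ε · dil (alt φ)
alt-ε·φ = ·-cong ≈-refl (≈-sym (alt-alt φ)) ⟫ ≈-sym (alt-· ε (alt φ)) ⟫ alt-cong ε·alt-φ ⟫ alt-· _ _
  ⟫ ·-cong (alt-alt ε) (alt-dil (alt φ))

φ·alt-φ : φ · alt φ ≈ dil (alt φ · alt φ)
φ·alt-φ = ·-cancelˡ ε ε-0 (·-cancelˡ (alt ε) alt-ε-0 (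
  solve 4 (λ a e f g → a :* (e :* (f :* g)) := e :* g :* (a :* f)) ≈-refl (alt ε) ε φ (alt φ)
  ⟫ ·-cong ε·alt-φ alt-ε·φ
  ⟫ solve 3 (λ a e d → a :* d :* (e :* d) := a :* (e :* (d :* d))) ≈-refl (alt ε) ε (dil (alt φ))
  ⟫ ·-cong ≈-refl (·-cong ≈-refl (≈-sym (dil-· _ _)))))

private
  -- In `K·v₀` the factor `K` = ε(-q²) and the right side are series in q², so taking even parts
  -- amounts to replacing q² by q.
  alt-ε·ev-v₀ : alt ε · (C (+ 2) · ev v₀ ⊕ ⊝ 1#) ≈ ε · φ
  alt-ε·ev-v₀ = ≈-sym (ev-dil· (alt ε) _ ⟫ ·-cong ≈-refl (
      ev-⊕ _ _ ⟫ ⊕-cong (ev-⊕ v₀ (alt v₀) ⟫ ⊕-cong ≈-refl (ev-alt v₀) ⟫ solve 1 (λ x → x :+ x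
          := con (+ 2) :* x) ≈-refl (ev v₀))
                         (ev-cong (≈-sym (C-neg 1ℤ)) ⟫ ev-C -1ℤ ⟫ C-neg 1ℤ)))
    ⟫ ev-cong (·-cong (≈-sym ε·alt-ε) ≈-refl ⟫ K·v₀ ⟫ ≈-sym (dil-· ε φ)) ⟫ ev-dil (ε · φ)

ev-v₀ : dil (alt φ) · (C (+ 2) · ev v₀ ⊕ ⊝ 1#) ≈ φ · φ
ev-v₀ = ·-cancelˡ (alt ε) alt-ε-0 (
  solve 3 (λ a d h → a :* (d :* h) := d :* (a :* h)) ≈-refl (alt ε) (dil (alt φ)) _
  ⟫ ·-cong ≈-refl alt-ε·ev-v₀
  ⟫ solve 3 (λ d e f → d :* (e :* f) := e :* d :* f) ≈-refl (dil (alt φ)) ε φ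
  ⟫ ·-cong (≈-sym alt-ε·φ) ≈-refl ⟫ 𝓢.*-assoc _ _ _)

-- Dissections of theta functions

dbl-mono : ∀ {a b} → a ℕ.≤ b → dbl a ℕ.≤ dbl b
dbl-mono z≤n     = z≤n
dbl-mono (s≤s p) = s≤s (s≤s (dbl-mono p))

ev-cong[] : ∀ m {f g} → f ≈[ suc (dbl m) ] g → ev f ≈[ m ] ev g
ev-cong[] m {f} {g} p = upTo λ k k≤m → trans (ev-at f k)
  (trans (coeff p (dbl k) (ℕₚ.m≤n⇒m≤1+n (dbl-mono k≤m))) (sym (ev-at g k)))

od-cong[] : ∀ m {f g} → f ≈[ suc (dbl m) ] g → od f ≈[ m ] od g
od-cong[] m {f} {g} p = upTo λ k k≤m → trans (od-at f k)
  (trans (coeff p (suc (dbl k)) (s≤s (dbl-mono k≤m))) (sym (od-at g k)))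

ev-X1 : ev (X 1) ≈ 0#
ev-X1 = pointwise λ { zero → trans (ev-at (X 1) 0) (trans (X-suc-0 0) (sym (C-at-0 0ℤ)))
  ; (suc n) → trans (ev-at (X 1) (suc n)) (trans (X-suc 0 (suc (dbl n))) (trans (sym (at X-0 _))
      (trans (C-at-suc 1ℤ (dbl n)) (sym (C-at-suc 0ℤ n))))) }

od-X1 : od (X 1) ≈ 1#
od-X1 = pointwise λ n → trans (od-at (X 1) n) (trans (X-suc 0 (dbl n)) (trans (sym (at X-0 (dbl n)))
  (trans (sym (ev-at 1# n)) (at (ev-C 1ℤ) n))))

ev-X1· : ∀ f → ev (X 1 · f) ≈ X 1 · od f
ev-X1· f = ev-· (X 1) f ⟫ ⊕-cong (·-cong ev-X1 ≈-refl) (·-cong ≈-refl (·-cong od-X1 ≈-refl))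
  ⟫ solve 3 (λ e o x → con 0ℤ :* e :+ x :* (con 1ℤ :* o) := x :* o) ≈-refl (ev f) (od f) (X 1)

od-X1· : ∀ f → od (X 1 · f) ≈ ev f
od-X1· f = od-· (X 1) f ⟫ ⊕-cong (·-cong ev-X1 ≈-refl) (·-cong od-X1 ≈-refl)
  ⟫ solve 2 (λ e o → con 0ℤ :* o :+ con 1ℤ :* e := e) ≈-refl (ev f) (od f)

dissect : ∀ f → f ≈ dil (ev f) ⊕ X 1 · dil (od f)
dissect f = sections
  (≈-sym (ev-⊕ _ _ ⟫ ⊕-cong (ev-dil (ev f)) (ev-X1· _ ⟫ ·-cong ≈-refl (od-dil (od f)))
    ⟫ solve 2 (λ e x → e :+ x :* con 0ℤ := e) ≈-refl (ev f) (X 1)))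
  (≈-sym (od-⊕ _ _ ⟫ ⊕-cong (od-dil (ev f)) (od-X1· _ ⟫ ev-dil (od f)) ⟫ 𝓢.+-identityˡ (od f)))

T△ : ℕ → ℕ
T△ zero    = 0
T△ (suc k) = suc k ℕ.+ T△ k

T△+T△ : ∀ k → T△ k ℕ.+ T△ k ≡ k ℕ.* suc k
T△+T△ zero    = refl
T△+T△ (suc k) = trans (regroup k (T△ k)) (trans (cong (suc k ℕ.+ suc k ℕ.+_) (T△+T△ k)) (expand k))
  where
  regroup : ∀ k t → suc k ℕ.+ t ℕ.+ (suc k ℕ.+ t) ≡ suc k ℕ.+ suc k ℕ.+ (t ℕ.+ t)
  regroup = ℕ-Solver.solve-∀
  expand : ∀ k → suc k ℕ.+ suc k ℕ.+ k ℕ.* suc k ≡ suc k ℕ.* suc (suc k)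
  expand = ℕ-Solver.solve-∀

ψ : Series
ψ = ∑ˢ (X ∘ T△)

ψ-order : ∀ k n → n ℕ.< k → X (T△ k) n ≡ 0ℤ
ψ-order (suc k) n n<k
    = trans (coeff (X-order {n} (ℕₚ.<-≤-trans n<k (ℕₚ.m≤m+n (suc k) (T△ k)))) n ℕₚ.≤-refl) (0#-at n)

ψ-approx : ∀ m → ψ ≈[ m ] Σs m (X ∘ T△)
ψ-approx m = ∑ˢ-approx (X ∘ T△) m ψ-order ℕₚ.≤-refl

private
  even-square : ∀ k → Q (+ dbl k) ≈ dil (dil (Q (+ k)))
  even-square k = X-≡ (trans (cong (λ j → j ℕ.* j) (dbl≡+ k)) (expand k))
      ⟫ ≈-sym (dil-cong (dil-X (k ℕ.* k)) ⟫ dil-X _)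
    where
    expand : ∀ k → (k ℕ.+ k) ℕ.* (k ℕ.+ k) ≡ k ℕ.* k ℕ.+ k ℕ.* k ℕ.+ (k ℕ.* k ℕ.+ k ℕ.* k)
    expand = ℕ-Solver.solve-∀

  odd-square : ∀ k → Q (+ suc (dbl k)) ≈ X 1 · dil (dil (dil (X (T△ k))))
  odd-square k = X-≡ (trans (cong (λ j → suc j ℕ.* suc j) (dbl≡+ k)) (trans (expand k)
        (cong (λ j → suc (j ℕ.+ j ℕ.+ (j ℕ.+ j))) (sym (T△+T△ k)))))
      ⟫ ≈-sym (·-cong ≈-refl (dil-cong (dil-cong (dil-X (T△ k)) ⟫ dil-X _) ⟫ dil-X _) ⟫ X-+ 1 _)
    where
    expand : ∀ k → suc (k ℕ.+ k) ℕ.* suc (k ℕ.+ k) ≡ suc (k ℕ.* suc k ℕ.+ k ℕ.* suc k ℕ.+ (k ℕ.* suc k ℕ.+ k ℕ.* suc k))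
    expand = ℕ-Solver.solve-∀

  ev-even-square : ∀ k → ev (Q (+ dbl k)) ≈ dil (Q (+ k))
  ev-even-square k = ev-cong (even-square k) ⟫ ev-dil _

  od-even-square : ∀ k → od (Q (+ dbl k)) ≈ 0#
  od-even-square k = od-cong (even-square k) ⟫ od-dil _

  ev-odd-square : ∀ k → ev (Q (+ suc (dbl k))) ≈ 0#
  ev-odd-square k = ev-cong (odd-square k) ⟫ ev-X1· _ ⟫ ·-cong ≈-refl (od-dil _) ⟫ 𝓢.zeroʳ _

  od-odd-square : ∀ k → od (Q (+ suc (dbl k))) ≈ dil (dil (X (T△ k)))
  od-odd-square k = od-cong (odd-square k) ⟫ od-X1· _ ⟫ ev-dil _

ev-φ : ev φ ≈ dil φ
ev-φ = ≈-from-≈[] λ m →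
  ev-cong[] m (φ-approx (suc (dbl m)))
  ⟫[] weaken m (exact m)
  ⟫[] dil-cong[] (≈[]-sym (φ-approx m))
  where
  exact : ∀ m → ev (Σℤ (suc (dbl m)) Q) ≈ dil (Σℤ m Q)
  exact zero = ev-⊕ _ _ ⟫ ⊕-cong (ev-even-square 0) (ev-⊕ _ _ ⟫ ⊕-cong (ev-odd-square 0) (ev-odd-square 0))
    ⟫ solve 1 (λ x → x :+ (con 0ℤ :+ con 0ℤ) := x) ≈-refl _
  exact (suc m) = ev-⊕ _ _
    ⟫ ⊕-cong (ev-⊕ _ _ ⟫ ⊕-cong (exact m) (ev-⊕ _ _ ⟫ ⊕-cong (ev-even-square (suc m)) (ev-even-square (suc m))))
             (ev-⊕ _ _ ⟫ ⊕-cong (ev-odd-square (suc m)) (ev-odd-square (suc m)))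
    ⟫ solve 2 (λ a b → a :+ b :+ (con 0ℤ :+ con 0ℤ) := a :+ b) ≈-refl _ _
    ⟫ ≈-sym (dil-⊕ _ _ ⟫ ⊕-cong ≈-refl (dil-⊕ _ _))

od-φ : od φ ≈ C (+ 2) · dil (dil ψ)
od-φ = ≈-from-≈[] λ m →
  od-cong[] m (φ-approx (suc (dbl m)))
  ⟫[] weaken m (exact m)
  ⟫[] ·-cong[] ≈[]-refl (weaken m (≈-sym (dil-cong (Σs-dil m _) ⟫ Σs-dil m _))
      ⟫[] dil-cong[] (dil-cong[] (≈[]-sym (ψ-approx m))))
  where
  exact : ∀ m → od (Σℤ (suc (dbl m)) Q) ≈ C (+ 2) · Σs m λ k → dil (dil (X (T△ k)))
  exact zero = od-⊕ _ _ ⟫ ⊕-cong (od-even-square 0) (od-⊕ _ _ ⟫ ⊕-cong (od-odd-square 0) (od-odd-square 0))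
    ⟫ solve 1 (λ x → con 0ℤ :+ (x :+ x) := con (+ 2) :* x) ≈-refl _
  exact (suc m) = od-⊕ _ _
    ⟫ ⊕-cong (od-⊕ _ _ ⟫ ⊕-cong (exact m) (od-⊕ _ _ ⟫ ⊕-cong (od-even-square (suc m)) (od-even-square (suc m))))
             (od-⊕ _ _ ⟫ ⊕-cong (od-odd-square (suc m)) (od-odd-square (suc m)))
    ⟫ solve 2 (λ a b → con (+ 2) :* a :+ (con 0ℤ :+ con 0ℤ) :+ (b :+ b) := con (+ 2) :* (a :+ b)) ≈-refl _ _
    ⟫ ·-cong ≈-refl (≈-sym (Σs-last m _))

-- B = φ(-q), D = φ(-q⁴), x = φ(q⁴)/D and y = 2qψ(q⁸)/D; w and z are
-- the series with x = w(q⁴) and y = q z(q⁴).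
B iB w z′ z x y′ y D T : Series
B  = alt φ
iB = inv B
w  = φ · iB
z′ = dil ψ · iB
z  = C (+ 2) · z′
x  = dil (dil w)
y′ = X 1 · dil (dil z′)
y  = C (+ 2) · y′
D  = dil (dil B)

infixl 9 _²
_² : Series → Series
f ² = f · f

T  = w ² ² ⊕ ⊝ 1#

dil-² : ∀ f → dil (f ²) ≈ dil f ²
dil-² f = dil-· f f

B-0 : B 0 ≡ 1ℤ
B-0 = trans (alt-at-0 φ) (trans (sym (at X-0 0)) (C-at-0 1ℤ))

D-0 : D 0 ≡ 1ℤ
D-0 = trans (dil-at-0 (dil B)) (trans (dil-at-0 B) B-0)
  where
  dil-at-0 : ∀ f → dil f 0 ≡ f 0
  dil-at-0 f = trans (sym (ev-at (dil f) 0)) (at (ev-dil f) 0)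

B·iB : B · iB ≈ 1#
B·iB = inv-inverse B B-0

B·over : ∀ f → B · (f · iB) ≈ f
B·over f = solve 3 (λ b f i → b :* (f :* i) := b :* i :* f) ≈-refl B f iB ⟫ ·-cong B·iB ≈-refl ⟫ 𝓢.*-identityˡ f

B·w : B · w ≈ φ
B·w = B·over φ

B·z : B · z ≈ C (+ 2) · dil ψ
B·z = solve 3 (λ b c z → b :* (c :* z) := c :* (b :* z)) ≈-refl B (C (+ 2)) z′ ⟫ ·-cong ≈-refl (B·over (dil ψ))

D·x : D · x ≈ dil (dil φ)
D·x = ≈-sym (dil-· _ _) ⟫ dil-cong (≈-sym (dil-· _ _)) ⟫ dil-cong (dil-cong B·w)

D·y : D · y ≈ X 1 · dil (od φ)
D·y = solve 4 (λ d c x z → d :* (c :* (x :* z)) := x :* (c :* (d :* z))) ≈-refl D (C (+ 2)) (X 1) (dil (dil z′))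
  ⟫ ·-cong ≈-refl (·-cong (≈-sym (dil-C (+ 2)))
      (≈-sym (dil-· _ _) ⟫ dil-cong (≈-sym (dil-· _ _) ⟫ dil-cong (B·over (dil ψ)))))
  ⟫ ·-cong ≈-refl (≈-sym (dil-· _ _) ⟫ dil-cong (≈-sym od-φ))

φ-split : φ ≈ D · (x ⊕ y)
φ-split = dissect φ ⟫ ⊕-cong (dil-cong ev-φ ⟫ ≈-sym D·x) (≈-sym D·y) ⟫ ≈-sym (𝓢.distribˡ D x y)

alt-y : alt y ≈ ⊝ y
alt-y = alt-· _ _ ⟫ ·-cong (alt-C (+ 2)) (alt-· _ _ ⟫ ·-cong alt-X1 (alt-dil _))
  ⟫ solve 3 (λ c x d → c :* (:- x :* d) := :- (c :* (x :* d))) ≈-refl (C (+ 2)) (X 1) (dil (dil z′))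

B-split : B ≈ D · (x ⊕ ⊝ y)
B-split = alt-cong φ-split ⟫ alt-· _ _ ⟫ ·-cong (alt-dil _) (alt-⊕ _ _ ⟫ ⊕-cong (alt-dil _) alt-y)

-- The classical φ(q²)² + 4q ψ(q⁴)² = φ(q)². The even part of φ(q) φ(-q) = φ(-q²)² gives it with a
-- minus sign and φ(-q) on the right; q ↦ -q corrects both, since `ev φ` and `od φ` are even in q.
φ²-even : (ev φ) ² ⊕ X 1 · (od φ) ² ≈ φ ²
φ²-even = ≈-sym (alt-alt _) ⟫ alt-cong altered ⟫ ≈-sym (alt-cong (alt-· φ φ)) ⟫ alt-alt (φ ²)
  where
  φB-even : (ev φ) ² ⊕ ⊝ (X 1 · (od φ) ²) ≈ B ²
  φB-even = ≈-sym (ev-· φ B ⟫ ⊕-cong (·-cong ≈-refl (ev-alt φ)) (·-cong ≈-refl (·-cong ≈-refl (od-alt φ)))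
      ⟫ solve 3 (λ e x o → e :* e :+ x :* (o :* :- o) := e :* e :+ :- (x :* (o :* o))) ≈-refl (ev φ) (X 1) (od φ))
    ⟫ ev-cong φ·alt-φ ⟫ ev-dil (B ²)
  alt-ev-φ : alt (ev φ) ≈ ev φ
  alt-ev-φ = alt-cong ev-φ ⟫ alt-dil φ ⟫ ≈-sym ev-φ
  alt-od-φ : alt (od φ) ≈ od φ
  alt-od-φ = alt-cong od-φ ⟫ alt-· _ _ ⟫ ·-cong (alt-C (+ 2)) (alt-dil (dil ψ)) ⟫ ≈-sym od-φ
  altered : alt ((ev φ) ² ⊕ X 1 · (od φ) ²) ≈ B ²
  altered = alt-⊕ _ _ ⟫ ⊕-cong (alt-· _ _ ⟫ ·-cong alt-ev-φ alt-ev-φ)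
      (alt-· _ _ ⟫ ·-cong alt-X1 (alt-· _ _ ⟫ ·-cong alt-od-φ alt-od-φ))
    ⟫ solve 3 (λ e x o → e :* e :+ :- x :* (o :* o) := e :* e :+ :- (x :* (o :* o))) ≈-refl (ev φ) (X 1) (od φ)
    ⟫ φB-even

ev-φ² : ev (φ ²) ≈ φ ²
ev-φ² = ev-· φ φ ⟫ φ²-even

S : Series
S = x ² ⊕ y ²

D²·S : D ² · S ≈ dil (φ ²)
D²·S = solve 3 (λ d x y → d :* d :* (x :* x :+ y :* y) := d :* x :* (d :* x) :+ d :* y :* (d :* y)) ≈-refl D x y
  ⟫ ⊕-cong (·-cong D·x D·x) (·-cong D·y D·y)
  ⟫ ⊕-cong (·-cong (dil-cong (≈-sym ev-φ)) (dil-cong (≈-sym ev-φ)) ⟫ ≈-sym (dil-² (ev φ)))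
           (solve 2 (λ x o → x :* o :* (x :* o) := x :* x :* (o :* o)) ≈-refl (X 1) (dil (od φ))
            ⟫ ·-cong (X-+ 1 1 ⟫ ≈-sym (dil-X 1)) (≈-sym (dil-² (od φ))) ⟫ ≈-sym (dil-· _ _))
  ⟫ ≈-sym (dil-⊕ _ _) ⟫ dil-cong φ²-even

-- Multiplied by D⁴ the left side is φ(q) φ(-q) φ(q²)² = (φ(-q²) φ(q²))² = φ(-q⁴)⁴.
x⁴-y⁴ : (x ⊕ y) · (x ⊕ ⊝ y) · S ≈ 1#
x⁴-y⁴ = ·-cancelˡ D D-0 (·-cancelˡ D D-0 (·-cancelˡ D D-0 (·-cancelˡ D D-0 (
  solve 4 (λ d a b s → d :* (d :* (d :* (d :* (a :* b :* s)))) := d :* a :* (d :* b) :* (d :* d :* s)) ≈-refl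
    D (x ⊕ y) (x ⊕ ⊝ y) S
  ⟫ ·-cong (·-cong (≈-sym φ-split) (≈-sym B-split) ⟫ φ·alt-φ) D²·S
  ⟫ ≈-sym (dil-· _ _) ⟫ dil-cong (
      solve 2 (λ a b → b :* b :* (a :* a) := a :* b :* (a :* b)) ≈-refl φ B ⟫ ·-cong φ·alt-φ φ·alt-φ
          ⟫ ≈-sym (dil-² _))
  ⟫ dil-cong (dil-cong (≈-refl {B ² ²})) ⟫ dil-cong (dil-² _ ⟫ ·-cong (dil-² B) (dil-² B)) ⟫ dil-² _
      ⟫ ·-cong (dil-² _) (dil-² _)
  ⟫ solve 1 (λ d → d :* d :* (d :* d) := d :* (d :* (d :* (d :* con 1ℤ)))) ≈-refl D))))

-- Here w = (x + y)/(x - y), and by `x⁴-y⁴` the inverse of x - y is (x + y) S.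
w-split : w ≈ (x ⊕ y) ² · S
w-split = ·-cancelˡ B B-0 (B·w ⟫ φ-split ⟫ ≈-sym (
  ·-cong B-split ≈-refl
  ⟫ solve 4 (λ d a b s → d :* b :* (a :* a :* s) := d :* a :* (a :* b :* s)) ≈-refl D (x ⊕ y) (x ⊕ ⊝ y) S
  ⟫ ·-cong ≈-refl x⁴-y⁴ ⟫ 𝓢.*-identityʳ _))

x⁴ : x ² ² ≈ 1# ⊕ y ² ²
x⁴ = solve 2 (λ x y → x :* x :* (x :* x) := (x :+ y) :* (x :+ :- y) :* (x :* x :+ y :* y)
    :+ y :* y :* (y :* y)) ≈-refl x y
  ⟫ ⊕-cong x⁴-y⁴ ≈-refl

w⁴ : w ² ² ≈ 1# ⊕ T
w⁴ = solve 1 (λ w → w := con 1ℤ :+ (w :+ :- con 1ℤ)) ≈-refl (w ² ²)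

y-dil : y ≈ X 1 · dil (dil z)
y-dil = solve 3 (λ c x d → c :* (x :* d) := x :* (c :* d)) ≈-refl (C (+ 2)) (X 1) (dil (dil z′))
  ⟫ ·-cong ≈-refl (·-cong (≈-sym (dil-cong (dil-C (+ 2)) ⟫ dil-C (+ 2))) ≈-refl ⟫ ≈-sym (dil-cong (dil-· _ _)
      ⟫ dil-· _ _))

y² : y ² ≈ dil (X 1 · dil z ²)
y² = ·-cong y-dil y-dil
  ⟫ solve 2 (λ x z → x :* z :* (x :* z) := x :* x :* (z :* z)) ≈-refl (X 1) (dil (dil z))
  ⟫ ·-cong (X-+ 1 1 ⟫ ≈-sym (dil-X 1)) (≈-sym (dil-² (dil z))) ⟫ ≈-sym (dil-· _ _)

y⁴ : y ² ² ≈ dil (dil (X 1 · z ² ²))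
y⁴ = ·-cong y² y² ⟫ ≈-sym (dil-² _) ⟫ dil-cong (
    solve 2 (λ x z → x :* z :* (x :* z) := x :* x :* (z :* z)) ≈-refl (X 1) (dil z ²)
    ⟫ ·-cong (X-+ 1 1 ⟫ ≈-sym (dil-X 1)) (·-cong (≈-sym (dil-² z)) (≈-sym (dil-² z)) ⟫ ≈-sym (dil-² (z ²)))
        ⟫ ≈-sym (dil-· _ _))

-- Both sides, taken at q⁴, equal y⁴ = x⁴ - 1; applying `ev` twice returns to q.
X1·z⁴ : X 1 · z ² ² ≈ T
X1·z⁴ = ≈-sym (ev-cong (ev-dil _) ⟫ ev-dil _)
  ⟫ ev-cong (ev-cong (≈-sym y⁴ ⟫ solve 1 (λ b → b := con 1ℤ :+ b :+ :- con 1ℤ) ≈-refl (y ² ²)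
      ⟫ ⊕-cong (≈-sym x⁴ ⟫ x⁴-dil) (≈-sym (C-neg 1ℤ) ⟫ ≈-sym (dil-cong (dil-C -1ℤ) ⟫ dil-C -1ℤ)
          ⟫ dil-cong (dil-cong (C-neg 1ℤ)))
      ⟫ ≈-sym (dil-cong (dil-⊕ _ _) ⟫ dil-⊕ _ _)))
  ⟫ ev-cong (ev-dil _) ⟫ ev-dil T
  where
  x⁴-dil : x ² ² ≈ dil (dil (w ² ²))
  x⁴-dil = ≈-sym (dil-cong (dil-² _ ⟫ ·-cong (dil-² w) (dil-² w)) ⟫ dil-² _ ⟫ ·-cong (dil-² _) (dil-² _))

-- The 1 in T = w⁴ - 1 is written as (x⁴ - y⁴)⁴. Beside the common factor S⁴ (x+y)⁴ there remains
-- (x+y)⁴ - (x-y)⁴ = 8xy(x² + y²).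
T-split : T ≈ C (+ 8) · (x · (y · (S · (S · (S · (S · (S · ((x ⊕ y) · ((x ⊕ y) · ((x ⊕ y) · (x ⊕ y)))))))))))
T-split =
  ⊕-cong (·-cong (·-cong w-split w-split) (·-cong w-split w-split))
         (⊝-cong (solve 0 (con 1ℤ := con 1ℤ :* con 1ℤ :* (con 1ℤ :* con 1ℤ)) ≈-refl
             ⟫ ≈-sym (·-cong (·-cong x⁴-y⁴ x⁴-y⁴) (·-cong x⁴-y⁴ x⁴-y⁴))))
  ⟫ solve 3 (λ x y s → let a = x :+ y ; b = x :+ :- y in
        a :* a :* s :* (a :* a :* s) :* (a :* a :* s :* (a :* a :* s))
            :+ :- (a :* b :* s :* (a :* b :* s) :* (a :* b :* s :* (a :* b :* s)))
        := con (+ 8) :* (x :* (y :* (s :* (s :* (s :* (s :* ((x :* x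
            :+ y :* y) :* (a :* (a :* (a :* a))))))))))) ≈-refl x y S

-- The action of U₄ on φ ℤ[T]

infixl 6 _⊞_
infixr 8 T·_
data Poly : Series → Set where
  const : ∀ c → Poly (C c)
  T·_   : ∀ {f} → Poly f → Poly (T · f)
  _⊞_   : ∀ {f g} → Poly f → Poly g → Poly (f ⊕ g)
  poly-≈  : ∀ {f g} → f ≈ g → Poly f → Poly g

Poly-C· : ∀ c {f} → Poly f → Poly (C c · f)
Poly-C· c (const d)      = poly-≈ (C-* c d) (const (c ℤ.* d))
Poly-C· c (T·_ {f} p)    = poly-≈ (solve 3 (λ t c f → t :* (c :* f)
    := c :* (t :* f)) ≈-refl T (C c) f) (T· Poly-C· c p)
Poly-C· c (_⊞_ {f} {g} p q) = poly-≈ (≈-sym (𝓢.distribˡ (C c) f g)) (Poly-C· c p ⊞ Poly-C· c q)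
Poly-C· c (poly-≈ f≈g p)   = poly-≈ (·-cong ≈-refl f≈g) (Poly-C· c p)

Poly-horner : ∀ {f} → Poly f → ∃[ n ] ∃[ g ] Poly g × f ≈ C n ⊕ T · g
Poly-horner (const c) = c , 0# , const 0ℤ , solve 2 (λ c t → c := c :+ t :* con 0ℤ) ≈-refl (C c) T
Poly-horner (T·_ {f} p) = 0ℤ , f , p , ≈-sym (𝓢.+-identityˡ (T · f))
Poly-horner (p ⊞ q) with Poly-horner p | Poly-horner q
... | m , f , pf , f≈ | n , g , pg , g≈ = m ℤ.+ n , f ⊕ g , pf ⊞ pg ,
  (⊕-cong f≈ g≈ ⟫ solve 5 (λ m n t f g → m :+ t :* f :+ (n :+ t :* g)
      := m :+ n :+ t :* (f :+ g)) ≈-refl (C m) (C n) T f g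
   ⟫ ⊕-cong (≈-sym (C-+ m n)) ≈-refl)
Poly-horner (poly-≈ f≈g p) with Poly-horner p
... | n , g , pg , f≈ = n , g , pg , (≈-sym f≈g ⟫ f≈)

infixr 8 _^′_
_^′_ : Series → ℕ → Series
f ^′ zero  = 1#
f ^′ suc n = f · f ^′ n

Multiple : Series → Series → Set
Multiple h f = ∃[ g ] Poly g × f ≈ h · g

Multiple-resp : ∀ {h f f'} → f ≈ f' → Multiple h f → Multiple h f'
Multiple-resp p (g , pg , q) = g , pg , (≈-sym p ⟫ q)

Multiple-⊕ : ∀ {h f f'} → Multiple h f → Multiple h f' → Multiple h (f ⊕ f')
Multiple-⊕ {h} (g , pg , q) (g' , pg' , q') = g ⊕ g' , pg ⊞ pg' , (⊕-cong q q' ⟫ ≈-sym (𝓢.distribˡ h g g'))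

Multiple-C· : ∀ c {h f} → Multiple h f → Multiple h (C c · f)
Multiple-C· c {h} (g , pg , q) = C c · g , Poly-C· c pg ,
  (·-cong ≈-refl q ⟫ solve 3 (λ c h g → c :* (h :* g) := h :* (c :* g)) ≈-refl (C c) h g)

-- Since w⁴ = 1 + T lies in ℤ[T], exponents of w can be reduced modulo 4.
Multiple-w⁴ : ∀ {a b f} → Multiple (b · w ^′ (4 ℕ.+ a)) f → Multiple (b · w ^′ a) f
Multiple-w⁴ {a} {b} (g , pg , q) = g ⊕ T · g , pg ⊞ T· pg , (q
  ⟫ solve 4 (λ b w v g → b :* (w :* (w :* (w :* (w :* v)))) :* g
      := b :* v :* (w :* w :* (w :* w) :* g)) ≈-refl b w (w ^′ a) g
  ⟫ ·-cong ≈-refl (·-cong w⁴ ≈-refl)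
  ⟫ solve 4 (λ b v t g → b :* v :* ((con 1ℤ :+ t) :* g) := b :* v :* (g :+ t :* g)) ≈-refl b (w ^′ a) T g)

-- section r is about the coefficients of index 4n + r.
record Sections (a₀ a₁ a₂ a₃ : ℕ) (f : Series) : Set where
  field
    section₀ : Multiple (1# · w ^′ a₀) (ev (ev f))
    section₁ : Multiple (z · w ^′ a₁) (ev (od f))
    section₂ : Multiple (z ² · w ^′ a₂) (od (ev f))
    section₃ : Multiple (z ² · z · w ^′ a₃) (od (od f))
open Sections

private
  Multiple-w : ∀ a b {f} → Multiple (b · w ^′ a) f → Multiple (b · w ^′ suc a) (w · f)
  Multiple-w a b (g , pg , q) = g , pg , (·-cong ≈-refl q
    ⟫ solve 4 (λ w b v g → w :* (b :* v :* g) := b :* (w :* v) :* g) ≈-refl w b (w ^′ a) g)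

  Multiple-z : ∀ a b {f} → Multiple (b · w ^′ a) f → Multiple (b · z · w ^′ a) (z · f)
  Multiple-z a b (g , pg , q) = g , pg , (·-cong ≈-refl q
    ⟫ solve 4 (λ z b v g → z :* (b :* v :* g) := b :* z :* v :* g) ≈-refl z b (w ^′ a) g)

x·-sections : ∀ {a₀ a₁ a₂ a₃ f} → Sections a₀ a₁ a₂ a₃ f → Sections (suc a₀) (suc a₁) (suc a₂) (suc a₃) (x · f)
x·-sections {a₀} {a₁} {a₂} {a₃} {f} s = record
  { section₀ = Multiple-resp (≈-sym (ev-cong (ev-dil· _ f) ⟫ ev-dil· w _)) (Multiple-w a₀ _ (section₀ s))
  ; section₁ = Multiple-resp (≈-sym (ev-cong (od-dil· _ f) ⟫ ev-dil· w _)) (Multiple-w a₁ _ (section₁ s))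
  ; section₂ = Multiple-resp (≈-sym (od-cong (ev-dil· _ f) ⟫ od-dil· w _)) (Multiple-w a₂ _ (section₂ s))
  ; section₃ = Multiple-resp (≈-sym (od-cong (od-dil· _ f) ⟫ od-dil· w _)) (Multiple-w a₃ _ (section₃ s)) }

-- As y = q z(q⁴), each section moves up by one with a factor z. The last one wraps around to
-- section 0 with q z⁴ = T, which the polynomial absorbs.
y·-sections : ∀ {a₀ a₁ a₂ a₃ f} → Sections a₀ a₁ a₂ a₃ f → Sections a₃ a₀ a₁ a₂ (y · f)
y·-sections {a₀} {a₁} {a₂} {a₃} {f} s = record
  { section₀ = wrap (section₃ s)
  ; section₁ = Multiple-resp (≈-sym (ev-cong od-y ⟫ ev-cong (ev-dil· _ f)
      ⟫ ev-dil· z _)) (drop-1 (Multiple-z a₀ _ (section₀ s)))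
  ; section₂ = Multiple-resp (≈-sym (od-cong ev-y ⟫ od-X1· _ ⟫ ev-cong (od-dil· _ f)
      ⟫ ev-dil· z _)) (Multiple-z a₁ _ (section₁ s))
  ; section₃ = Multiple-resp (≈-sym (od-cong od-y ⟫ od-cong (ev-dil· _ f)
      ⟫ od-dil· z _)) (Multiple-z a₂ _ (section₂ s)) }
  where
  y-dil· : y · f ≈ X 1 · (dil (dil z) · f)
  y-dil· = ·-cong y-dil ≈-refl ⟫ 𝓢.*-assoc _ _ _
  ev-y : ev (y · f) ≈ X 1 · od (dil (dil z) · f)
  ev-y = ev-cong y-dil· ⟫ ev-X1· _
  od-y : od (y · f) ≈ ev (dil (dil z) · f)
  od-y = od-cong y-dil· ⟫ od-X1· _
  drop-1 : ∀ {f} → Multiple (1# · z · w ^′ a₀) f → Multiple (z · w ^′ a₀) f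
  drop-1 (g , pg , q) = g , pg , (q ⟫ ·-cong (·-cong (𝓢.*-identityˡ z) ≈-refl) ≈-refl)
  wrap : Multiple (z ² · z · w ^′ a₃) (od (od f)) → Multiple (1# · w ^′ a₃) (ev (ev (y · f)))
  wrap (g , pg , q) = T · g , T· pg , (ev-cong ev-y ⟫ ev-X1· _
    ⟫ ·-cong ≈-refl (od-cong (od-dil· _ f) ⟫ od-dil· z _ ⟫ ·-cong ≈-refl q)
    ⟫ solve 4 (λ x z v g → x :* (z :* (z :* z :* z :* v :* g))
        := con 1ℤ :* v :* (x :* (z :* z :* (z :* z)) :* g)) ≈-refl
        (X 1) z (w ^′ a₃) g
    ⟫ ·-cong ≈-refl (·-cong X1·z⁴ ≈-refl))

⊕-sections : ∀ {a₀ a₁ a₂ a₃ f g} → Sections a₀ a₁ a₂ a₃ f → Sections a₀ a₁ a₂ a₃ g → Sections a₀ a₁ a₂ a₃ (f ⊕ g)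
⊕-sections {f = f} {g} s t = record
  { section₀ = Multiple-resp (≈-sym (ev-cong (ev-⊕ f g) ⟫ ev-⊕ _ _)) (Multiple-⊕ (section₀ s) (section₀ t))
  ; section₁ = Multiple-resp (≈-sym (ev-cong (od-⊕ f g) ⟫ ev-⊕ _ _)) (Multiple-⊕ (section₁ s) (section₁ t))
  ; section₂ = Multiple-resp (≈-sym (od-cong (ev-⊕ f g) ⟫ od-⊕ _ _)) (Multiple-⊕ (section₂ s) (section₂ t))
  ; section₃ = Multiple-resp (≈-sym (od-cong (od-⊕ f g) ⟫ od-⊕ _ _)) (Multiple-⊕ (section₃ s) (section₃ t)) }

C·-sections : ∀ c {a₀ a₁ a₂ a₃ f} → Sections a₀ a₁ a₂ a₃ f → Sections a₀ a₁ a₂ a₃ (C c · f)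
C·-sections c {f = f} s = record
  { section₀ = Multiple-resp (≈-sym (ev-cong (ev-C· c f) ⟫ ev-C· c _)) (Multiple-C· c (section₀ s))
  ; section₁ = Multiple-resp (≈-sym (ev-cong (od-C· c f) ⟫ ev-C· c _)) (Multiple-C· c (section₁ s))
  ; section₂ = Multiple-resp (≈-sym (od-cong (ev-C· c f) ⟫ od-C· c _)) (Multiple-C· c (section₂ s))
  ; section₃ = Multiple-resp (≈-sym (od-cong (od-C· c f) ⟫ od-C· c _)) (Multiple-C· c (section₃ s)) }

resp-sections : ∀ {a₀ a₁ a₂ a₃ f g} → f ≈ g → Sections a₀ a₁ a₂ a₃ f → Sections a₀ a₁ a₂ a₃ g
resp-sections p s = record
  { section₀ = Multiple-resp (ev-cong (ev-cong p)) (section₀ s)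
  ; section₁ = Multiple-resp (ev-cong (od-cong p)) (section₁ s)
  ; section₂ = Multiple-resp (od-cong (ev-cong p)) (section₂ s)
  ; section₃ = Multiple-resp (od-cong (od-cong p)) (section₃ s) }

-- Satisfied by the ℤ[x⁴, y⁴]-combinations of monomials in x, y of degree ≡ d
-- (mod 4): a monomial x^i y^r with r < 4 contributes to section r only, and
-- x⁴, y⁴ are the images of 1 + T, T under q ↦ q⁴.
Degree : ℕ → Series → Set
Degree 0 = Sections 0 3 2 1
Degree 1 = Sections 1 0 3 2
Degree 2 = Sections 2 1 0 3
Degree 3 = Sections 3 2 1 0
Degree (suc (suc (suc (suc d)))) = Degree d

Degree-1# : Degree 0 1#
Degree-1# = record
  { section₀ = 1# , const 1ℤ , (ev-cong (ev-C 1ℤ) ⟫ ev-C 1ℤ ⟫ solve 0 (con 1ℤ := con 1ℤ :* con 1ℤ :* con 1ℤ) ≈-refl)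
  ; section₁ = 0# , const 0ℤ , (ev-cong (od-C 1ℤ) ⟫ ev-C 0ℤ ⟫ ≈-sym (𝓢.zeroʳ _))
  ; section₂ = 0# , const 0ℤ , (od-cong (ev-C 1ℤ) ⟫ od-C 1ℤ ⟫ ≈-sym (𝓢.zeroʳ _))
  ; section₃ = 0# , const 0ℤ , (od-cong (od-C 1ℤ) ⟫ od-C 0ℤ ⟫ ≈-sym (𝓢.zeroʳ _)) }

-- As x = w(q⁴), all four exponents of w rise by one; exactly one of them reaches 4 and is reduced
-- to 0.
x·-degree : ∀ d {f} → Degree d f → Degree (suc d) (x · f)
x·-degree 0 s = let t = x·-sections s in record
  { section₀ = section₀ t ; section₁ = Multiple-w⁴ {0} (section₁ t) ; section₂ = section₂ t
  ; section₃ = section₃ t }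
x·-degree 1 s = let t = x·-sections s in record
  { section₀ = section₀ t ; section₁ = section₁ t ; section₂ = Multiple-w⁴ {0} (section₂ t)
  ; section₃ = section₃ t }
x·-degree 2 s = let t = x·-sections s in record
  { section₀ = section₀ t ; section₁ = section₁ t ; section₂ = section₂ t
  ; section₃ = Multiple-w⁴ {0} (section₃ t) }
x·-degree 3 s = let t = x·-sections s in record
  { section₀ = Multiple-w⁴ {0} (section₀ t) ; section₁ = section₁ t ; section₂ = section₂ t
  ; section₃ = section₃ t }
x·-degree (suc (suc (suc (suc d)))) = x·-degree d

y·-degree : ∀ d {f} → Degree d f → Degree (suc d) (y · f)
y·-degree 0 = y·-sections
y·-degree 1 = y·-sections
y·-degree 2 = y·-sections
y·-degree 3 = y·-sections
y·-degree (suc (suc (suc (suc d)))) = y·-degree d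

⊕-degree : ∀ d {f g} → Degree d f → Degree d g → Degree d (f ⊕ g)
⊕-degree 0 = ⊕-sections
⊕-degree 1 = ⊕-sections
⊕-degree 2 = ⊕-sections
⊕-degree 3 = ⊕-sections
⊕-degree (suc (suc (suc (suc d)))) = ⊕-degree d

resp-degree : ∀ d {f g} → f ≈ g → Degree d f → Degree d g
resp-degree 0 = resp-sections
resp-degree 1 = resp-sections
resp-degree 2 = resp-sections
resp-degree 3 = resp-sections
resp-degree (suc (suc (suc (suc d)))) = resp-degree d

[x+y]·-degree : ∀ d {f} → Degree d f → Degree (suc d) ((x ⊕ y) · f)
[x+y]·-degree d {f} s = resp-degree (suc d)
    (≈-sym (𝓢.distribʳ f x y)) (⊕-degree (suc d) (x·-degree d s) (y·-degree d s))

S·-degree : ∀ d {f} → Degree d f → Degree (2 ℕ.+ d) (S · f)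
S·-degree d {f} s = resp-degree (2 ℕ.+ d)
  (solve 3 (λ x y f → x :* (x :* f) :+ y :* (y :* f) := (x :* x :+ y :* y) :* f) ≈-refl x y f)
  (⊕-degree (2 ℕ.+ d) (x·-degree (suc d) (x·-degree d s)) (y·-degree (suc d) (y·-degree d s)))

T/8· : Series → Series
T/8· f = x · (y · (S · (S · (S · (S · (S · ((x ⊕ y) · ((x ⊕ y) · ((x ⊕ y) · ((x ⊕ y) · f))))))))))

T·-split : ∀ f → T · f ≈ C (+ 8) · T/8· f
T·-split f = ·-cong T-split ≈-refl
  ⟫ solve 6 (λ c x y s a f → c :* (x :* (y :* (s :* (s :* (s :* (s :* (s :* (a :* (a :* (a :* a)))))))))) :* f
               := c :* (x :* (y :* (s :* (s :* (s :* (s :* (s :* (a :* (a :* (a :* (a :* f)))))))))))) ≈-refl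
      (C (+ 8)) x y S (x ⊕ y) f

-- The total degree of x, y, five factors S and four factors x + y is 1 + 1 + 10 + 4 = 16.
T/8·-degree : ∀ {f} → Degree 0 f → Degree 0 (T/8· f)
T/8·-degree s = x·-degree 15 (y·-degree 14 (S·-degree 12 (S·-degree 10 (S·-degree 8 (S·-degree 6 (S·-degree 4
  ([x+y]·-degree 3 ([x+y]·-degree 2 ([x+y]·-degree 1 ([x+y]·-degree 0 s))))))))))

Poly-degree : ∀ {f} → Poly f → Degree 0 f
Poly-degree (const c)    = resp-sections (𝓢.*-identityʳ (C c)) (C·-sections c Degree-1#)
Poly-degree (T·_ {f} p)  = resp-sections (≈-sym (T·-split f)) (C·-sections (+ 8) (T/8·-degree (Poly-degree p)))
Poly-degree (p ⊞ q)      = ⊕-sections (Poly-degree p) (Poly-degree q)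
Poly-degree (poly-≈ f≈g p) = resp-sections f≈g (Poly-degree p)

2ψ : Series
2ψ = C (+ 2) · dil ψ

U₄ U₄′ : Series → Series
U₄  f = ev (ev f)
U₄′ f = ev (od f)

U₄-cong : ∀ {f g} → f ≈ g → U₄ f ≈ U₄ g
U₄-cong p = ev-cong (ev-cong p)

U₄′-cong : ∀ {f g} → f ≈ g → U₄′ f ≈ U₄′ g
U₄′-cong p = ev-cong (od-cong p)

U₄-⊕ : ∀ f g → U₄ (f ⊕ g) ≈ U₄ f ⊕ U₄ g
U₄-⊕ f g = ev-cong (ev-⊕ f g) ⟫ ev-⊕ _ _

U₄′-⊕ : ∀ f g → U₄′ (f ⊕ g) ≈ U₄′ f ⊕ U₄′ g
U₄′-⊕ f g = ev-cong (od-⊕ f g) ⟫ ev-⊕ _ _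

U₄-C· : ∀ c f → U₄ (C c · f) ≈ C c · U₄ f
U₄-C· c f = ev-cong (ev-C· c f) ⟫ ev-C· c _

U₄′-C· : ∀ c f → U₄′ (C c · f) ≈ C c · U₄′ f
U₄′-C· c f = ev-cong (od-C· c f) ⟫ ev-C· c _

U₄-φ : U₄ φ ≈ φ
U₄-φ = ev-cong ev-φ ⟫ ev-dil φ

U₄′-φ : U₄′ φ ≈ 2ψ
U₄′-φ = ev-cong od-φ ⟫ ev-C· (+ 2) _ ⟫ ·-cong ≈-refl (ev-dil (dil ψ))

-- D = B(q⁴) leaves the extraction as B. In degree 1, section 0 lies in w ℤ[T] and B w = φ; section
-- 1, used for `U₄′`, lies in z ℤ[T] and B z = 2ψ(q²).
U₄-D· : ∀ {f} → Degree 1 f → Multiple φ (U₄ (D · f))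
U₄-D· {f} s = finish (section₀ s)
  where
  finish : Multiple (1# · w ^′ 1) (U₄ f) → Multiple φ (U₄ (D · f))
  finish (g , pg , q) = g , pg , (ev-cong (ev-dil· _ f) ⟫ ev-dil· B _ ⟫ ·-cong ≈-refl q
    ⟫ solve 3 (λ b w g → b :* (con 1ℤ :* (w :* con 1ℤ) :* g) := b :* w :* g) ≈-refl B w g ⟫ ·-cong B·w ≈-refl)

U₄′-D· : ∀ {f} → Degree 1 f → Multiple 2ψ (U₄′ (D · f))
U₄′-D· {f} s = finish (section₁ s)
  where
  finish : Multiple (z · w ^′ 0) (U₄′ f) → Multiple 2ψ (U₄′ (D · f))
  finish (g , pg , q) = g , pg , (ev-cong (od-dil· _ f) ⟫ ev-dil· B _ ⟫ ·-cong ≈-refl q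
    ⟫ solve 3 (λ b z g → b :* (z :* con 1ℤ :* g) := b :* z :* g) ≈-refl B z g ⟫ ·-cong B·z ≈-refl)

private
  φ·T· : ∀ f → φ · (T · f) ≈ C (+ 8) · (D · ((x ⊕ y) · T/8· f))
  φ·T· f = ·-cong φ-split (T·-split f)
    ⟫ solve 4 (λ d a c f → d :* a :* (c :* f) := c :* (d :* (a :* f))) ≈-refl D (x ⊕ y) (C (+ 8)) (T/8· f)

U₄-φT· : ∀ {f} → Poly f → ∃[ g ] Poly g × U₄ (φ · (T · f)) ≈ C (+ 8) · (φ · g)
U₄-φT· {f} p = finish (U₄-D· ([x+y]·-degree 0 (T/8·-degree (Poly-degree p))))
  where
  finish : Multiple φ (U₄ (D · ((x ⊕ y) · T/8· f))) → ∃[ g ] Poly g × U₄ (φ · (T · f)) ≈ C (+ 8) · (φ · g)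
  finish (g , pg , q) = g , pg , (U₄-cong (φ·T· f) ⟫ U₄-C· (+ 8) _ ⟫ ·-cong ≈-refl q)

U₄′-φT· : ∀ {f} → Poly f → ∃[ g ] Poly g × U₄′ (φ · (T · f)) ≈ C (+ 8) · (2ψ · g)
U₄′-φT· {f} p = finish (U₄′-D· ([x+y]·-degree 0 (T/8·-degree (Poly-degree p))))
  where
  finish : Multiple 2ψ (U₄′ (D · ((x ⊕ y) · T/8· f))) → ∃[ g ] Poly g × U₄′ (φ · (T · f)) ≈ C (+ 8) · (2ψ · g)
  finish (g , pg , q) = g , pg , (U₄′-cong (φ·T· f) ⟫ U₄′-C· (+ 8) _ ⟫ ·-cong ≈-refl q)

-- The series of v₀(4n) and its iterates under `U₄`

G : Series
G = C (+ 2) · U₄ v₀ ⊕ ⊝ 1#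

B·G : B · G ≈ φ ²
B·G = ·-cong ≈-refl (≈-sym (ev-⊕ _ _ ⟫ ⊕-cong (ev-C· (+ 2) (ev v₀)) (ev-cong (≈-sym (C-neg 1ℤ)) ⟫ ev-C -1ℤ
    ⟫ C-neg 1ℤ)))
  ⟫ ≈-sym (ev-dil· B _) ⟫ ev-cong ev-v₀ ⟫ ev-φ²

remainder : Series
remainder = x · (y · (y · (y · (y · 1#)))) ⊕ y · (y · (y · (y · (y · 1#)))) ⊕ (x · (x · (x · (y · (y · 1#))))
    ⊕ x · (x · (y · (y · (y · 1#)))))

remainder-degree : Degree 1 remainder
remainder-degree = ⊕-degree 1
  (⊕-degree 1 (x·-degree 4 yyyy) (y·-degree 4 yyyy))
  (⊕-degree 1 (x·-degree 4 (x·-degree 3 (x·-degree 2 yy))) (x·-degree 4 (x·-degree 3 (y·-degree 2 yy))))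
  where
  yy : Degree 2 (y · (y · 1#))
  yy = y·-degree 1 (y·-degree 0 Degree-1#)
  yyyy : Degree 4 (y · (y · (y · (y · 1#))))
  yyyy = y·-degree 3 (y·-degree 2 yy)

-- (x + y)³(x² + y²) = x⁵ + 3x⁴y + 4x³y² + 4x²y³ + 3xy⁴ + y⁵ with x⁴ = 1 + y⁴.
G-split : G ≈ D · x ⊕ C (+ 3) · (D · y) ⊕ C (+ 4) · (D · remainder)
G-split = ·-cancelˡ B B-0 (B·G
  ⟫ ·-cong ≈-refl (≈-sym B·w) ⟫ solve 3 (λ f b w → f :* (b :* w) := b :* (f :* w)) ≈-refl φ B w
  ⟫ ·-cong ≈-refl (·-cong φ-split w-split
    ⟫ solve 3 (λ d x y → d :* (x :+ y) :* ((x :+ y) :* (x :+ y) :* (x :* x :+ y :* y))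
        := d :* (x :* x :* (x :* x) :* (x :+ con (+ 3) :* y) :+ con (+ 4) :* (x :* x :* x :* y :* y
            :+ x :* x :* y :* y :* y)
                 :+ (con (+ 3) :* x :* (y :* y :* (y :* y)) :+ y :* (y :* y :* (y :* y))))) ≈-refl D x y
    ⟫ ·-cong ≈-refl (⊕-cong (⊕-cong (·-cong x⁴ ≈-refl) ≈-refl) ≈-refl)
    ⟫ solve 3 (λ d x y → d :* ((con 1ℤ :+ y :* y :* (y :* y)) :* (x :+ con (+ 3) :* y)
        :+ con (+ 4) :* (x :* x :* x :* y :* y :+ x :* x :* y :* y :* y)
                 :+ (con (+ 3) :* x :* (y :* y :* (y :* y)) :+ y :* (y :* y :* (y :* y))))
        := d :* x :+ con (+ 3) :* (d :* y)
           :+ con (+ 4) :* (d :* (x :* (y :* (y :* (y :* (y :* con 1ℤ)))) :+ y :* (y :* (y :* (y :* (y :* con 1ℤ))))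
                :+ (x :* (x :* (x :* (y :* (y :* con 1ℤ))))
                    :+ x :* (x :* (y :* (y :* (y :* con 1ℤ)))))))) ≈-refl D x y))

private
  U₄-Dx : U₄ (D · x) ≈ φ
  U₄-Dx = U₄-cong D·x ⟫ ev-cong (ev-dil _) ⟫ ev-dil φ

  U₄-Dy : U₄ (D · y) ≈ 0#
  U₄-Dy = U₄-cong D·y ⟫ ev-cong (ev-X1· _ ⟫ ·-cong ≈-refl (od-dil _) ⟫ 𝓢.zeroʳ _) ⟫ ev-C 0ℤ

  U₄′-Dx : U₄′ (D · x) ≈ 0#
  U₄′-Dx = U₄′-cong D·x ⟫ ev-cong (od-dil _) ⟫ ev-C 0ℤ

  U₄′-Dy : U₄′ (D · y) ≈ 2ψ
  U₄′-Dy = U₄′-cong D·y ⟫ ev-cong (od-X1· _ ⟫ ev-dil _ ⟫ od-φ) ⟫ ev-C· (+ 2) _ ⟫ ·-cong ≈-refl (ev-dil (dil ψ))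

U₄-G : ∃[ g ] Poly g × U₄ G ≈ φ ⊕ C (+ 4) · (φ · g)
U₄-G = finish (U₄-D· remainder-degree)
  where
  finish : Multiple φ (U₄ (D · remainder)) → ∃[ g ] Poly g × U₄ G ≈ φ ⊕ C (+ 4) · (φ · g)
  finish (g , pg , q) = g , pg , (U₄-cong G-split ⟫ U₄-⊕ _ _
    ⟫ ⊕-cong (U₄-⊕ _ _ ⟫ ⊕-cong U₄-Dx (U₄-C· (+ 3) _ ⟫ ·-cong ≈-refl U₄-Dy ⟫ 𝓢.zeroʳ _) ⟫ 𝓢.+-identityʳ φ)
             (U₄-C· (+ 4) _ ⟫ ·-cong ≈-refl q))

U₄′-G : ∃[ g ] Poly g × U₄′ G ≈ 2ψ · (C (+ 3) ⊕ C (+ 4) · g)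
U₄′-G = finish (U₄′-D· remainder-degree)
  where
  finish : Multiple 2ψ (U₄′ (D · remainder)) → ∃[ g ] Poly g × U₄′ G ≈ 2ψ · (C (+ 3) ⊕ C (+ 4) · g)
  finish (g , pg , q) = g , pg , (U₄′-cong G-split ⟫ U₄′-⊕ _ _
    ⟫ ⊕-cong (U₄′-⊕ _ _ ⟫ ⊕-cong U₄′-Dx (U₄′-C· (+ 3) _ ⟫ ·-cong ≈-refl U₄′-Dy)) (U₄′-C· (+ 4) _ ⟫ ·-cong ≈-refl q)
    ⟫ solve 2 (λ p g → con 0ℤ :+ con (+ 3) :* p :+ con (+ 4) :* (p :* g)
        := p :* (con (+ 3) :+ con (+ 4) :* g)) ≈-refl 2ψ g)

iterate : ℕ → Series
iterate zero    = G
iterate (suc α) = U₄ (iterate α)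

4·8^ : ℕ → ℤ
4·8^ zero    = + 4
4·8^ (suc α) = + 8 ℤ.* 4·8^ α

Iterate : ℕ → Series → Set
Iterate α f = ∃[ n ] ∃[ g ] Poly g × f ≈ C n · φ ⊕ C (4·8^ α) · (φ · (T · g))

-- Each extraction leaves a polynomial whose constant term may be nonzero. Horner's rule moves that
-- constant into the multiple of φ, so that the rest again has the factor T on which the next step
-- gains 8.
iterate-suc : ∀ α → Iterate α (iterate (suc α))
iterate-suc zero = finish U₄-G
  where
  expand : ∀ {f} → U₄ G ≈ φ ⊕ C (+ 4) · (φ · f) → ∃[ n ] ∃[ g ] Poly g × f ≈ C n ⊕ T · g → Iterate 0 (U₄ G)
  expand q (n , g , pg , f≈) = + 1 ℤ.+ + 4 ℤ.* n , g , pg , (q ⟫ ⊕-cong ≈-refl (·-cong ≈-refl (·-cong ≈-refl f≈))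
    ⟫ solve 3 (λ p n t → p :+ con (+ 4) :* (p :* (n :+ t)) := (con 1ℤ :+ con (+ 4) :* n) :* p
        :+ con (+ 4) :* (p :* t)) ≈-refl φ (C n) (T · g)
    ⟫ ⊕-cong (·-cong (≈-sym (C-+ _ _ ⟫ ⊕-cong ≈-refl (C-* (+ 4) n))) ≈-refl) ≈-refl)
  finish : ∃[ f ] Poly f × U₄ G ≈ φ ⊕ C (+ 4) · (φ · f) → Iterate 0 (U₄ G)
  finish (f , pf , q) = expand q (Poly-horner pf)
iterate-suc (suc α) = finish (iterate-suc α)
  where
  it = iterate (suc α)
  expand : ∀ {g} n → U₄ it ≈ C n · φ ⊕ C (4·8^ (suc α)) · (φ · g) →
    ∃[ n' ] ∃[ g' ] Poly g' × g ≈ C n' ⊕ T · g' → Iterate (suc α) (U₄ it)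
  expand n q (n' , g' , pg' , g≈) = n ℤ.+ 4·8^ (suc α) ℤ.* n' , g' , pg' , (q
      ⟫ ⊕-cong ≈-refl (·-cong ≈-refl (·-cong ≈-refl g≈))
    ⟫ solve 5 (λ n p c n' t → n :* p :+ c :* (p :* (n' :+ t)) := (n :+ c :* n') :* p :+ c :* (p :* t)) ≈-refl
        (C n) φ (C (4·8^ (suc α))) (C n') (T · g')
    ⟫ ⊕-cong (·-cong (≈-sym (C-+ _ _ ⟫ ⊕-cong ≈-refl (C-* (4·8^ (suc α)) n'))) ≈-refl) ≈-refl)
  apply : ∀ {f} n → it ≈ C n · φ ⊕ C (4·8^ α) · (φ · (T · f)) →
    ∃[ g ] Poly g × U₄ (φ · (T · f)) ≈ C (+ 8) · (φ · g) → Iterate (suc α) (U₄ it)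
  apply {f} n q (g , pg , q') = expand n (U₄-cong q ⟫ U₄-⊕ _ _
    ⟫ ⊕-cong (U₄-C· n φ ⟫ ·-cong ≈-refl U₄-φ) (U₄-C· (4·8^ α) _ ⟫ ·-cong ≈-refl q'
       ⟫ solve 3 (λ c e h → c :* (e :* h) := e :* c :* h) ≈-refl (C (4·8^ α)) (C (+ 8)) (φ · g)
           ⟫ ·-cong (≈-sym (C-* (+ 8) (4·8^ α))) ≈-refl))
    (Poly-horner pg)
  finish : Iterate α it → Iterate (suc α) (U₄ it)
  finish (n , f , pf , q) = apply n q (U₄-φT· pf)

Iterate′ : ℕ → Series → Set
Iterate′ α f = ∃[ n ] ∃[ g ] Poly g × f ≈ 2ψ · (C n ⊕ C (4·8^ α) · g)

-- At exponents congruent to 1 modulo 4 the series φ becomes 2ψ(q²). For α = 0 the constant 3 is the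
-- coefficient of D y in `G-split`.
U₄′-iterate : ∀ α → Iterate′ α (U₄′ (iterate α))
U₄′-iterate zero = + 3 , U₄′-G
U₄′-iterate (suc α) = finish (iterate-suc α)
  where
  it = iterate (suc α)
  apply : ∀ {f} n → it ≈ C n · φ ⊕ C (4·8^ α) · (φ · (T · f)) →
    ∃[ g ] Poly g × U₄′ (φ · (T · f)) ≈ C (+ 8) · (2ψ · g) → Iterate′ (suc α) (U₄′ it)
  apply n q (g , pg , q') = n , g , pg , (U₄′-cong q ⟫ U₄′-⊕ _ _
    ⟫ ⊕-cong (U₄′-C· n φ ⟫ ·-cong ≈-refl U₄′-φ) (U₄′-C· (4·8^ α) _ ⟫ ·-cong ≈-refl q')
    ⟫ solve 5 (λ n p c e g → n :* p :+ c :* (e :* (p :* g)) := p :* (n :+ e :* c :* g))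
        ≈-refl (C n) 2ψ (C (4·8^ α)) (C (+ 8)) g
    ⟫ ·-cong ≈-refl (⊕-cong ≈-refl (·-cong (≈-sym (C-* (+ 8) (4·8^ α))) ≈-refl)))
  finish : Iterate α it → Iterate′ (suc α) (U₄′ it)
  finish (n , f , pf , q) = apply n q (U₄′-φT· pf)

-- The even part of T modulo 128

private
  s r : Series
  s = dil w ² ⊕ X 1 · dil z ²
  r = dil w · dil z′ · (s · (s · (s · (s · (s · (s · s))))))

  S-dil : S ≈ dil s
  S-dil = ⊕-cong (≈-sym (dil-² (dil w))) y² ⟫ ≈-sym (dil-⊕ _ _)

  T/16 : Series
  T/16 = x · (y′ · (S · (S · (S · (S · (S · ((x ⊕ y) · ((x ⊕ y) · ((x ⊕ y) · (x ⊕ y))))))))))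

  T≈16 : T ≈ C (+ 16) · T/16
  T≈16 = T-split ⟫ solve 4 (λ x y s f → con (+ 8) :* (x :* (con (+ 2) :* y :* (s :* (s :* (s :* (s :* (s :* f))))))) := con (+ 16) :* (x :* (y :* (s :* (s :* (s :* (s :* (s :* f)))))))) ≈-refl
    x y′ S ((x ⊕ y) · ((x ⊕ y) · ((x ⊕ y) · (x ⊕ y))))

  odd-part : x · y′ · (S · (S · (S · (S · (S · (S · S)))))) ≈ X 1 · dil r
  odd-part = ·-cong ≈-refl (·-cong S-dil (·-cong S-dil (·-cong S-dil (·-cong S-dil (·-cong S-dil
      (·-cong S-dil S-dil))))))
    ⟫ solve 4 (λ x q z e → x :* (q :* z) :* e := q :* (x :* z :* e)) ≈-refl x (X 1) (dil (dil z′)) _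
    ⟫ ·-cong ≈-refl (≈-sym (dil-· _ _ ⟫ ·-cong (dil-· _ _)
        (dil-· _ _ ⟫ ·-cong ≈-refl (dil-· _ _ ⟫ ·-cong ≈-refl (dil-· _ _ ⟫ ·-cong ≈-refl (dil-· _ _
            ⟫ ·-cong ≈-refl (dil-· _ _ ⟫ ·-cong ≈-refl (dil-· _ _))))))))

  -- From (x + y)² = S + 2xy and y = 2y′ one gets (x + y)⁴ = S² + 8xy′(S + xy). The leading part x
  -- y′ S⁷ has only odd exponents, because x and S are series in q² and y′ is odd.
  T/16-split : T/16 ≈ X 1 · dil r ⊕ C (+ 8) · (x · y′ · (S · (S · (S · (S · S)))) · (x · y′ · (S ⊕ x · y)))
  T/16-split = solve 3 (λ x y s → let d = con (+ 2) :* y ; a = x :+ d ; u = x :* x :+ d :* d in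
      x :* (y :* (s :* (s :* (s :* (s :* (s :* (a :* (a :* (a :* a)))))))))
      := x :* y :* (s :* (s :* (s :* (s :* (s :* (u :* u))))))
          :+ con (+ 8) :* (x :* y :* (s :* (s :* (s :* (s :* s)))) :* (x :* y :* (u :+ x :* d))))
      ≈-refl x y′ S
    ⟫ ⊕-cong odd-part ≈-refl

ev-T : ∃[ h ] ev T ≈ C (+ 128) · h
ev-T = ev h , (ev-cong (T≈16 ⟫ ·-cong ≈-refl T/16-split) ⟫ ev-C· (+ 16) _
    ⟫ ·-cong ≈-refl (ev-⊕ _ _ ⟫ ⊕-cong (ev-X1· _ ⟫ ·-cong ≈-refl (od-dil r)) (ev-C· (+ 8) h))
    ⟫ solve 2 (λ x h → con (+ 16) :* (x :* con 0ℤ :+ con (+ 8) :* h) := con (+ 128) :* h) ≈-refl (X 1) (ev h))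
  where h = x · y′ · (S · (S · (S · (S · S)))) · (x · y′ · (S ⊕ x · y))

-- In f = n + n′T + T²g′ the last term is divisible by 16² = 256, and `ev-T` handles the middle one.
ev-Poly : ∀ {f} → Poly f → ∃[ n ] ∃[ h ] ev f ≈ C n ⊕ C (+ 128) · h
ev-Poly {f} p = first (Poly-horner p)
  where
  second : ∀ n {g} → f ≈ C n ⊕ T · g → ∃[ h ] ev T ≈ C (+ 128) · h → ∃[ n' ] ∃[ g' ] Poly g' × g ≈ C n' ⊕ T · g' →
    ∃[ n ] ∃[ h ] ev f ≈ C n ⊕ C (+ 128) · h
  second n f≈ (h , T≈) (n' , g' , _ , g≈) = n , C n' · h ⊕ C (+ 2) · ev (T/16 · T/16 · g') ,
    (ev-cong (f≈ ⟫ ⊕-cong ≈-refl (·-cong ≈-refl g≈ ⟫ expand))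
     ⟫ ev-⊕ _ _ ⟫ ⊕-cong (ev-C n) (ev-⊕ _ _ ⟫ ⊕-cong (ev-C· n' T ⟫ ·-cong ≈-refl T≈) (ev-C· (+ 256) _))
     ⟫ ⊕-cong ≈-refl (solve 3 (λ n' h e → n' :* (con (+ 128) :* h) :+ con (+ 256) :* e
         := con (+ 128) :* (n' :* h :+ con (+ 2) :* e)) ≈-refl
         (C n') h (ev (T/16 · T/16 · g'))))
    where
    expand : T · (C n' ⊕ T · g') ≈ C n' · T ⊕ C (+ 256) · (T/16 · T/16 · g')
    expand = solve 3 (λ t n f → t :* (n :+ t :* f) := n :* t :+ t :* t :* f) ≈-refl T (C n') g'
      ⟫ ⊕-cong ≈-refl (·-cong (·-cong T≈16 T≈16) ≈-refl
        ⟫ solve 2 (λ t f → con (+ 16) :* t :* (con (+ 16) :* t) :* f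
            := con (+ 256) :* (t :* t :* f)) ≈-refl T/16 g')
  first : ∃[ n ] ∃[ g ] Poly g × f ≈ C n ⊕ T · g → ∃[ n ] ∃[ h ] ev f ≈ C n ⊕ C (+ 128) · h
  first (n , g , pg , f≈) = second n f≈ ev-T (Poly-horner pg)

-- The 256 is the 2 of 2ψ(q²) times the 128 of `ev-Poly`.
iterate-8n+1 : ∀ α → ∃[ n ] ∃[ h ] ev (U₄′ (iterate α)) ≈ C n · ψ ⊕ C (+ 256 ℤ.* 4·8^ α) · h
iterate-8n+1 α = finish (U₄′-iterate α)
  where
  f = U₄′ (iterate α)
  expand : ∀ n {g} → f ≈ 2ψ · (C n ⊕ C (4·8^ α) · g) → ∃[ n' ] ∃[ h ] ev g ≈ C n' ⊕ C (+ 128) · h →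
    ∃[ n ] ∃[ h ] ev f ≈ C n · ψ ⊕ C (+ 256 ℤ.* 4·8^ α) · h
  expand n {g} q (n' , h , g≈) = + 2 ℤ.* (n ℤ.+ 4·8^ α ℤ.* n') , ψ · h ,
    (ev-cong (q ⟫ solve 3 (λ c p g → c :* p :* g := p :* (c :* g)) ≈-refl (C (+ 2)) (dil ψ) _)
     ⟫ ev-dil· ψ _ ⟫ ·-cong ≈-refl (ev-C· (+ 2) _ ⟫ ·-cong ≈-refl (ev-⊕ _ _
         ⟫ ⊕-cong (ev-C n) (ev-C· (4·8^ α) g ⟫ ·-cong ≈-refl g≈)))
     ⟫ solve 5 (λ p n c n' h → p :* (con (+ 2) :* (n :+ c :* (n' :+ con (+ 128) :* h)))
         := con (+ 2) :* (n :+ c :* n') :* p :+ con (+ 256) :* c :* (p :* h))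
         ≈-refl ψ (C n) (C (4·8^ α)) (C n') h
     ⟫ ⊕-cong (·-cong (≈-sym (C-* (+ 2) _ ⟫ ·-cong ≈-refl (C-+ _ _ ⟫ ⊕-cong ≈-refl (C-* _ n')))) ≈-refl)
              (·-cong (≈-sym (C-* (+ 256) (4·8^ α))) ≈-refl))
  finish : Iterate′ α f → ∃[ n ] ∃[ h ] ev f ≈ C n · ψ ⊕ C (+ 256 ℤ.* 4·8^ α) · h
  finish (n , g , pg , q) = expand n q (ev-Poly pg)

-- Coefficients at nonsquares

open import Data.Nat.Base using (_+_; _*_; _^_; _≤_; _<_; nonTrivial⇒n>1)
open import Data.Nat.Divisibility using () renaming (_∣_ to _∣ℕ_)
open import Data.Nat.Primality using (Prime; prime⇒nonZero; prime⇒nonTrivial; euclidsLemma)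
open import Data.Integer.Divisibility.Signed using (_∣_; divides; _∣?_)

iterate-at : ∀ α n → iterate α n ≡ G (4 ^ α * n)
iterate-at zero    n = cong G (sym (ℕₚ.+-identityʳ n))
iterate-at (suc α) n = trans (trans (ev-at _ n) (ev-at _ (dbl n))) (trans (iterate-at α (dbl (dbl n)))
    (cong G index))
  where
  regroup : ∀ a n → a * (n + n + (n + n)) ≡ 4 * a * n
  regroup = ℕ-Solver.solve-∀
  index : 4 ^ α * dbl (dbl n) ≡ 4 * 4 ^ α * n
  index = trans (cong (4 ^ α *_) (trans (dbl≡+ (dbl n)) (cong₂ _+_ (dbl≡+ n) (dbl≡+ n)))) (regroup (4 ^ α) n)

G-at : ∀ n → 0 < n → G n ≡ + 2 ℤ.* v₀ (4 * n)
G-at (suc n) _ = begin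
  G (suc n)                                            ≡⟨ ⊕-at _ _ (suc n) ⟩
  (C (+ 2) · U₄ v₀) (suc n) ℤ.+ (⊝ 1#) (suc n)         ≡⟨ cong₂ ℤ._+_ (C·-at (+ 2) (U₄ v₀) (suc n))
                                                           (trans (⊝-at 1# (suc n)) (cong ℤ.-_ (C-at-suc 1ℤ n))) ⟩
  + 2 ℤ.* U₄ v₀ (suc n) ℤ.+ 0ℤ                         ≡⟨ ℤₚ.+-identityʳ _ ⟩
  + 2 ℤ.* U₄ v₀ (suc n)                                ≡⟨ cong (ℤ._*_ (+ 2))
      (trans (ev-at _ (suc n)) (ev-at v₀ (dbl (suc n)))) ⟩
  + 2 ℤ.* v₀ (dbl (dbl (suc n)))                       ≡⟨ cong (λ k → + 2 ℤ.* v₀ k) (quadruple (suc n)) ⟩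
  + 2 ℤ.* v₀ (4 * suc n) ∎
  where
  open ≡-Reasoning
  regroup : ∀ n → n + n + (n + n) ≡ 4 * n
  regroup = ℕ-Solver.solve-∀
  quadruple : ∀ n → dbl (dbl n) ≡ 4 * n
  quadruple n = trans (dbl≡+ (dbl n)) (trans (cong₂ _+_ (dbl≡+ n) (dbl≡+ n)) (regroup n))

odd-square-T△ : ∀ k → suc (k + k) * suc (k + k) ≡ 8 * T△ k + 1
odd-square-T△ k = trans (expand k) (trans (cong (λ t → 4 * t + 1) (sym (T△+T△ k))) (collect (T△ k)))
  where
  expand : ∀ k → suc (k + k) * suc (k + k) ≡ 4 * (k * suc k) + 1
  expand = ℕ-Solver.solve-∀
  collect : ∀ t → 4 * (t + t) + 1 ≡ 8 * t + 1
  collect = ℕ-Solver.solve-∀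

ψ-support : ∀ N → (∀ m → m * m ≢ 8 * N + 1) → ψ N ≡ 0ℤ
ψ-support N nonsquare = ∑≤-zero N λ k _ → trans (sym (at (X-def (T△ k)) N)) (off-diagonal (T△ k) λ { refl →
  nonsquare (suc (k + k)) (odd-square-T△ k) })
  where
  off-diagonal : ∀ a → a ≢ N → (q^ a) N ≡ 0ℤ
  off-diagonal a a≢N with a ℕₚ.≟ N
  ... | yes a≡N = contradiction a≡N a≢N
  ... | no  _   = refl

-- The separate factor 2 cancels against the 2 in front of v₀ in `G`.
modulus : ∀ α → + 256 ℤ.* 4·8^ α ≡ + 2 ℤ.* + (2 ^ (3 * α + 9))
modulus zero    = refl
modulus (suc α) = begin
  + 256 ℤ.* (+ 8 ℤ.* 4·8^ α)              ≡⟨ swap (4·8^ α) ⟩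
  + 8 ℤ.* (+ 256 ℤ.* 4·8^ α)              ≡⟨ cong (ℤ._*_ (+ 8)) (modulus α) ⟩
  + 8 ℤ.* (+ 2 ℤ.* + (2 ^ (3 * α + 9)))   ≡⟨ swap′ (+ (2 ^ (3 * α + 9))) ⟩
  + 2 ℤ.* (+ 8 ℤ.* + (2 ^ (3 * α + 9)))   ≡⟨ cong (ℤ._*_ (+ 2)) (ℤₚ.pos-* 8 (2 ^ (3 * α + 9))) ⟨
  + 2 ℤ.* + (8 * 2 ^ (3 * α + 9))         ≡⟨ cong (λ k → + 2 ℤ.* + k)
      (trans (sym (ℕₚ.^-distribˡ-+-* 2 3 (3 * α + 9))) (cong (2 ^_) (exponent α))) ⟩
  + 2 ℤ.* + (2 ^ (3 * suc α + 9)) ∎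
  where
  open ≡-Reasoning
  swap : ∀ a → + 256 ℤ.* (+ 8 ℤ.* a) ≡ + 8 ℤ.* (+ 256 ℤ.* a)
  swap = ℤ-Solver.solve-∀
  swap′ : ∀ a → + 8 ℤ.* (+ 2 ℤ.* a) ≡ + 2 ℤ.* (+ 8 ℤ.* a)
  swap′ = ℤ-Solver.solve-∀
  exponent : ∀ α → 3 + (3 * α + 9) ≡ 3 * suc α + 9
  exponent = ℕ-Solver.solve-∀

nonsquare-divisible : ∀ α N → (∀ m → m * m ≢ 8 * N + 1) →
  + (2 ^ (3 * α + 9)) ∣ v₀ (2 ^ (2 * α + 2) * (8 * N + 1))
nonsquare-divisible α N nonsquare = finish (iterate-8n+1 α)
  where
  open ≡-Reasoning
  positive : 0 < 4 ^ α * (8 * N + 1)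
  positive = ℕₚ.*-mono-≤ (ℕₚ.m^n>0 4 α) (ℕₚ.m≤n+m 1 (8 * N))
  octuple : suc (dbl (dbl (dbl N))) ≡ 8 * N + 1
  octuple = trans (cong suc (trans (dbl≡+ (dbl (dbl N))) (cong₂ _+_ quadruple quadruple))) (collect N)
    where
    quadruple = trans (dbl≡+ (dbl N)) (cong₂ _+_ (dbl≡+ N) (dbl≡+ N))
    collect : ∀ n → suc (n + n + (n + n) + (n + n + (n + n))) ≡ 8 * n + 1
    collect = ℕ-Solver.solve-∀
  index : 4 * (4 ^ α * (8 * N + 1)) ≡ 2 ^ (2 * α + 2) * (8 * N + 1)
  index = begin
    4 * (4 ^ α * (8 * N + 1))            ≡⟨ ℕₚ.*-assoc 4 (4 ^ α) (8 * N + 1) ⟨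
    4 * 4 ^ α * (8 * N + 1)              ≡⟨ cong (_* (8 * N + 1)) (ℕₚ.*-comm 4 (4 ^ α)) ⟩
    4 ^ α * 4 * (8 * N + 1)              ≡⟨ cong (λ a → a * 4 * (8 * N + 1)) (ℕₚ.^-*-assoc 2 2 α) ⟩
    2 ^ (2 * α) * 2 ^ 2 * (8 * N + 1)    ≡⟨ cong (_* (8 * N + 1)) (ℕₚ.^-distribˡ-+-* 2 (2 * α) 2) ⟨
    2 ^ (2 * α + 2) * (8 * N + 1) ∎
  value : ev (U₄′ (iterate α)) N ≡ + 2 ℤ.* v₀ (2 ^ (2 * α + 2) * (8 * N + 1))
  value = begin
    ev (U₄′ (iterate α)) N                   ≡⟨ trans (ev-at _ N)
        (trans (ev-at _ (dbl N)) (od-at _ (dbl (dbl N)))) ⟩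
    iterate α (suc (dbl (dbl (dbl N))))      ≡⟨ cong (iterate α) octuple ⟩
    iterate α (8 * N + 1)                    ≡⟨ iterate-at α (8 * N + 1) ⟩
    G (4 ^ α * (8 * N + 1))                  ≡⟨ G-at _ positive ⟩
    + 2 ℤ.* v₀ (4 * (4 ^ α * (8 * N + 1)))   ≡⟨ cong (λ k → + 2 ℤ.* v₀ k) index ⟩
    + 2 ℤ.* v₀ (2 ^ (2 * α + 2) * (8 * N + 1)) ∎
  finish : ∃[ n ] ∃[ h ] ev (U₄′ (iterate α)) ≈ C n · ψ ⊕ C (+ 256 ℤ.* 4·8^ α) · h →
    + (2 ^ (3 * α + 9)) ∣ v₀ (2 ^ (2 * α + 2) * (8 * N + 1))
  finish (n , h , q) = divides (h N) (ℤₚ.*-cancelˡ-≡ (+ 2) _ _ (begin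
    + 2 ℤ.* v₀ (2 ^ (2 * α + 2) * (8 * N + 1))          ≡⟨ value ⟨
    ev (U₄′ (iterate α)) N                              ≡⟨ at q N ⟩
    (C n · ψ ⊕ C c · h) N                               ≡⟨ ⊕-at _ _ N ⟩
    (C n · ψ) N ℤ.+ (C c · h) N                         ≡⟨ cong₂ ℤ._+_ (C·-at n ψ N) (C·-at c h N) ⟩
    n ℤ.* ψ N ℤ.+ c ℤ.* h N                             ≡⟨ cong₂ ℤ._+_
        (trans (cong (ℤ._*_ n) (ψ-support N nonsquare)) (ℤₚ.*-zeroʳ n))
                                                             (cong (ℤ._* h N) (modulus α)) ⟩
    0ℤ ℤ.+ + 2 ℤ.* + (2 ^ (3 * α + 9)) ℤ.* h N          ≡⟨ regroup (+ (2 ^ (3 * α + 9))) (h N) ⟩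
    + 2 ℤ.* (h N ℤ.* + (2 ^ (3 * α + 9))) ∎))
    where
    c = + 256 ℤ.* 4·8^ α
    regroup : ∀ a b → 0ℤ ℤ.+ + 2 ℤ.* a ℤ.* b ≡ + 2 ℤ.* (b ℤ.* a)
    regroup = ℤ-Solver.solve-∀

-- Nonsquares congruent to 1 modulo 8

OneMod8 : ℕ → Set
OneMod8 m = ∃[ N ] m ≡ 8 * N + 1

OneMod8-* : ∀ {a b} → OneMod8 a → OneMod8 b → OneMod8 (a * b)
OneMod8-* (M , refl) (N , refl) = 8 * M * N + M + N , expand M N
  where
  expand : ∀ M N → (8 * M + 1) * (8 * N + 1) ≡ 8 * (8 * M * N + M + N) + 1
  expand = ℕ-Solver.solve-∀

OneMod8-^ : ∀ {a} n → OneMod8 a → OneMod8 (a ^ n)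
OneMod8-^ zero    _ = 0 , refl
OneMod8-^ (suc n) p = OneMod8-* p (OneMod8-^ n p)

odd-square-OneMod8 : ∀ p → ¬ (2 ∣ℕ p) → OneMod8 (p * p)
odd-square-OneMod8 p 2∤p with parity p
... | even k = contradiction (ℕ-Div.divides k (trans (dbl≡+ k) (double k))) 2∤p
  where
  double : ∀ k → k + k ≡ k * 2
  double = ℕ-Solver.solve-∀
... | odd k = T△ k , trans (cong (λ j → suc j * suc j) (dbl≡+ k)) (odd-square-T△ k)

even-power : ∀ p β → p ^ (2 * β) ≡ (p * p) ^ β
even-power p β = trans (sym (ℕₚ.^-*-assoc p 2 β)) (cong (λ a → (p * a) ^ β) (ℕₚ.*-identityʳ p))

∣square⇒∣ : ∀ {p} m → Prime p → p ∣ℕ m * m → p ∣ℕ m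
∣square⇒∣ m p-prime p∣m² with euclidsLemma m m p-prime p∣m²
... | inj₁ p∣m = p∣m
... | inj₂ p∣m = p∣m

-- Descent on β: p divides m², hence m, and p² can be cancelled on both sides.
square-cofactor : ∀ {p} → Prime p → ∀ β c m → m * m ≡ (p * p) ^ β * c → ∃[ l ] l * l ≡ c
square-cofactor p-prime zero c m eq = m , trans eq (ℕₚ.+-identityʳ c)
square-cofactor {p} p-prime (suc β) c m eq with ∣square⇒∣ m p-prime
  (ℕ-Div.divides (p * (p * p) ^ β * c) (trans eq (regroup p ((p * p) ^ β) c)))
  where
  regroup : ∀ p a c → p * p * a * c ≡ p * a * c * p
  regroup = ℕ-Solver.solve-∀
... | ℕ-Div.divides q refl = square-cofactor p-prime β c q (ℕₚ.*-cancelˡ-≡ _ _ (p * p)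
    (trans (square p q) (trans eq (ℕₚ.*-assoc (p * p) _ c))))
  where
  instance
    p≢0 = prime⇒nonZero p-prime
    p²≢0 = ℕₚ.m*n≢0 p p
  square : ∀ p q → p * p * (q * q) ≡ q * p * (q * p)
  square = ℕ-Solver.solve-∀

legendre≡-1⇒nonresidue : ∀ a {p} (p-prime : Prime p) → legendre a p-prime ≡ -1ℤ → ¬ IsSquareMod a p
legendre≡-1⇒nonresidue a {p} p-prime with + p ∣? a | isSquareMod? a p {{prime⇒nonZero p-prime}}
... | yes _ | _             = λ ()
... | no  _ | yes _         = λ ()
... | no  _ | no nonresidue = λ _ → nonresidue

odd-prime∤2^ : ∀ {p} → Prime p → ¬ (2 ∣ℕ p) → ∀ n → ¬ (p ∣ℕ 2 ^ n)
odd-prime∤2^ {p} p-prime 2∤p n p∣2^n = go n p∣2^n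
  where
  1<p : 1 < p
  1<p = nonTrivial⇒n>1 p {{prime⇒nonTrivial p-prime}}
  go : ∀ n → ¬ (p ∣ℕ 2 ^ n)
  go zero    p∣1 = ℕₚ.<⇒≱ 1<p (ℕ-Div.∣⇒≤ p∣1)
  go (suc n) p∣2^ with euclidsLemma 2 (2 ^ n) p-prime p∣2^
  ... | inj₁ p∣2 = 2∤p (ℕ-Div.∣-reflexive (ℕₚ.≤-antisym 1<p (ℕ-Div.∣⇒≤ p∣2)))
  ... | inj₂ p∣n = go n p∣n

corollary1p2 : ∀ (n α β p : ℕ) (p-prime : Prime p) → ¬ (2 ∣ℕ p) →
    (∀ (i : ℕ) → 1 ≤ i → i < p →
    + (2 ^ (3 * α + 9)) ∣ v₀ (2 ^ (2 * α + 2) * p ^ (2 * β + 1) * (8 * p * n + 8 * i + p)))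
    × (∀ (j : ℕ) → j < p → legendre (+ (8 * j + 1)) p-prime ≡ -1ℤ →
    + (2 ^ (3 * α + 9)) ∣ v₀ (2 ^ (2 * α + 2) * p ^ (2 * β) * (8 * p * n + 8 * j + 1)))
corollary1p2 n α β p p-prime 2∤p = ramified , nonresidue
  where
  instance
    p≢0 = prime⇒nonZero p-prime

  p²≡1 : OneMod8 (p * p)
  p²≡1 = odd-square-OneMod8 p 2∤p

  -- Common to both families: the square p^(2β) changes neither the residue 1 modulo 8, as p is odd,
  -- nor the property of being a nonsquare.
  from-cofactor : ∀ m c → m ≡ (p * p) ^ β * c → OneMod8 c → (∀ l → l * l ≢ c) →
    + (2 ^ (3 * α + 9)) ∣ v₀ (2 ^ (2 * α + 2) * m)
  from-cofactor m c m≡ c≡1 c-nonsquare = finish (OneMod8-* (OneMod8-^ β p²≡1) c≡1)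
    where
    finish : OneMod8 ((p * p) ^ β * c) → + (2 ^ (3 * α + 9)) ∣ v₀ (2 ^ (2 * α + 2) * m)
    finish (N , eq) = subst (λ k → + (2 ^ (3 * α + 9)) ∣ v₀ (2 ^ (2 * α + 2) * k)) (sym (trans m≡ eq))
      (nonsquare-divisible α N λ m m²≡ →
        let l , l²≡c = square-cofactor p-prime β c m (trans m²≡ (sym eq)) in c-nonsquare l l²≡c)

  ramified : ∀ i → 1 ≤ i → i < p →
    + (2 ^ (3 * α + 9)) ∣ v₀ (2 ^ (2 * α + 2) * p ^ (2 * β + 1) * (8 * p * n + 8 * i + p))
  ramified i 1≤i i<p = subst (λ k → + (2 ^ (3 * α + 9)) ∣ v₀ k)
      (sym (ℕₚ.*-assoc (2 ^ (2 * α + 2)) (p ^ (2 * β + 1)) c))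
    (from-cofactor (p ^ (2 * β + 1) * c) (p * c) split (one-mod-8 p²≡1) nonsquare)
    where
    c = 8 * p * n + 8 * i + p
    -- The odd factor p joins c, and p c ≡ p² ≡ 1 modulo 8.
    split : p ^ (2 * β + 1) * c ≡ (p * p) ^ β * (p * c)
    split = trans (cong (_* c) (trans (ℕₚ.^-distribˡ-+-* p (2 * β) 1)
        (cong₂ _*_ (even-power p β) (ℕₚ.*-identityʳ p))))
      (ℕₚ.*-assoc ((p * p) ^ β) p c)
    one-mod-8 : OneMod8 (p * p) → OneMod8 (p * c)
    one-mod-8 (N , eq) = p * (p * n + i) + N , trans (expand p n i)
        (trans (cong (_+_ (8 * (p * (p * n + i)))) eq) (collect (p * (p * n + i)) N))
      where
      expand : ∀ p n i → p * (8 * p * n + 8 * i + p) ≡ 8 * (p * (p * n + i)) + p * p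
      expand = ℕ-Solver.solve-∀
      collect : ∀ a N → 8 * a + (8 * N + 1) ≡ 8 * (a + N) + 1
      collect = ℕ-Solver.solve-∀
    -- Modulo p the number c is 8i with 0 < i < p. So p divides p c exactly once, which rules out a
    -- square.
    p∤c : ¬ (p ∣ℕ c)
    p∤c p∣c with euclidsLemma 8 i p-prime (ℕ-Div.∣m+n∣m⇒∣n
      (ℕ-Div.∣m+n∣m⇒∣n (subst (p ∣ℕ_) (rotate p n i) p∣c) ℕ-Div.∣-refl) (ℕ-Div.n∣m*n*o 8 n))
      where
      rotate : ∀ p n i → 8 * p * n + 8 * i + p ≡ p + (8 * p * n + 8 * i)
      rotate = ℕ-Solver.solve-∀
    ... | inj₁ p∣8 = odd-prime∤2^ p-prime 2∤p 3 p∣8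
    ... | inj₂ p∣i = ℕₚ.<⇒≱ i<p (ℕ-Div.∣⇒≤ {{ℕ.>-nonZero 1≤i}} p∣i)
    nonsquare : ∀ l → l * l ≢ p * c
    nonsquare l eq with ∣square⇒∣ l p-prime (ℕ-Div.divides c (trans eq (ℕₚ.*-comm p c)))
    ... | ℕ-Div.divides q refl = p∤c (ℕ-Div.divides (q * q) (ℕₚ.*-cancelˡ-≡ c (q * q * p) p
        (trans (sym eq) (regroup p q))))
      where
      regroup : ∀ p q → q * p * (q * p) ≡ p * (q * q * p)
      regroup = ℕ-Solver.solve-∀

  nonresidue : ∀ j → j < p → legendre (+ (8 * j + 1)) p-prime ≡ -1ℤ →
    + (2 ^ (3 * α + 9)) ∣ v₀ (2 ^ (2 * α + 2) * p ^ (2 * β) * (8 * p * n + 8 * j + 1))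
  nonresidue j _ leg = subst (λ k → + (2 ^ (3 * α + 9)) ∣ v₀ k) (sym (ℕₚ.*-assoc (2 ^ (2 * α + 2)) (p ^ (2 * β)) c))
    (from-cofactor (p ^ (2 * β) * c) c (cong (_* c) (even-power p β)) (p * n + j , collect p n j) nonsquare)
    where
    c = 8 * p * n + 8 * j + 1
    collect : ∀ p n j → 8 * p * n + 8 * j + 1 ≡ 8 * (p * n + j) + 1
    collect = ℕ-Solver.solve-∀
    -- Since c = 8j + 1 + 8np, a square root of c would be a root of 8j + 1 modulo p.
    nonsquare : ∀ l → l * l ≢ c
    nonsquare l l²≡c = legendre≡-1⇒nonresidue (+ (8 * j + 1)) p-prime leg (+ l , divides (+ (8 * n)) (begin
      + l ℤ.* + l ℤ.- + (8 * j + 1)                       ≡⟨ cong (ℤ._- + (8 * j + 1))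
          (trans (sym (ℤₚ.pos-* l l)) (cong +_ l²≡c)) ⟩
      + (8 * p * n + 8 * j + 1) ℤ.- + (8 * j + 1)         ≡⟨ cong (λ k → + k ℤ.- + (8 * j + 1)) (regroup p n j) ⟩
      + (8 * n * p) ℤ.+ + (8 * j + 1) ℤ.- + (8 * j + 1)   ≡⟨ cancel (+ (8 * n * p)) (+ (8 * j + 1)) ⟩
      + (8 * n * p)                                       ≡⟨ ℤₚ.pos-* (8 * n) p ⟩
      + (8 * n) ℤ.* + p ∎))
      where
      open ≡-Reasoning
      regroup : ∀ p n j → 8 * p * n + 8 * j + 1 ≡ 8 * n * p + (8 * j + 1)
      regroup = ℕ-Solver.solve-∀
      cancel : ∀ a b → a ℤ.+ b ℤ.- b ≡ a
      cancel = ℤ-Solver.solve-∀
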